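{- Let $\Gamma$ be a geometric distance-regular graph with respect to $\mathcal C$, having valency $k$, smallest eigenvalue $\theta_{\min}$, and diameter $D \geq 3$. Let $r = -\theta_{\min}$ and $\beta = \frac{k}{ -\theta_{\min}}$. If $\beta \geq (r -\tau_2 + 1)(\phi_2-\phi_1)+\phi_1$, then $\Gamma$ satisfies the ELS property.
   Context: A connected graph $\Gamma$ of diameter $D$ is distance-regular if there are integers $b_i, c_i$ such that for all vertices $x,y$ at distance $i$, $y$ has exactly $c_i$ neighbours at distance $i-1$ from $x$ and $b_i$ neighbours at distance $i+1$ from $x$; $k=b_0$. A Delsarte clique is a clique with exactly $1+k/(-\theta_{\min})$ vertices. For a Delsarte clique $C$ and vertex $x$ at distance $j$ from $C$ (minimum distance to a vertex of $C$), $\phi_j$ is the number of vertices of $C$ at distance $j$ from $x$ (depends only on $j$). $\Gamma$ is geometric with respect to $\mathcal{C}$ if $\mathcal{C}$ is a set of Delsarte cliques (called lines) with each edge in exactly one line; then for vertices $x,y$ at distance $j$, $\tau_j$ is the number of lines containing $y$ at distance $j-1$ from $x$ (depends only on $j$). For vertices $x,z$ at distance $2$, $[x,z]$ denotes the set of lines containing $x$ at distance $1$ from $z$. $\Gamma$ has the ELS (equal line set) property if for every vertex $x$, every line $\ell$ with $d(x,\ell)=1$, and all distinct vertices $y_1,y_2\in\ell$ at distance $2$ from $x$, we have $[x,y_1]=[x,y_2]$. -}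

module Defs where

open import Data.Nat as ℕ using (ℕ; zero; suc; _∸_)
open import Data.Bool using (Bool; true; false; _∧_; _∨_; if_then_else_)
open import Data.Fin using (Fin; zero; suc; _≟_)
open import Data.List using (List; []; _∷_; _++_; [_]; length)
open import Data.Sum using (_⊎_)
open import Data.Product using (Σ; ∃; _×_; _,_)
open import Relation.Nullary using (¬_)
open import Relation.Nullary.Decidable using (⌊_⌋)
open import Relation.Binary.PropositionalEquality using (_≡_; _≢_)
open import Algebra.Structures using (IsCommutativeRing)

record Graph (n : ℕ) : Set where
  field
    adj    : Fin n → Fin n → Bool
    sym    : ∀ x y → adj x y ≡ adj y x
    irrefl : ∀ x → adj x x ≡ false

anyF : ∀ {n} → (Fin n → Bool) → Bool
anyF {zero}  p = false
anyF {suc n} p = p zero ∨ anyF (λ i → p (suc i))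

count : ∀ {n} → (Fin n → Bool) → ℕ
count {zero}  p = 0
count {suc n} p = (if p zero then 1 else 0) ℕ.+ count (λ i → p (suc i))

-- least j < m with p j, or m if there is none
least : (ℕ → Bool) → ℕ → ℕ
least p zero    = zero
least p (suc m) = if p zero then zero else suc (least (λ j → p (suc j)) m)

module _ {n : ℕ} (G : Graph n) where
  open Graph G

  reach : Fin n → Fin n → ℕ → Bool
  reach x y zero    = ⌊ x ≟ y ⌋
  reach x y (suc j) = reach x y j ∨ anyF (λ z → adj x z ∧ reach z y j)

  -- graph distance (a shortest walk has length < n; value n means unreachable)
  dist : Fin n → Fin n → ℕ
  dist x y = least (reach x y) n

  Connected : Set
  Connected = ∀ x y → ∃ λ j → reach x y j ≡ true

  HasDiameter : ℕ → Set
  HasDiameter D = (∀ x y → dist x y ℕ.≤ D) × ∃ λ x → ∃ λ y → dist x y ≡ D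

  -- distance-regular with diameter D and intersection numbers b_i, c_i (k = b 0)
  IsDRG : ℕ → (ℕ → ℕ) → (ℕ → ℕ) → Set
  IsDRG D b c = Connected × HasDiameter D ×
    (∀ x y i → dist x y ≡ i →
        (count (λ z → adj y z ∧ ⌊ dist x z ℕ.≟ i ∸ 1 ⌋) ≡ c i)
      × (count (λ z → adj y z ∧ ⌊ dist x z ℕ.≟ suc i ⌋) ≡ b i))

  IsClique : (Fin n → Bool) → Set
  IsClique C = ∀ x y → C x ≡ true → C y ≡ true → x ≢ y → adj x y ≡ true

  -- d(x, C) = min distance from x to a vertex of C (n if C is empty)
  distSet : Fin n → (Fin n → Bool) → ℕ
  distSet x C = least (λ j → anyF (λ y → C y ∧ ⌊ dist x y ℕ.≟ j ⌋)) n

  module Lines {L : ℕ} (line : Fin L → Fin n → Bool) where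

    bracket : Fin n → Fin n → Fin L → Bool
    bracket x z m = line m x ∧ ⌊ distSet z (line m) ℕ.≟ 1 ⌋

    ELS : Set
    ELS = ∀ x (l : Fin L) → distSet x (line l) ≡ 1 →
          ∀ y₁ y₂ → line l y₁ ≡ true → line l y₂ ≡ true → y₁ ≢ y₂ →
          dist x y₁ ≡ 2 → dist x y₂ ≡ 2 →
          ∀ m → bracket x y₁ m ≡ bracket x y₂ m

-- Real closed fields (the real numbers up to elementary equivalence)

evalPoly : {A : Set} → (A → A → A) → (A → A → A) → A → List A → A → A
evalPoly _+_ _*_ 0# []       x = 0#
evalPoly _+_ _*_ 0# (a ∷ as) x = a + (x * evalPoly _+_ _*_ 0# as x)

record RealClosedField : Set₁ where
  infixl 7 _*_
  infixl 6 _+_ _-_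
  infix  4 _≤_
  field
    Carrier : Set
    _+_ _*_ : Carrier → Carrier → Carrier
    -_      : Carrier → Carrier
    0# 1#   : Carrier
    _⁻¹     : Carrier → Carrier
    _≤_     : Carrier → Carrier → Set
    isCommutativeRing : IsCommutativeRing _≡_ _+_ _*_ -_ 0# 1#
    0≢1       : 0# ≢ 1#
    ⁻¹-inverse : ∀ x → x ≢ 0# → x * (x ⁻¹) ≡ 1#
    ≤-refl    : ∀ x → x ≤ x
    ≤-antisym : ∀ {x y} → x ≤ y → y ≤ x → x ≡ y
    ≤-trans   : ∀ {x y z} → x ≤ y → y ≤ z → x ≤ z
    ≤-total   : ∀ x y → (x ≤ y) ⊎ (y ≤ x)
    +-mono-≤  : ∀ {x y} z → x ≤ y → x + z ≤ y + z
    *-nonneg  : ∀ {x y} → 0# ≤ x → 0# ≤ y → 0# ≤ x * y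
    sqrt      : ∀ x → 0# ≤ x → ∃ λ y → y * y ≡ x
    oddRoot   : ∀ (cs : List Carrier) (lead : Carrier) (m : ℕ) →
                length cs ≡ suc (2 ℕ.* m) → lead ≢ 0# →
                ∃ λ x → evalPoly _+_ _*_ 0# (cs ++ [ lead ]) x ≡ 0#
  _-_ : Carrier → Carrier → Carrier
  x - y = x + (- y)

module Spectral (R : RealClosedField) where
  open RealClosedField R

  fromℕ : ℕ → Carrier
  fromℕ zero    = 0#
  fromℕ (suc m) = 1# + fromℕ m

  sumR : ∀ {n} → (Fin n → Carrier) → Carrier
  sumR {zero}  f = 0#
  sumR {suc n} f = f zero + sumR (λ i → f (suc i))

  module _ {n : ℕ} (G : Graph n) where
    open Graph G

    A : Fin n → Fin n → Carrier
    A i j = if adj i j then 1# else 0#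

    IsEigenvalue : Carrier → Set
    IsEigenvalue θ = ∃ λ (v : Fin n → Carrier) →
      (∃ λ i → v i ≢ 0#) × (∀ i → sumR (λ j → A i j * v j) ≡ θ * v i)

    IsSmallestEigenvalue : Carrier → Set
    IsSmallestEigenvalue θ = IsEigenvalue θ × (∀ μ → IsEigenvalue μ → θ ≤ μ)

    IsDelsarte : ℕ → Carrier → (Fin n → Bool) → Set
    IsDelsarte k θ C = IsClique G C × (fromℕ (count C) ≡ 1# + fromℕ k * ((- θ) ⁻¹))

    IsGeometric : ℕ → Carrier → {L : ℕ} → (Fin L → Fin n → Bool) → Set
    IsGeometric k θ line = (∀ m → IsDelsarte k θ (line m)) ×
      (∀ x y → adj x y ≡ true → count (λ m → line m x ∧ line m y) ≡ 1)

    IsPhi : ℕ → Carrier → (ℕ → ℕ) → Set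
    IsPhi k θ φ = ∀ C → IsDelsarte k θ C → ∀ x j → distSet G x C ≡ j →
      count (λ y → C y ∧ ⌊ dist G x y ℕ.≟ j ⌋) ≡ φ j

    IsTau : {L : ℕ} → (Fin L → Fin n → Bool) → (ℕ → ℕ) → Set
    IsTau line τ = ∀ x y j → 1 ℕ.≤ j → dist G x y ≡ j →
      count (λ m → line m y ∧ ⌊ distSet G x (line m) ℕ.≟ j ∸ 1 ⌋) ≡ τ j

{-# OPTIONS --safe #-}
module Submission where

-- Suppose m₁ ∈ [x , y₂] but m₁ ∉ [x , y₁] for two points of a line l at distance 1
-- from x.  Every point y of l at distance 2 from x has m₁ ∈ [x , y], or, as all the
-- sets [x , y] have τ₂ elements, some line of [x , y] lies outside [x , y₂].  A line
-- m through x that is missing from some [x , y′] belongs to [x , y] for at most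
-- φ₂ - φ₁ points y (count the adjacent pairs between m and l), so l has at most
-- (ρ - τ₂ + 1) (φ₂ - φ₁) points at distance 2 from x, where ρ is the number of
-- lines through x.  As l has β + 1 - φ₁ of them, this contradicts the hypothesis,
-- provided that ρ = r.
--
-- Counting neighbours gives ρ β = k, and this yields ρ = r once θ ≠ 0, as 0 ⁻¹ is
-- unspecified.  An edge makes the adjacency form indefinite, so θ < 0 follows
-- from the spectral theorem for symmetric matrices over a real closed field.  Only
-- square roots and roots of polynomials of odd degree are available, hence, as in
-- the linear algebra proof of the fundamental theorem of algebra, one uses
-- induction on the power of 2 dividing the dimension d: in odd dimension some
-- vector has a minimal polynomial of odd degree, and in even dimension a common
-- eigenvector of A ⊗ 1 + 1 ⊗ A and A ⊗ A on the symmetric square, of dimension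
-- d (d + 1) / 2, provides a quadratic equation for A.

open import Defs
open import Algebra.Bundles using (CommutativeRing)
import Algebra.Properties.CommutativeSemigroup
import Algebra.Properties.Ring
import Algebra.Properties.Semiring.Mult.TCOptimised
import Algebra.Properties.Semiring.Sum
import Algebra.Solver.Ring
import Algebra.Solver.Ring.AlmostCommutativeRing as ACR
open import Algebra.Structures using (IsCommutativeRing)
open import Data.Bool using (Bool; true; false; if_then_else_)
open import Data.Bool.Properties using () renaming (_≟_ to _≟ᵇ_)
open import Data.Empty using (⊥; ⊥-elim)
open import Data.Fin as Fin using (Fin; zero; suc; toℕ; fromℕ<)
open import Data.Fin.Properties using (any?; suc-injective; toℕ<n; toℕ-injective; toℕ-fromℕ<)
open import Data.Integer as ℤ using (ℤ)
import Data.Integer.Properties as ℤ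
open import Data.List using (List; []; _∷_; _++_; [_]; length)
import Data.Maybe
open import Data.Nat as ℕ using (ℕ; zero; suc)
open import Data.Nat.Divisibility using (_∣_; _∣?_; divides; ∣m∣n⇒∣m+n; ∣m+n∣m⇒∣n; *-cancelˡ-∣; *-monoʳ-∣; ∣⇒≤; ∣-trans; ∣1⇒≡1; m∣m*n; _∣0)
open import Data.Nat.Primality using (prime?; euclidsLemma)
import Data.Nat.Properties as ℕ
open import Data.Nat.Tactic.RingSolver using (solve-∀)
open import Data.Product using (∃; ∃₂; _×_; _,_; proj₁; proj₂)
open import Data.Sum using (_⊎_; inj₁; inj₂)
open import Data.Unit using (⊤; tt)
open import Function using (_∘_)
open import Level using (0ℓ)
open import Relation.Binary.PropositionalEquality as ≡ using (_≡_; _≢_)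
open import Relation.Nullary using (¬_; Dec; yes; no)
open import Relation.Nullary.Decidable using (⌊_⌋; _×-dec_; dec⇒maybe; toWitness)

-- Some choices in the spectral part, such as that of a non-null vector in a subspace given by a
-- predicate, are not constructive. They do no harm: the goal is an equation between Booleans whose
-- failure is refuted outright, so eigenvectors and field equations are needed only up to double
-- negation, and `Classically` is the monad in which they are combined. The symmetric square of a
-- space with index set I is realised inside the functions on I × I. The induction therefore treats
-- invariant subspaces of function spaces, for all index sets at once. Operators are known through
-- self-adjointness alone, and vectors are tested by inner products. The one spectral fact that the
-- counting argument uses is θ ≠ 0. If 0 were the smallest eigenvalue, no eigenvalue would be
-- negative and the adjacency form would be nonnegative. Once r = - θ is invertible, r s = k = ρ s,
-- with s + 1 the size of a line, forces r = ρ.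

Classically : ∀ {a} → Set a → Set a
Classically P = ¬ ¬ P

pure : ∀ {a} {P : Set a} → P → Classically P
pure p k = k p

infixl 1 _>>=_
_>>=_ : ∀ {a b} {P : Set a} {Q : Set b} → Classically P → (P → Classically Q) → Classically Q
(m >>= f) k = m λ p → f p k

excludedMiddle : ∀ {a} (P : Set a) → Classically (Dec P)
excludedMiddle P k = k (no (k ∘ yes))

-- Normalisation in commutative rings; integer coefficients have decidable equality.

module IntegerCoefficientSolver (K : CommutativeRing 0ℓ 0ℓ) where
  open CommutativeRing K
  open import Data.Integer using (+_; -[1+_])
  open Algebra.Properties.Ring ring
  open Algebra.Properties.Semiring.Mult.TCOptimised semiring using (×-homo-+; ×1-homo-*; 1+×) renaming (_×_ to _×′_)
  open import Relation.Binary.Reasoning.Setoid setoid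

  nat : ℕ → Carrier
  nat n = n ×′ 1#

  ⟦_⟧ : ℤ → Carrier
  ⟦ + n ⟧ = nat n
  ⟦ -[1+ n ] ⟧ = - nat (suc n)

  ⟦⟧-homo-⊖ : ∀ m n → ⟦ m ℤ.⊖ n ⟧ ≈ nat m - nat n
  ⟦⟧-homo-⊖ m zero = sym (trans (+-congˡ -0#≈0#) (+-identityʳ _))
  ⟦⟧-homo-⊖ zero (suc n) = sym (+-identityˡ _)
  ⟦⟧-homo-⊖ (suc m) (suc n) = begin
    ⟦ suc m ℤ.⊖ suc n ⟧                 ≡⟨ ≡.cong ⟦_⟧ (ℤ.[1+m]⊖[1+n]≡m⊖n m n) ⟩
    ⟦ m ℤ.⊖ n ⟧                         ≈⟨ ⟦⟧-homo-⊖ m n ⟩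
    nat m - nat n                       ≈⟨ +-congʳ (+-identityʳ _) ⟨
    nat m + 0# - nat n                  ≈⟨ +-congʳ (+-congˡ (-‿inverseʳ 1#)) ⟨
    nat m + (1# - 1#) - nat n           ≈⟨ +-congʳ (+-assoc _ _ _) ⟨
    nat m + 1# - 1# - nat n             ≈⟨ +-assoc _ _ _ ⟩
    nat m + 1# + (- 1# - nat n)         ≈⟨ +-cong (+-comm _ _) (-‿+-comm 1# (nat n)) ⟩
    1# + nat m - (1# + nat n)           ≈⟨ +-cong (1+× m 1#) (-‿cong (1+× n 1#)) ⟨
    nat (suc m) - nat (suc n)           ∎

  ⟦⟧-homo-+ : ∀ i j → ⟦ i ℤ.+ j ⟧ ≈ ⟦ i ⟧ + ⟦ j ⟧
  ⟦⟧-homo-+ (+ m) (+ n) = ×-homo-+ 1# m n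
  ⟦⟧-homo-+ (+ m) -[1+ n ] = ⟦⟧-homo-⊖ m (suc n)
  ⟦⟧-homo-+ -[1+ m ] (+ n) = trans (⟦⟧-homo-⊖ n (suc m)) (+-comm _ _)
  ⟦⟧-homo-+ -[1+ m ] -[1+ n ] = begin
    - nat (suc (suc (m ℕ.+ n)))        ≡⟨ ≡.cong (λ k → - nat (suc k)) (≡.sym (ℕ.+-suc m n)) ⟩
    - nat (suc m ℕ.+ suc n)            ≈⟨ -‿cong (×-homo-+ 1# (suc m) (suc n)) ⟩
    - (nat (suc m) + nat (suc n))      ≈⟨ -‿+-comm _ _ ⟨
    - nat (suc m) - nat (suc n)        ∎

  ⟦⟧-homo-neg : ∀ i → ⟦ ℤ.- i ⟧ ≈ - ⟦ i ⟧
  ⟦⟧-homo-neg (+ zero) = sym -0#≈0#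
  ⟦⟧-homo-neg (+ suc n) = refl
  ⟦⟧-homo-neg -[1+ n ] = sym (-‿involutive _)

  ⟦⟧-homo-*ʳ : ∀ m j → ⟦ + m ℤ.* j ⟧ ≈ nat m * ⟦ j ⟧
  ⟦⟧-homo-*ʳ m (+ n) = trans (reflexive (≡.cong ⟦_⟧ (≡.sym (ℤ.pos-* m n)))) (×1-homo-* m n)
  ⟦⟧-homo-*ʳ m j@(-[1+ n ]) = begin
    ⟦ + m ℤ.* j ⟧               ≡⟨ ≡.cong ⟦_⟧ (≡.sym (ℤ.neg-distribʳ-* (+ m) (+ suc n))) ⟩
    ⟦ ℤ.- (+ m ℤ.* + suc n) ⟧   ≈⟨ ⟦⟧-homo-neg (+ m ℤ.* + suc n) ⟩
    - ⟦ + m ℤ.* + suc n ⟧       ≈⟨ -‿cong (⟦⟧-homo-*ʳ m (+ suc n)) ⟩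
    - (nat m * nat (suc n))     ≈⟨ -‿distribʳ-* _ _ ⟩
    nat m * ⟦ j ⟧               ∎

  ⟦⟧-homo-* : ∀ i j → ⟦ i ℤ.* j ⟧ ≈ ⟦ i ⟧ * ⟦ j ⟧
  ⟦⟧-homo-* (+ m) j = ⟦⟧-homo-*ʳ m j
  ⟦⟧-homo-* i@(-[1+ m ]) j = begin
    ⟦ i ℤ.* j ⟧                 ≡⟨ ≡.cong ⟦_⟧ (≡.sym (ℤ.neg-distribˡ-* (+ suc m) j)) ⟩
    ⟦ ℤ.- (+ suc m ℤ.* j) ⟧     ≈⟨ ⟦⟧-homo-neg (+ suc m ℤ.* j) ⟩
    - ⟦ + suc m ℤ.* j ⟧         ≈⟨ -‿cong (⟦⟧-homo-*ʳ (suc m) j) ⟩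
    - (nat (suc m) * ⟦ j ⟧)     ≈⟨ -‿distribˡ-* _ _ ⟩
    ⟦ i ⟧ * ⟦ j ⟧               ∎

  morphism : ℤ.+-*-rawRing ACR.-Raw-AlmostCommutative⟶ ACR.fromCommutativeRing K
  morphism = record
    { ⟦_⟧    = ⟦_⟧
    ; +-homo = ⟦⟧-homo-+
    ; *-homo = ⟦⟧-homo-*
    ; -‿homo = ⟦⟧-homo-neg
    ; 0-homo = refl
    ; 1-homo = refl
    }

  open Algebra.Solver.Ring ℤ.+-*-rawRing (ACR.fromCommutativeRing K) morphism
    (λ i j → Data.Maybe.map (reflexive ∘ ≡.cong ⟦_⟧) (dec⇒maybe (i ℤ.≟ j))) public
    using (Polynomial; solve; _:+_; _:*_; _:-_; :-_; _:=_; con)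

  :0 :1 : ∀ {n} → Polynomial n
  :0 = con (+ 0)
  :1 = con (+ 1)

-- Field and order laws up to double negation.

-- Equality in a real closed field need not be stable, so the linear algebra
-- is done up to double negated equality, which is decidable.
module StableField (R : RealClosedField) where
  private module F = RealClosedField R
  open F public using (Carrier; _+_; _*_; -_; 0#; 1#; _-_; _⁻¹)

  infix 4 _≈_ _≉_
  _≈_ _≉_ : Carrier → Carrier → Set
  x ≈ y = Classically (x ≡ y)
  x ≉ y = ¬ (x ≈ y)

  private
    lift₂ : ∀ (f : Carrier → Carrier → Carrier) {x y u v} → x ≈ y → u ≈ v → f x u ≈ f y v
    lift₂ f p q = p >>= λ p → q >>= λ q → pure (≡.cong₂ f p q)

  commutativeRing : CommutativeRing 0ℓ 0ℓ
  commutativeRing = record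
    { _≈_ = _≈_
    ; isCommutativeRing = record
      { isRing = record
        { +-isAbelianGroup = record
          { isGroup = record
            { isMonoid = record
              { isSemigroup = record
                { isMagma = record
                  { isEquivalence = record
                    { refl = pure ≡.refl
                    ; sym = λ p → p >>= λ p → pure (≡.sym p)
                    ; trans = λ p q → p >>= λ p → q >>= λ q → pure (≡.trans p q)
                    }
                  ; ∙-cong = lift₂ _+_
                  }
                ; assoc = λ x y z → pure (L.+-assoc x y z)
                }
              ; identity = pure ∘ L.+-identityˡ , pure ∘ L.+-identityʳ
              }
            ; inverse = pure ∘ L.-‿inverseˡ , pure ∘ L.-‿inverseʳ
            ; ⁻¹-cong = λ p → p >>= λ p → pure (≡.cong -_ p)
            }
          ; comm = λ x y → pure (L.+-comm x y)
          }
        ; *-cong = lift₂ _*_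
        ; *-assoc = λ x y z → pure (L.*-assoc x y z)
        ; *-identity = pure ∘ L.*-identityˡ , pure ∘ L.*-identityʳ
        ; distrib = (λ x y z → pure (L.distribˡ x y z)) , (λ x y z → pure (L.distribʳ x y z))
        }
      ; *-comm = λ x y → pure (L.*-comm x y)
      }
    }
    where module L = IsCommutativeRing F.isCommutativeRing

  open CommutativeRing commutativeRing public
    hiding (Carrier; _+_; _*_; -_; 0#; 1#; _-_; _≈_; _≉_; zero)
  open IntegerCoefficientSolver commutativeRing public
    using (solve; _:+_; _:*_; _:-_; :-_; _:=_; :0; :1)
  open import Relation.Binary.Reasoning.Setoid setoid

  -- The order enters only through its cone of nonnegative elements, with x ≤ y read as
  -- `Nonneg (y - x)`. The double negation makes the cone invariant under `_≈_`.
  Nonneg : Carrier → Set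
  Nonneg x = Classically (0# F.≤ x)

  ≤⇒Nonneg : ∀ {x y} → x F.≤ y → Nonneg (y - x)
  ≤⇒Nonneg {x} {y} x≤y = -‿inverseʳ x >>= λ e → pure (≡.subst (F._≤ (y - x)) e (F.+-mono-≤ (- x) x≤y))

  Nonneg-resp : ∀ {x y} → x ≈ y → Nonneg x → Nonneg y
  Nonneg-resp x≈y 0≤x = x≈y >>= λ x≡y → 0≤x >>= λ 0≤x → pure (≡.subst (0# F.≤_) x≡y 0≤x)

  Nonneg-+ : ∀ {x y} → Nonneg x → Nonneg y → Nonneg (x + y)
  Nonneg-+ {x} {y} 0≤x 0≤y = 0≤x >>= λ 0≤x → 0≤y >>= λ 0≤y → +-identityˡ y >>= λ e →
    pure (F.≤-trans (≡.subst (0# F.≤_) (≡.sym e) 0≤y) (F.+-mono-≤ y 0≤x))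

  Nonneg-* : ∀ {x y} → Nonneg x → Nonneg y → Nonneg (x * y)
  Nonneg-* 0≤x 0≤y = 0≤x >>= λ 0≤x → 0≤y >>= λ 0≤y → pure (F.*-nonneg 0≤x 0≤y)

  Nonneg-total : ∀ x → Nonneg x ⊎ Nonneg (- x)
  Nonneg-total x with F.≤-total 0# x
  ... | inj₁ 0≤x = inj₁ (pure 0≤x)
  ... | inj₂ x≤0 = inj₂ (Nonneg-resp (+-identityˡ (- x)) (≤⇒Nonneg x≤0))

  Nonneg-antisym : ∀ {x} → Nonneg x → Nonneg (- x) → x ≈ 0#
  Nonneg-antisym {x} 0≤x 0≤-x = 0≤x >>= λ 0≤x → 0≤-x >>= λ 0≤-x →
    +-identityˡ x >>= λ e₁ → -‿inverseˡ x >>= λ e₂ →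
    pure (F.≤-antisym (≡.subst₂ F._≤_ e₁ e₂ (F.+-mono-≤ x 0≤-x)) 0≤x)

  Nonneg-0 : Nonneg 0#
  Nonneg-0 = pure (F.≤-refl 0#)

  Nonneg-square : ∀ x → Nonneg (x * x)
  Nonneg-square x with Nonneg-total x
  ... | inj₁ 0≤x = Nonneg-* 0≤x 0≤x
  ... | inj₂ 0≤-x = Nonneg-resp (solve 1 (λ x → (:- x) :* (:- x) := x :* x) refl x) (Nonneg-* 0≤-x 0≤-x)

  1≉0 : 1# ≉ 0#
  1≉0 p = p λ q → F.0≢1 (≡.sym q)

  Nonneg-1 : Nonneg 1#
  Nonneg-1 = Nonneg-resp (*-identityˡ 1#) (Nonneg-square 1#)

  ¬Nonneg-neg1 : ¬ Nonneg (- 1#)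
  ¬Nonneg-neg1 0≤-1 = 1≉0 (Nonneg-antisym Nonneg-1 0≤-1)

  inverseʳ : ∀ {x} → x ≉ 0# → x * x ⁻¹ ≈ 1#
  inverseʳ {x} x≉0 = pure (F.⁻¹-inverse x (x≉0 ∘ pure))

  -- x * x ⁻¹ is 0 or 1 according to whether x vanishes, and comparing its
  -- double with 1 tells which.
  ≈0? : ∀ x → Dec (x ≈ 0#)
  ≈0? x with F.≤-total (e + e) 1#
    where e = x * x ⁻¹
  ... | inj₁ e+e≤1 = yes λ x≢0 → ¬Nonneg-neg1 (Nonneg-resp
          (trans (+-congˡ (-‿cong (+-cong (e≈1 x≢0) (e≈1 x≢0)))) (solve 0 (:1 :- (:1 :+ :1) := :- :1) refl))
          (≤⇒Nonneg e+e≤1))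
    where e≈1 : x ≢ 0# → x * x ⁻¹ ≈ 1#
          e≈1 x≢0 = pure (F.⁻¹-inverse x x≢0)
  ... | inj₂ 1≤e+e = no λ x≈0 → ¬Nonneg-neg1 (Nonneg-resp
          (trans (+-congʳ (+-cong (e≈0 x≈0) (e≈0 x≈0))) (solve 0 (:0 :+ :0 :- :1 := :- :1) refl))
          (≤⇒Nonneg 1≤e+e))
    where e≈0 : x ≈ 0# → x * x ⁻¹ ≈ 0#
          e≈0 x≈0 = trans (*-congʳ x≈0) (zeroˡ _)

  *-cancelˡ-≈0 : ∀ {x y} → x ≉ 0# → x * y ≈ 0# → y ≈ 0#
  *-cancelˡ-≈0 {x} {y} x≉0 xy≈0 = begin
    y                ≈⟨ *-identityˡ y ⟨
    1# * y           ≈⟨ *-congʳ (inverseʳ x≉0) ⟨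
    x * x ⁻¹ * y     ≈⟨ solve 3 (λ x i y → x :* i :* y := x :* y :* i) refl x (x ⁻¹) y ⟩
    x * y * x ⁻¹     ≈⟨ *-congʳ xy≈0 ⟩
    0# * x ⁻¹        ≈⟨ zeroˡ _ ⟩
    0#               ∎

  *-≉0 : ∀ {x y} → x ≉ 0# → y ≉ 0# → x * y ≉ 0#
  *-≉0 x≉0 y≉0 = y≉0 ∘ *-cancelˡ-≈0 x≉0

  x-y≈0⇒x≈y : ∀ {x y} → x - y ≈ 0# → x ≈ y
  x-y≈0⇒x≈y {x} {y} p = begin
    x          ≈⟨ solve 2 (λ x y → x := x :- y :+ y) refl x y ⟩
    x - y + y  ≈⟨ +-congʳ p ⟩
    0# + y     ≈⟨ +-identityˡ y ⟩
    y          ∎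

  Nonneg-sum≈0ˡ : ∀ {x y} → Nonneg x → Nonneg y → x + y ≈ 0# → x ≈ 0#
  Nonneg-sum≈0ˡ {x} {y} 0≤x 0≤y x+y≈0 = Nonneg-antisym 0≤x (Nonneg-resp y≈-x 0≤y)
    where
    y≈-x : y ≈ - x
    y≈-x = begin
      y            ≈⟨ solve 2 (λ x y → y := :- x :+ (x :+ y)) refl x y ⟩
      - x + (x + y) ≈⟨ +-congˡ x+y≈0 ⟩
      - x + 0#     ≈⟨ +-identityʳ _ ⟩
      - x          ∎

  square≈0 : ∀ {x} → x * x ≈ 0# → x ≈ 0#
  square≈0 {x} xx≈0 with ≈0? x
  ... | yes x≈0 = x≈0
  ... | no x≉0 = *-cancelˡ-≈0 x≉0 xx≈0

  -- Here d = p / q is a quotient of nonnegative elements. If totality returns the sign - d ≥ 0,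
  -- then p = d q is both nonnegative and nonpositive, so p and hence d vanish, and 0 is a root.
  sqrt-of-ratio : ∀ {p q d} → Nonneg p → Nonneg q → q ≉ 0# → p ≈ d * q → Classically (∃ λ δ → δ * δ ≈ d)
  sqrt-of-ratio {p} {q} {d} 0≤p 0≤q q≉0 p≈dq with Nonneg-total d
  ... | inj₁ 0≤d = 0≤d >>= λ 0≤d → let δ , e = F.sqrt d 0≤d in pure (δ , pure e)
  ... | inj₂ 0≤-d = pure (0# , trans (zeroˡ _) (sym (*-cancelˡ-≈0 q≉0 (begin
    q * d   ≈⟨ *-comm q d ⟩
    d * q   ≈⟨ p≈dq ⟨
    p       ≈⟨ Nonneg-antisym 0≤p (Nonneg-resp (trans (solve 2 (λ d q → (:- d) :* q := :- (d :* q)) refl d q) (-‿cong (sym p≈dq))) (Nonneg-* 0≤-d 0≤q)) ⟩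
    0#      ∎))))

  eval : List Carrier → Carrier → Carrier
  eval = evalPoly _+_ _*_ 0#

  monicOddRoot : ∀ cs m → length cs ≡ suc (2 ℕ.* m) → ∃ λ x → eval (cs ++ [ 1# ]) x ≈ 0#
  monicOddRoot cs m l = let x , e = F.oddRoot cs 1# m l (F.0≢1 ∘ ≡.sym) in x , pure e

-- Inner product spaces, orthogonal dimension and projection.

module LinearAlgebra (R : RealClosedField) where
  open StableField R
  open import Relation.Binary.Reasoning.Setoid setoid

  -- Linear combinations are the only vector operation, and vectors carry no equality. `definite`
  -- lets a vector of norm zero play the role of the zero vector.
  record InnerProductSpace : Set₁ where
    infix 8 _·_⊞_·_
    field
      Vector   : Set
      _·_⊞_·_  : Carrier → Vector → Carrier → Vector → Vector
      ⟨_,_⟩    : Vector → Vector → Carrier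
      ⟨⟩-comm  : ∀ x y → ⟨ x , y ⟩ ≈ ⟨ y , x ⟩
      ⟨⟩-linˡ  : ∀ a x b y z → ⟨ a · x ⊞ b · y , z ⟩ ≈ a * ⟨ x , z ⟩ + b * ⟨ y , z ⟩
      nonneg   : ∀ x → Nonneg ⟨ x , x ⟩
      definite : ∀ {x} → ⟨ x , x ⟩ ≈ 0# → ∀ y → ⟨ x , y ⟩ ≈ 0#

  module Space (X : InnerProductSpace) where
    open InnerProductSpace X public

    Null : Vector → Set
    Null x = ⟨ x , x ⟩ ≈ 0#

    -- Vectors are only ever compared through their inner products.
    infix 4 _≋_
    _≋_ : Vector → Vector → Set
    x ≋ y = ∀ z → ⟨ x , z ⟩ ≈ ⟨ y , z ⟩

    ≋-sym : ∀ {x y} → x ≋ y → y ≋ x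
    ≋-sym x≋y z = sym (x≋y z)

    ⟨⟩-congʳ : ∀ {x y} z → x ≋ y → ⟨ z , x ⟩ ≈ ⟨ z , y ⟩
    ⟨⟩-congʳ {x} {y} z x≋y = begin
      ⟨ z , x ⟩  ≈⟨ ⟨⟩-comm z x ⟩
      ⟨ x , z ⟩  ≈⟨ x≋y z ⟩
      ⟨ y , z ⟩  ≈⟨ ⟨⟩-comm y z ⟩
      ⟨ z , y ⟩  ∎

    ⟨⟩-linʳ : ∀ a x b y z → ⟨ z , a · x ⊞ b · y ⟩ ≈ a * ⟨ z , x ⟩ + b * ⟨ z , y ⟩
    ⟨⟩-linʳ a x b y z = begin
      ⟨ z , a · x ⊞ b · y ⟩          ≈⟨ ⟨⟩-comm _ _ ⟩
      ⟨ a · x ⊞ b · y , z ⟩          ≈⟨ ⟨⟩-linˡ a x b y z ⟩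
      a * ⟨ x , z ⟩ + b * ⟨ y , z ⟩  ≈⟨ +-cong (*-congˡ (⟨⟩-comm x z)) (*-congˡ (⟨⟩-comm y z)) ⟩
      a * ⟨ z , x ⟩ + b * ⟨ z , y ⟩  ∎

    definiteʳ : ∀ {x} → Null x → ∀ y → ⟨ y , x ⟩ ≈ 0#
    definiteʳ {x} x≈0 y = trans (⟨⟩-comm y x) (definite x≈0 y)

    lin-zero : ∀ {p q} a b → p ≈ 0# → q ≈ 0# → a * p + b * q ≈ 0#
    lin-zero {p} {q} a b p≈0 q≈0 = begin
      a * p + b * q    ≈⟨ +-cong (*-congˡ p≈0) (*-congˡ q≈0) ⟩
      a * 0# + b * 0#  ≈⟨ solve 2 (λ a b → a :* :0 :+ b :* :0 := :0) refl a b ⟩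
      0#               ∎

    ⊥-linˡ : ∀ {x y z} a b → ⟨ x , z ⟩ ≈ 0# → ⟨ y , z ⟩ ≈ 0# → ⟨ a · x ⊞ b · y , z ⟩ ≈ 0#
    ⊥-linˡ a b p q = trans (⟨⟩-linˡ a _ b _ _) (lin-zero a b p q)

    ⊥-linʳ : ∀ {x y z} a b → ⟨ z , x ⟩ ≈ 0# → ⟨ z , y ⟩ ≈ 0# → ⟨ z , a · x ⊞ b · y ⟩ ≈ 0#
    ⊥-linʳ a b p q = trans (⟨⟩-linʳ a _ b _ _) (lin-zero a b p q)

    record Subspace (V : Vector → Set) : Set where
      field
        lin  : ∀ {x y} a b → V x → V y → V (a · x ⊞ b · y)
        resp : ∀ {x y} → x ≋ y → V x → V y
        null : ∀ {x} → Null x → V x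

    infixl 6 _⟂_ _⟂ˢ_
    _⟂_ : (Vector → Set) → Vector → Vector → Set
    (V ⟂ w) x = V x × ⟨ x , w ⟩ ≈ 0#

    _⟂ˢ_ : (Vector → Set) → (Vector → Set) → Vector → Set
    (V ⟂ˢ W) x = V x × (∀ w → W w → ⟨ x , w ⟩ ≈ 0#)

    ⟂-subspace : ∀ {V} w → Subspace V → Subspace (V ⟂ w)
    ⟂-subspace w sub = record
      { lin  = λ a b (x∈ , xw) (y∈ , yw) → lin a b x∈ y∈ , ⊥-linˡ a b xw yw
      ; resp = λ x≋y (x∈ , xw) → resp x≋y x∈ , trans (sym (x≋y w)) xw
      ; null = λ x≈0 → null x≈0 , definite x≈0 w
      }
      where open Subspace sub

    ⟂ˢ-subspace : ∀ {V} W → Subspace V → Subspace (V ⟂ˢ W)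
    ⟂ˢ-subspace W sub = record
      { lin  = λ a b (x∈ , xW) (y∈ , yW) → lin a b x∈ y∈ , λ w w∈ → ⊥-linˡ a b (xW w w∈) (yW w w∈)
      ; resp = λ x≋y (x∈ , xW) → resp x≋y x∈ , λ w w∈ → trans (sym (x≋y w)) (xW w w∈)
      ; null = λ x≈0 → null x≈0 , λ w _ → definite x≈0 w
      }
      where open Subspace sub

    -- V has an orthogonal basis of d vectors, chosen one at a time.
    Dim : ℕ → (Vector → Set) → Set
    Dim zero    V = ∀ x → V x → Null x
    Dim (suc d) V = ∃ λ w → V w × ¬ Null w × Dim d (V ⟂ w)

    Dim-resp : ∀ d {V W} → (∀ x → V x → W x) → (∀ x → W x → V x) → Dim d V → Dim d W
    Dim-resp zero f g D = λ x x∈ → D x (g x x∈)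
    Dim-resp (suc d) f g (w , w∈ , w≉0 , D) =
      w , f w w∈ , w≉0 , Dim-resp d (λ x (x∈ , xw) → f x x∈ , xw) (λ x (x∈ , xw) → g x x∈ , xw) D

    -- The component of w orthogonal to v, multiplied by ⟨ v , v ⟩ so that nothing is divided.
    reject : Vector → Vector → Vector
    reject v w = ⟨ v , v ⟩ · w ⊞ - ⟨ w , v ⟩ · v

    ⟨reject,⟩ : ∀ v w x → ⟨ reject v w , x ⟩ ≈ ⟨ v , v ⟩ * ⟨ w , x ⟩ - ⟨ w , v ⟩ * ⟨ v , x ⟩
    ⟨reject,⟩ v w x = trans (⟨⟩-linˡ _ w _ v x)
      (solve 4 (λ a b c d → a :* b :+ (:- c) :* d := a :* b :- c :* d) refl ⟨ v , v ⟩ ⟨ w , x ⟩ ⟨ w , v ⟩ ⟨ v , x ⟩)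

    reject-⟂ : ∀ v w → ⟨ reject v w , v ⟩ ≈ 0#
    reject-⟂ v w = trans (⟨reject,⟩ v w v)
      (solve 2 (λ a b → a :* b :- b :* a := :0) refl ⟨ v , v ⟩ ⟨ w , v ⟩)

    -- The Gram determinant of v and w. Its vanishing detects that they are parallel, in the form
    -- that `reject v w` is null.
    gram : Vector → Vector → Carrier
    gram v w = ⟨ v , v ⟩ * ⟨ w , w ⟩ - ⟨ v , w ⟩ * ⟨ v , w ⟩

    ⟨reject,w⟩ : ∀ v w → ⟨ reject v w , w ⟩ ≈ gram v w
    ⟨reject,w⟩ v w = trans (⟨reject,⟩ v w w) (+-congˡ (-‿cong (*-congʳ (⟨⟩-comm w v))))

    gram-comm : ∀ v w → gram v w ≈ gram w v
    gram-comm v w = +-cong (*-comm _ _) (-‿cong (*-cong (⟨⟩-comm v w) (⟨⟩-comm v w)))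

    gram≈0⇒reject-Null : ∀ v w → gram v w ≈ 0# → Null (reject v w)
    gram≈0⇒reject-Null v w g≈0 = begin
      ⟨ reject v w , reject v w ⟩
        ≈⟨ ⟨⟩-linʳ _ w _ v _ ⟩
      ⟨ v , v ⟩ * ⟨ reject v w , w ⟩ + - ⟨ w , v ⟩ * ⟨ reject v w , v ⟩
        ≈⟨ lin-zero _ _ (trans (⟨reject,w⟩ v w) g≈0) (reject-⟂ v w) ⟩
      0# ∎

    reject-Null⇒gram≈0 : ∀ v w → Null (reject v w) → gram v w ≈ 0#
    reject-Null⇒gram≈0 v w r≈0 = trans (sym (⟨reject,w⟩ v w)) (definite r≈0 w)

    -- Up to the nonzero factor ⟨ v , v ⟩, w is a combination of v and `reject v w`. Orthogonality
    -- to V can thus be checked on v and on the part of V orthogonal to v.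
    reject-⟂-iff : ∀ {v w x} → ¬ Null v → ⟨ x , v ⟩ ≈ 0# → ⟨ x , reject v w ⟩ ≈ 0# → ⟨ x , w ⟩ ≈ 0#
    reject-⟂-iff {v} {w} {x} v≉0 xv xr = *-cancelˡ-≈0 v≉0 (begin
      ⟨ v , v ⟩ * ⟨ x , w ⟩
        ≈⟨ solve 4 (λ a b c d → a :* b := a :* b :+ (:- c) :* d :+ c :* d) refl ⟨ v , v ⟩ ⟨ x , w ⟩ ⟨ w , v ⟩ ⟨ x , v ⟩ ⟩
      ⟨ v , v ⟩ * ⟨ x , w ⟩ + - ⟨ w , v ⟩ * ⟨ x , v ⟩ + ⟨ w , v ⟩ * ⟨ x , v ⟩
        ≈⟨ +-cong (trans (sym (⟨⟩-linʳ _ w _ v x)) xr) (trans (*-congˡ xv) (zeroʳ _)) ⟩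
      0# + 0#
        ≈⟨ +-identityʳ 0# ⟩
      0# ∎)

    -- Exchange: the first basis vector can be any non-null vector of V.
    -- If w is not parallel to v, rotating the plane they span moves v to w.
    Dim-⟂ : ∀ d {V w} → Subspace V → Dim (suc d) V → V w → ¬ Null w → Dim d (V ⟂ w)
    Dim-⟂ d {V} {w} sub (v , v∈ , v≉0 , D) w∈ w≉0 with ≈0? (gram v w)
    ... | yes g≈0 = Dim-resp d
          (λ x (x∈ , xv) → x∈ , reject-⟂-iff v≉0 xv (definiteʳ (gram≈0⇒reject-Null v w g≈0) x))
          (λ x (x∈ , xw) → x∈ , reject-⟂-iff w≉0 xw (definiteʳ (gram≈0⇒reject-Null w v (trans (gram-comm w v) g≈0)) x))
          D
    Dim-⟂ zero {V} {w} sub (v , v∈ , v≉0 , D) w∈ w≉0 | no g≉0 =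
      ⊥-elim (g≉0 (reject-Null⇒gram≈0 v w (D _ (lin _ _ w∈ v∈ , reject-⟂ v w))))
      where open Subspace sub
    Dim-⟂ (suc d) {V} {w} sub (v , v∈ , v≉0 , D) w∈ w≉0 | no g≉0 =
      reject w v , (lin _ _ v∈ w∈ , reject-⟂ w v) , g≉0 ∘ trans (gram-comm v w) ∘ reject-Null⇒gram≈0 w v ,
      Dim-resp d
        (λ x ((x∈ , xv) , xr) → let xw = reject-⟂-iff v≉0 xv xr in (x∈ , xw) , ⊥-linʳ _ _ xv xw)
        (λ x ((x∈ , xw) , xr) → let xv = reject-⟂-iff w≉0 xw xr in (x∈ , xv) , ⊥-linʳ _ _ xw xv)
        (Dim-⟂ d (⟂-subspace v sub) D (lin _ _ w∈ v∈ , reject-⟂ v w) (g≉0 ∘ reject-Null⇒gram≈0 v w))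
      where open Subspace sub

    ⟂ˢ-split : ∀ {V W w x} → Subspace W → W w → ¬ Null w → ⟨ x , w ⟩ ≈ 0# →
      (V ⟂ˢ (W ⟂ w)) x → (V ⟂ˢ W) x
    ⟂ˢ-split sub w∈ w≉0 xw (x∈ , xW) = x∈ , λ u u∈ →
      reject-⟂-iff w≉0 xw (xW _ (lin _ _ u∈ w∈ , reject-⟂ _ u))
      where open Subspace sub

    -- If W contains a non-null vector w, the exchange property makes w the first basis vector of V,
    -- and the recursion continues in the complements of w in V and in W. Otherwise W has dimension
    -- 0 and its complement is V.
    Dim-complement : ∀ d {V W} → Subspace V → Subspace W → (∀ x → W x → V x) → Dim d V →
      Classically (∃₂ λ e f → e ℕ.+ f ≡ d × Dim e W × Dim f (V ⟂ˢ W))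
    Dim-complement d {V} {W} subV subW W⊆V D = excludedMiddle (∃ λ w → W w × ¬ Null w) >>= λ where
        (no none) →
          let null : ∀ x → W x → Null x
              null x x∈ x≉0 = none (x , x∈ , λ n → n x≉0)
          in pure (0 , d , ≡.refl , null ,
            Dim-resp d (λ x x∈ → x∈ , λ w w∈ → definiteʳ (null w w∈) x) (λ _ → proj₁) D)
        (yes (w , w∈ , w≉0)) → step d D w w∈ w≉0
      where
      step : ∀ d → Dim d V → ∀ w → W w → ¬ Null w → Classically (∃₂ λ e f → e ℕ.+ f ≡ d × Dim e W × Dim f (V ⟂ˢ W))
      step zero D w w∈ w≉0 = ⊥-elim (w≉0 (D w (W⊆V w w∈)))
      step (suc d) D w w∈ w≉0 =
        Dim-complement d (⟂-subspace w subV) (⟂-subspace w subW) (λ x (x∈ , xw) → W⊆V x x∈ , xw)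
          (Dim-⟂ d subV D (W⊆V w w∈) w≉0) >>= λ (e , f , e+f≡d , De , Df) →
        pure (suc e , f , ≡.cong suc e+f≡d , (w , w∈ , w≉0 , De) ,
          Dim-resp f
            (λ x ((x∈ , xw) , xW) → ⟂ˢ-split {V = V} subW w∈ w≉0 xw (x∈ , xW))
            (λ x (x∈ , xW) → (x∈ , xW w w∈) , λ u (u∈ , _) → xW u u∈)
            Df)


    infix 8 _⊟_
    _⊟_ : Vector → Vector → Vector
    x ⊟ y = 1# · x ⊞ - 1# · y

    ⟨⊟,⟩ : ∀ x y z → ⟨ x ⊟ y , z ⟩ ≈ ⟨ x , z ⟩ - ⟨ y , z ⟩
    ⟨⊟,⟩ x y z = trans (⟨⟩-linˡ 1# x (- 1#) y z)
      (solve 2 (λ a b → :1 :* a :+ (:- :1) :* b := a :- b) refl ⟨ x , z ⟩ ⟨ y , z ⟩)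

    ⊟-Null⇒≋ : ∀ {x y} → Null (x ⊟ y) → x ≋ y
    ⊟-Null⇒≋ {x} {y} n z = x-y≈0⇒x≈y (trans (sym (⟨⊟,⟩ x y z)) (definite n z))

    zeroVector : Vector → Vector
    zeroVector x = 0# · x ⊞ 0# · x

    ⟨zero,⟩ : ∀ x z → ⟨ zeroVector x , z ⟩ ≈ 0#
    ⟨zero,⟩ x z = trans (⟨⟩-linˡ 0# x 0# x z) (solve 1 (λ a → :0 :* a :+ :0 :* a := :0) refl ⟨ x , z ⟩)

    -- With p′ the projection to the complement of v in V, the projection to V is p′ + c v, where c
    -- is the Fourier coefficient of x at v.
    project : ∀ d {V} → Subspace V → Dim d V → ∀ x → ∃ λ p → V p × (∀ w → V w → ⟨ x ⊟ p , w ⟩ ≈ 0#)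
    project zero sub D x = zeroVector x , null (⟨zero,⟩ x _) , λ w w∈ → definiteʳ (D w w∈) _
      where open Subspace sub
    project (suc d) {V} sub (v , v∈ , v≉0 , D) x =
      let p′ , (p′∈ , p′v) , h = project d (⟂-subspace v sub) D x
          c = ⟨ x , v ⟩ * ⟨ v , v ⟩ ⁻¹
          p = 1# · p′ ⊞ c · v
          eq : ∀ z → ⟨ x ⊟ p , z ⟩ ≈ ⟨ x ⊟ p′ , z ⟩ - c * ⟨ v , z ⟩
          eq z = begin
            ⟨ x ⊟ p , z ⟩
              ≈⟨ ⟨⊟,⟩ x p z ⟩
            ⟨ x , z ⟩ - ⟨ p , z ⟩
              ≈⟨ +-congˡ (-‿cong (⟨⟩-linˡ 1# p′ c v z)) ⟩
            ⟨ x , z ⟩ - (1# * ⟨ p′ , z ⟩ + c * ⟨ v , z ⟩)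
              ≈⟨ solve 4 (λ a b c d → a :- (:1 :* b :+ c :* d) := a :- b :- c :* d) refl ⟨ x , z ⟩ ⟨ p′ , z ⟩ c ⟨ v , z ⟩ ⟩
            ⟨ x , z ⟩ - ⟨ p′ , z ⟩ - c * ⟨ v , z ⟩
              ≈⟨ +-congʳ (⟨⊟,⟩ x p′ z) ⟨
            ⟨ x ⊟ p′ , z ⟩ - c * ⟨ v , z ⟩ ∎
          ⊥v : ⟨ x ⊟ p , v ⟩ ≈ 0#
          ⊥v = begin
            ⟨ x ⊟ p , v ⟩
              ≈⟨ eq v ⟩
            ⟨ x ⊟ p′ , v ⟩ - c * ⟨ v , v ⟩
              ≈⟨ +-cong (⟨⊟,⟩ x p′ v) (-‿cong (solve 3 (λ a i b → a :* i :* b := a :* (b :* i)) refl ⟨ x , v ⟩ (⟨ v , v ⟩ ⁻¹) ⟨ v , v ⟩)) ⟩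
            ⟨ x , v ⟩ - ⟨ p′ , v ⟩ - ⟨ x , v ⟩ * (⟨ v , v ⟩ * ⟨ v , v ⟩ ⁻¹)
              ≈⟨ +-cong (+-congˡ (-‿cong p′v)) (-‿cong (*-congˡ (inverseʳ v≉0))) ⟩
            ⟨ x , v ⟩ - 0# - ⟨ x , v ⟩ * 1#
              ≈⟨ solve 1 (λ a → a :- :0 :- a :* :1 := :0) refl ⟨ x , v ⟩ ⟩
            0# ∎
          ⊥reject : ∀ w → V w → ⟨ x ⊟ p , reject v w ⟩ ≈ 0#
          ⊥reject w w∈ = begin
            ⟨ x ⊟ p , reject v w ⟩
              ≈⟨ eq (reject v w) ⟩
            ⟨ x ⊟ p′ , reject v w ⟩ - c * ⟨ v , reject v w ⟩
              ≈⟨ +-cong (h _ (lin _ _ w∈ v∈ , reject-⟂ v w)) (-‿cong (*-congˡ (trans (⟨⟩-comm v _) (reject-⟂ v w)))) ⟩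
            0# - c * 0#
              ≈⟨ solve 1 (λ c → :0 :- c :* :0 := :0) refl c ⟩
            0# ∎
      in p , lin _ _ p′∈ v∈ , λ w w∈ → reject-⟂-iff v≉0 ⊥v (⊥reject w w∈)
      where open Subspace sub

    -- The residue x - p of the projection is orthogonal to V. It is then orthogonal to x by
    -- hypothesis and to p because p lies in V, so it is null and x agrees with p.
    biorthogonal : ∀ d {V} → Subspace V → Dim d V → ∀ x →
      (∀ y → (∀ w → V w → ⟨ y , w ⟩ ≈ 0#) → ⟨ x , y ⟩ ≈ 0#) → V x
    biorthogonal d sub D x x⊥ =
      let p , p∈ , h = project d sub D x
      in resp (≋-sym (⊟-Null⇒≋ (begin
           ⟨ x ⊟ p , x ⊟ p ⟩              ≈⟨ ⟨⊟,⟩ x p (x ⊟ p) ⟩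
           ⟨ x , x ⊟ p ⟩ - ⟨ p , x ⊟ p ⟩  ≈⟨ +-cong (x⊥ _ h) (-‿cong (trans (⟨⟩-comm p _) (h p p∈))) ⟩
           0# - 0#                        ≈⟨ -‿inverseʳ 0# ⟩
           0#                             ∎))) p∈
      where open Subspace sub

    -- This contains linearity up to `_≋_`: moving A to the other argument turns the value at a
    -- combination into the combination of the values.
    SelfAdjoint : (Vector → Vector) → Set
    SelfAdjoint A = ∀ x y → ⟨ A x , y ⟩ ≈ ⟨ x , A y ⟩

    Invariant : (Vector → Vector) → (Vector → Set) → Set
    Invariant A V = ∀ x → V x → V (A x)

    Eigenvector : (Vector → Vector) → Carrier → Vector → Set
    Eigenvector A μ x = ∀ z → ⟨ A x , z ⟩ ≈ μ * ⟨ x , z ⟩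

    HasEigenvector : (Vector → Vector) → (Vector → Set) → Set
    HasEigenvector A V = ∃₂ λ x μ → V x × ¬ Null x × Eigenvector A μ x

-- Cyclic subspaces, minimal polynomials, and eigenvectors in odd dimension.

module KrylovSpaces (R : RealClosedField) where
  open StableField R
  open LinearAlgebra R
  open import Relation.Binary.Reasoning.Setoid setoid

  module Krylov (X : InnerProductSpace) (A : Space.Vector X → Space.Vector X)
                (sa : Space.SelfAdjoint X A) (v : Space.Vector X) where
    open Space X

    -- `act cs` is p(A) v in Horner form, where p has the coefficients cs with the constant term
    -- first.
    act : List Carrier → Vector
    act []       = zeroVector v
    act (c ∷ cs) = c · v ⊞ 1# · A (act cs)

    pow : ℕ → Vector
    pow zero    = v
    pow (suc m) = A (pow m)

    ⟨act[],⟩ : ∀ z → ⟨ act [] , z ⟩ ≈ 0#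
    ⟨act[],⟩ z = ⟨zero,⟩ v z

    ⟨act∷,⟩ : ∀ c cs z → ⟨ act (c ∷ cs) , z ⟩ ≈ c * ⟨ v , z ⟩ + ⟨ act cs , A z ⟩
    ⟨act∷,⟩ c cs z = begin
      ⟨ act (c ∷ cs) , z ⟩                         ≈⟨ ⟨⟩-linˡ c v 1# _ z ⟩
      c * ⟨ v , z ⟩ + 1# * ⟨ A (act cs) , z ⟩      ≈⟨ +-congˡ (trans (*-identityˡ _) (sa _ z)) ⟩
      c * ⟨ v , z ⟩ + ⟨ act cs , A z ⟩             ∎

    ⟨act∷ʳ,⟩ : ∀ cs a z → ⟨ act (cs ++ [ a ]) , z ⟩ ≈ ⟨ act cs , z ⟩ + a * ⟨ pow (length cs) , z ⟩
    ⟨act∷ʳ,⟩ [] a z = begin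
      ⟨ act (a ∷ []) , z ⟩                  ≈⟨ ⟨act∷,⟩ a [] z ⟩
      a * ⟨ v , z ⟩ + ⟨ act [] , A z ⟩      ≈⟨ +-congˡ (⟨act[],⟩ _) ⟩
      a * ⟨ v , z ⟩ + 0#                    ≈⟨ +-comm _ _ ⟩
      0# + a * ⟨ v , z ⟩                    ≈⟨ +-congʳ (⟨act[],⟩ z) ⟨
      ⟨ act [] , z ⟩ + a * ⟨ v , z ⟩        ∎
    ⟨act∷ʳ,⟩ (c ∷ cs) a z = begin
      ⟨ act (c ∷ cs ++ [ a ]) , z ⟩                                              ≈⟨ ⟨act∷,⟩ c (cs ++ [ a ]) z ⟩
      c * ⟨ v , z ⟩ + ⟨ act (cs ++ [ a ]) , A z ⟩                                ≈⟨ +-congˡ (⟨act∷ʳ,⟩ cs a (A z)) ⟩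
      c * ⟨ v , z ⟩ + (⟨ act cs , A z ⟩ + a * ⟨ pow (length cs) , A z ⟩)         ≈⟨ +-assoc _ _ _ ⟨
      c * ⟨ v , z ⟩ + ⟨ act cs , A z ⟩ + a * ⟨ pow (length cs) , A z ⟩           ≈⟨ +-cong (⟨act∷,⟩ c cs z) (*-congˡ (sa _ z)) ⟨
      ⟨ act (c ∷ cs) , z ⟩ + a * ⟨ A (pow (length cs)) , z ⟩                     ∎

    length-∷ʳ : ∀ (cs : List Carrier) {a} → length (cs ++ [ a ]) ≡ suc (length cs)
    length-∷ʳ []       = ≡.refl
    length-∷ʳ (c ∷ cs) = ≡.cong suc (length-∷ʳ cs)

    snoc-view : ∀ m (cs : List Carrier) → length cs ≡ suc m → ∃₂ λ ds a → cs ≡ ds ++ [ a ] × length ds ≡ m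
    snoc-view zero    (c ∷ []) l = [] , c , ≡.refl , ≡.refl
    snoc-view (suc m) (c ∷ cs) l with snoc-view m cs (ℕ.suc-injective l)
    ... | ds , a , ≡.refl , l′ = c ∷ ds , a , ≡.refl , ≡.cong suc l′

    act-lin : ∀ m cs ds a → length cs ≡ m → length ds ≡ m →
      ∃ λ es → length es ≡ m × (∀ z → ⟨ act es , z ⟩ ≈ ⟨ act cs , z ⟩ + a * ⟨ act ds , z ⟩)
    act-lin zero [] [] a _ _ = [] , ≡.refl , λ z → begin
      ⟨ act [] , z ⟩                       ≈⟨ ⟨act[],⟩ z ⟩
      0#                                   ≈⟨ solve 1 (λ a → :0 := :0 :+ a :* :0) refl a ⟩
      0# + a * 0#                          ≈⟨ +-cong (⟨act[],⟩ z) (*-congˡ (⟨act[],⟩ z)) ⟨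
      ⟨ act [] , z ⟩ + a * ⟨ act [] , z ⟩  ∎
    act-lin (suc m) (c ∷ cs) (d ∷ ds) a l l′ =
      let es , l″ , h = act-lin m cs ds a (ℕ.suc-injective l) (ℕ.suc-injective l′)
      in c + a * d ∷ es , ≡.cong suc l″ , λ z → begin
        ⟨ act (c + a * d ∷ es) , z ⟩
          ≈⟨ ⟨act∷,⟩ _ es z ⟩
        (c + a * d) * ⟨ v , z ⟩ + ⟨ act es , A z ⟩
          ≈⟨ +-congˡ (h (A z)) ⟩
        (c + a * d) * ⟨ v , z ⟩ + (⟨ act cs , A z ⟩ + a * ⟨ act ds , A z ⟩)
          ≈⟨ solve 6 (λ c a d p q r → (c :+ a :* d) :* p :+ (q :+ a :* r) := c :* p :+ q :+ a :* (d :* p :+ r)) refl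
               c a d ⟨ v , z ⟩ ⟨ act cs , A z ⟩ ⟨ act ds , A z ⟩ ⟩
        c * ⟨ v , z ⟩ + ⟨ act cs , A z ⟩ + a * (d * ⟨ v , z ⟩ + ⟨ act ds , A z ⟩)
          ≈⟨ +-cong (⟨act∷,⟩ c cs z) (*-congˡ (⟨act∷,⟩ d ds z)) ⟨
        ⟨ act (c ∷ cs) , z ⟩ + a * ⟨ act (d ∷ ds) , z ⟩ ∎

    -- Synthetic division of a monic polynomial by t - μ.
    divide : ∀ μ c cs → ∃ λ gs → length gs ≡ length cs × (∀ z →
      ⟨ act (c ∷ cs ++ [ 1# ]) , z ⟩ ≈
        ⟨ act (gs ++ [ 1# ]) , A z ⟩ - μ * ⟨ act (gs ++ [ 1# ]) , z ⟩ + eval (c ∷ cs ++ [ 1# ]) μ * ⟨ v , z ⟩)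
    divide μ c [] = [] , ≡.refl , λ z → begin
      ⟨ act (c ∷ 1# ∷ []) , z ⟩
        ≈⟨ ⟨act∷,⟩ c [ 1# ] z ⟩
      c * ⟨ v , z ⟩ + ⟨ act (1# ∷ []) , A z ⟩
        ≈⟨ solve 4 (λ μ c p q → c :* p :+ q := q :- μ :* (:1 :* p :+ :0) :+ (c :+ μ :* (:1 :+ μ :* :0)) :* p) refl
             μ c ⟨ v , z ⟩ ⟨ act (1# ∷ []) , A z ⟩ ⟩
      ⟨ act (1# ∷ []) , A z ⟩ - μ * (1# * ⟨ v , z ⟩ + 0#) + eval (c ∷ 1# ∷ []) μ * ⟨ v , z ⟩
        ≈⟨ +-congʳ (+-congˡ (-‿cong (*-congˡ (trans (⟨act∷,⟩ 1# [] z) (+-congˡ (⟨act[],⟩ (A z))))))) ⟨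
      ⟨ act (1# ∷ []) , A z ⟩ - μ * ⟨ act (1# ∷ []) , z ⟩ + eval (c ∷ 1# ∷ []) μ * ⟨ v , z ⟩ ∎
    divide μ c (c′ ∷ cs) =
      let gs , l , h = divide μ c′ cs
          e = eval (c′ ∷ cs ++ [ 1# ]) μ
      in e ∷ gs , ≡.cong suc l , λ z →
        let g : Vector → Carrier
            g y = ⟨ act (gs ++ [ 1# ]) , y ⟩
        in begin
        ⟨ act (c ∷ c′ ∷ cs ++ [ 1# ]) , z ⟩
          ≈⟨ ⟨act∷,⟩ c (c′ ∷ cs ++ [ 1# ]) z ⟩
        c * ⟨ v , z ⟩ + ⟨ act (c′ ∷ cs ++ [ 1# ]) , A z ⟩
          ≈⟨ +-congˡ (h (A z)) ⟩
        c * ⟨ v , z ⟩ + (g (A (A z)) - μ * g (A z) + e * ⟨ v , A z ⟩)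
          ≈⟨ solve 7 (λ μ c e p q r s → c :* p :+ (r :- μ :* s :+ e :* q) :=
               e :* q :+ r :- μ :* (e :* p :+ s) :+ (c :+ μ :* e) :* p) refl
               μ c e ⟨ v , z ⟩ ⟨ v , A z ⟩ (g (A (A z))) (g (A z)) ⟩
        e * ⟨ v , A z ⟩ + g (A (A z)) - μ * (e * ⟨ v , z ⟩ + g (A z)) + (c + μ * e) * ⟨ v , z ⟩
          ≈⟨ +-congʳ (+-cong (⟨act∷,⟩ e (gs ++ [ 1# ]) (A z)) (-‿cong (*-congˡ (⟨act∷,⟩ e (gs ++ [ 1# ]) z)))) ⟨
        ⟨ act (e ∷ gs ++ [ 1# ]) , A z ⟩ - μ * ⟨ act (e ∷ gs ++ [ 1# ]) , z ⟩ + (c + μ * e) * ⟨ v , z ⟩ ∎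

    act-∈ : ∀ {V} → Subspace V → Invariant A V → V v → ∀ cs → V (act cs)
    act-∈ sub inv v∈ []       = Subspace.lin sub _ _ v∈ v∈
    act-∈ sub inv v∈ (c ∷ cs) = Subspace.lin sub _ _ v∈ (inv _ (act-∈ sub inv v∈ cs))

    module _ {V : Vector → Set} (sub : Subspace V) (inv : Invariant A V) (v∈ : V v) where
      open Subspace sub

      -- The part of V orthogonal to v , A v , … , A ^ (m - 1) v.
      Rest : ℕ → Vector → Set
      Rest m x = V x × (∀ cs → length cs ≡ m → ⟨ x , act cs ⟩ ≈ 0#)

      Rest-subspace : ∀ m → Subspace (Rest m)
      Rest-subspace m = record
        { lin  = λ a b (x∈ , xs) (y∈ , ys) → lin a b x∈ y∈ , λ cs l → ⊥-linˡ a b (xs cs l) (ys cs l)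
        ; resp = λ x≋y (x∈ , xs) → resp x≋y x∈ , λ cs l → trans (sym (x≋y _)) (xs cs l)
        ; null = λ x≈0 → null x≈0 , λ cs _ → definite x≈0 _
        }

      -- The invariant of Gram-Schmidt on the powers of A applied to v, after m of them: V consists
      -- of the p(A) v with deg p < m together with an orthogonal rest of dimension e. `no-smaller`
      -- speaks of degree m - 1, the degree left when a linear factor is divided out of an
      -- annihilator of degree m.
      record State (m e : ℕ) : Set where
        field
          dim        : Dim e (Rest m)
          reduce     : ∀ y → V y → ∃ λ cs → length cs ≡ m × Rest m (y ⊟ act cs)
          no-smaller : ∀ gs → suc (length gs) ≡ m → ¬ Null (act (gs ++ [ 1# ]))

      Annihilator : ℕ → Set
      Annihilator m = ∃ λ cs → length cs ≡ m × Null (act (cs ++ [ 1# ]))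

      initial : ∀ {d} → Dim d V → State 0 d
      initial {d} D = record
        { dim = Dim-resp d (λ { x x∈ → x∈ , λ { [] _ → ⟨x,[]⟩ x } }) (λ _ → proj₁) D
        ; reduce = λ y y∈ → [] , ≡.refl , lin _ _ y∈ (act-∈ sub inv v∈ []) , λ { [] _ → ⟨x,[]⟩ _ }
        ; no-smaller = λ _ ()
        }
        where
        ⟨x,[]⟩ : ∀ x → ⟨ x , act [] ⟩ ≈ 0#
        ⟨x,[]⟩ x = trans (⟨⟩-comm x _) (⟨act[],⟩ x)

      -- A monic polynomial of degree m differs from the m-th power by terms of lower degree, to
      -- which x is already orthogonal. So one such polynomial suffices to reach the m-th power.
      Rest-suc : ∀ {m x cs} → length cs ≡ m → ⟨ x , act (cs ++ [ 1# ]) ⟩ ≈ 0# → Rest m x → Rest (suc m) x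
      Rest-suc {m} {x} {cs} l xq (x∈ , xs) = x∈ , λ ds l′ → orth ds (snoc-view m ds l′)
        where
        ⟨x,pow⟩ : ⟨ x , pow m ⟩ ≈ 0#
        ⟨x,pow⟩ = begin
          ⟨ x , pow m ⟩
            ≈⟨ solve 2 (λ p q → p := q :+ :1 :* p :- q) refl ⟨ x , pow m ⟩ ⟨ x , act cs ⟩ ⟩
          ⟨ x , act cs ⟩ + 1# * ⟨ x , pow m ⟩ - ⟨ x , act cs ⟩
            ≈⟨ +-cong (+-cong (⟨⟩-comm x _) (*-congˡ (⟨⟩-comm x _))) (-‿cong (xs cs l)) ⟩
          ⟨ act cs , x ⟩ + 1# * ⟨ pow m , x ⟩ - 0#
            ≡⟨ ≡.cong (λ k → ⟨ act cs , x ⟩ + 1# * ⟨ pow k , x ⟩ - 0#) (≡.sym l) ⟩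
          ⟨ act cs , x ⟩ + 1# * ⟨ pow (length cs) , x ⟩ - 0#
            ≈⟨ +-congʳ (⟨act∷ʳ,⟩ cs 1# x) ⟨
          ⟨ act (cs ++ [ 1# ]) , x ⟩ - 0#
            ≈⟨ +-congʳ (trans (⟨⟩-comm _ x) xq) ⟩
          0# - 0#
            ≈⟨ -‿inverseʳ 0# ⟩
          0# ∎
        orth : ∀ ds → (∃₂ λ es a → ds ≡ es ++ [ a ] × length es ≡ m) → ⟨ x , act ds ⟩ ≈ 0#
        orth .(es ++ [ a ]) (es , a , ≡.refl , l′) = begin
          ⟨ x , act (es ++ [ a ]) ⟩                          ≈⟨ ⟨⟩-comm x _ ⟩
          ⟨ act (es ++ [ a ]) , x ⟩                          ≈⟨ ⟨act∷ʳ,⟩ es a x ⟩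
          ⟨ act es , x ⟩ + a * ⟨ pow (length es) , x ⟩       ≡⟨ ≡.cong (λ k → ⟨ act es , x ⟩ + a * ⟨ pow k , x ⟩) l′ ⟩
          ⟨ act es , x ⟩ + a * ⟨ pow m , x ⟩                 ≈⟨ +-cong (⟨⟩-comm _ x) (*-congˡ (⟨⟩-comm _ x)) ⟩
          ⟨ x , act es ⟩ + a * ⟨ x , pow m ⟩                 ≈⟨ +-cong (xs es l′) (*-congˡ ⟨x,pow⟩) ⟩
          0# + a * 0#                                        ≈⟨ solve 1 (λ a → :0 :+ a :* :0 := :0) refl a ⟩
          0#                                                 ∎

      Rest-pred : ∀ {m x} → Rest (suc m) x → Rest m x
      Rest-pred {m} {x} (x∈ , xs) = x∈ , λ cs l → trans (⟨⟩-comm x _) (begin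
        ⟨ act cs , x ⟩                                       ≈⟨ solve 2 (λ p q → p := p :+ :0 :* q) refl ⟨ act cs , x ⟩ ⟨ pow (length cs) , x ⟩ ⟩
        ⟨ act cs , x ⟩ + 0# * ⟨ pow (length cs) , x ⟩        ≈⟨ ⟨act∷ʳ,⟩ cs 0# x ⟨
        ⟨ act (cs ++ [ 0# ]) , x ⟩                           ≈⟨ ⟨⟩-comm _ x ⟩
        ⟨ x , act (cs ++ [ 0# ]) ⟩                           ≈⟨ xs (cs ++ [ 0# ]) (≡.trans (length-∷ʳ cs) (≡.cong suc l)) ⟩
        0#                                                   ∎)

      pow-∈ : ∀ m → V (pow m)
      pow-∈ zero    = v∈
      pow-∈ (suc m) = inv _ (pow-∈ m)

      monic-in-Rest : ∀ {m e} → State m e → ∃ λ cs → length cs ≡ m × Rest m (act (cs ++ [ 1# ]))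
      monic-in-Rest {m} S =
        let open State S
            cs , l , _ , h = reduce (pow m) (pow-∈ m)
            -- Taking cs - 2 cs negates the coefficients, so that `ms ++ [ 1# ]` represents the m-th
            -- power minus its projection.
            ms , l′ , k = act-lin m cs cs (- (1# + 1#)) l l
        in ms , l′ , act-∈ sub inv v∈ (ms ++ [ 1# ]) , λ ds l″ → begin
          ⟨ act (ms ++ [ 1# ]) , act ds ⟩
            ≈⟨ ⟨act∷ʳ,⟩ ms 1# (act ds) ⟩
          ⟨ act ms , act ds ⟩ + 1# * ⟨ pow (length ms) , act ds ⟩
            ≡⟨ ≡.cong (λ j → ⟨ act ms , act ds ⟩ + 1# * ⟨ pow j , act ds ⟩) l′ ⟩
          ⟨ act ms , act ds ⟩ + 1# * ⟨ pow m , act ds ⟩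
            ≈⟨ +-congʳ (k (act ds)) ⟩
          ⟨ act cs , act ds ⟩ + - (1# + 1#) * ⟨ act cs , act ds ⟩ + 1# * ⟨ pow m , act ds ⟩
            ≈⟨ solve 2 (λ p q → p :+ (:- (:1 :+ :1)) :* p :+ :1 :* q := q :- p) refl ⟨ act cs , act ds ⟩ ⟨ pow m , act ds ⟩ ⟩
          ⟨ pow m , act ds ⟩ - ⟨ act cs , act ds ⟩
            ≈⟨ ⟨⊟,⟩ (pow m) (act cs) (act ds) ⟨
          ⟨ pow m ⊟ act cs , act ds ⟩
            ≈⟨ h ds l″ ⟩
          0# ∎

      extend : ∀ {m e} → State m (suc e) → ∀ cs → length cs ≡ m → Rest m (act (cs ++ [ 1# ])) →
        ¬ Null (act (cs ++ [ 1# ])) → State (suc m) e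
      extend {m} {e} S cs l q∈ q≉0 = record
        { dim = Dim-resp e
            (λ x (x∈ , xq) → Rest-suc {cs = cs} l xq x∈)
            (λ x x∈ → Rest-pred x∈ , proj₂ x∈ (cs ++ [ 1# ]) (≡.trans (length-∷ʳ cs) (≡.cong suc l)))
            (Dim-⟂ e (Rest-subspace m) dim q∈ q≉0)
        ; reduce = λ y y∈ →
            let cs₁ , l₁ , h₁ = reduce y y∈
                -- The Fourier coefficient at the new vector q. As q comes from a monic polynomial,
                -- adding a q to `act cs₁` puts a in the top position of `fs`.
                a = ⟨ y ⊟ act cs₁ , q ⟩ * ⟨ q , q ⟩ ⁻¹
                es , l₂ , h₂ = act-lin m cs₁ cs a l₁ l
                fs = es ++ [ a ]
                eq : ∀ z → ⟨ y ⊟ act fs , z ⟩ ≈ ⟨ y ⊟ act cs₁ , z ⟩ - a * ⟨ q , z ⟩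
                eq z = begin
                  ⟨ y ⊟ act fs , z ⟩
                    ≈⟨ ⟨⊟,⟩ y (act fs) z ⟩
                  ⟨ y , z ⟩ - ⟨ act fs , z ⟩
                    ≈⟨ +-congˡ (-‿cong (trans (⟨act∷ʳ,⟩ es a z) (+-congʳ (h₂ z)))) ⟩
                  ⟨ y , z ⟩ - (⟨ act cs₁ , z ⟩ + a * ⟨ act cs , z ⟩ + a * ⟨ pow (length es) , z ⟩)
                    ≡⟨ ≡.cong (λ k → ⟨ y , z ⟩ - (⟨ act cs₁ , z ⟩ + a * ⟨ act cs , z ⟩ + a * ⟨ pow k , z ⟩)) (≡.trans l₂ (≡.sym l)) ⟩
                  ⟨ y , z ⟩ - (⟨ act cs₁ , z ⟩ + a * ⟨ act cs , z ⟩ + a * ⟨ pow (length cs) , z ⟩)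
                    ≈⟨ solve 5 (λ y c a d p → y :- (c :+ a :* d :+ a :* p) := y :- c :- a :* (d :+ :1 :* p)) refl
                         ⟨ y , z ⟩ ⟨ act cs₁ , z ⟩ a ⟨ act cs , z ⟩ ⟨ pow (length cs) , z ⟩ ⟩
                  ⟨ y , z ⟩ - ⟨ act cs₁ , z ⟩ - a * (⟨ act cs , z ⟩ + 1# * ⟨ pow (length cs) , z ⟩)
                    ≈⟨ +-cong (⟨⊟,⟩ y (act cs₁) z) (-‿cong (*-congˡ (⟨act∷ʳ,⟩ cs 1# z))) ⟨
                  ⟨ y ⊟ act cs₁ , z ⟩ - a * ⟨ q , z ⟩ ∎
                ⊥q : ⟨ y ⊟ act fs , q ⟩ ≈ 0#
                ⊥q = begin
                  ⟨ y ⊟ act fs , q ⟩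
                    ≈⟨ eq q ⟩
                  ⟨ y ⊟ act cs₁ , q ⟩ - a * ⟨ q , q ⟩
                    ≈⟨ solve 3 (λ p i n → p :- p :* i :* n := p :- p :* (n :* i)) refl ⟨ y ⊟ act cs₁ , q ⟩ (⟨ q , q ⟩ ⁻¹) ⟨ q , q ⟩ ⟩
                  ⟨ y ⊟ act cs₁ , q ⟩ - ⟨ y ⊟ act cs₁ , q ⟩ * (⟨ q , q ⟩ * ⟨ q , q ⟩ ⁻¹)
                    ≈⟨ +-congˡ (-‿cong (*-congˡ (inverseʳ q≉0))) ⟩
                  ⟨ y ⊟ act cs₁ , q ⟩ - ⟨ y ⊟ act cs₁ , q ⟩ * 1#
                    ≈⟨ solve 1 (λ p → p :- p :* :1 := :0) refl ⟨ y ⊟ act cs₁ , q ⟩ ⟩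
                  0# ∎
            in fs , ≡.trans (length-∷ʳ es) (≡.cong suc l₂) ,
               Rest-suc {cs = cs} l ⊥q (lin _ _ y∈ (act-∈ sub inv v∈ fs) , λ ds l₃ → begin
                 ⟨ y ⊟ act fs , act ds ⟩                          ≈⟨ eq (act ds) ⟩
                 ⟨ y ⊟ act cs₁ , act ds ⟩ - a * ⟨ q , act ds ⟩    ≈⟨ +-cong (proj₂ h₁ ds l₃) (-‿cong (*-congˡ (proj₂ q∈ ds l₃))) ⟩
                 0# - a * 0#                                      ≈⟨ solve 1 (λ a → :0 :- a :* :0 := :0) refl a ⟩
                 0#                                               ∎)
        -- All terms of degree below m are orthogonal to q, so every monic polynomial of degree m
        -- has the same product with q, namely ⟨ q , q ⟩.
        ; no-smaller = λ gs l′ g≈0 → q≉0 (begin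
            ⟨ q , q ⟩                                        ≈⟨ ⟨act∷ʳ,⟩ cs 1# q ⟩
            ⟨ act cs , q ⟩ + 1# * ⟨ pow (length cs) , q ⟩    ≈⟨ +-congʳ (⊥q cs l) ⟩
            0# + 1# * ⟨ pow (length cs) , q ⟩                ≡⟨ ≡.cong (λ k → 0# + 1# * ⟨ pow k , q ⟩) (≡.trans l (≡.sym (ℕ.suc-injective l′))) ⟩
            0# + 1# * ⟨ pow (length gs) , q ⟩                ≈⟨ +-congʳ (⊥q gs (ℕ.suc-injective l′)) ⟨
            ⟨ act gs , q ⟩ + 1# * ⟨ pow (length gs) , q ⟩    ≈⟨ ⟨act∷ʳ,⟩ gs 1# q ⟨
            ⟨ act (gs ++ [ 1# ]) , q ⟩                       ≈⟨ definite g≈0 q ⟩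
            0#                                               ∎)
        }
        where
        open State S
        q = act (cs ++ [ 1# ])
        ⊥q : ∀ ds → length ds ≡ m → ⟨ act ds , q ⟩ ≈ 0#
        ⊥q ds l = trans (⟨⟩-comm _ q) (proj₂ q∈ ds l)

      -- Each non-null q uses up one dimension of the rest, so the process stops with a minimal
      -- polynomial. The sum m + e stays constant, which later relates the parities of the two
      -- parts.
      saturate : ∀ {m} e → State m e → ∃₂ λ m′ e′ → m′ ℕ.+ e′ ≡ m ℕ.+ e × State m′ e′ × Annihilator m′
      saturate {m} e S with monic-in-Rest S
      ... | cs , l , q∈ with ≈0? ⟨ act (cs ++ [ 1# ]) , act (cs ++ [ 1# ]) ⟩
      ...   | yes q≈0 = m , e , ≡.refl , S , cs , l , q≈0
      saturate zero S | cs , l , q∈ | no q≉0 = ⊥-elim (q≉0 (State.dim S _ q∈))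
      saturate {m} (suc e) S | cs , l , q∈ | no q≉0 =
        let m′ , e′ , eq , rest = saturate e (extend S cs l q∈ q≉0)
        in m′ , e′ , ≡.trans eq (≡.sym (ℕ.+-suc m e)) , rest

      -- Write the minimal polynomial as (t - μ) g(t) with μ a root. Then A - μ kills w = g(A) v,
      -- and w is not null because g is monic of degree one less.
      Annihilator-odd⇒eigenvector : ∀ {k e} → State (suc (2 ℕ.* k)) e → Annihilator (suc (2 ℕ.* k)) → HasEigenvector A V
      Annihilator-odd⇒eigenvector {k} S (c ∷ cs , l , p≈0) =
        let μ , root = monicOddRoot (c ∷ cs) k l
            gs , l′ , h = divide μ c cs
            w = act (gs ++ [ 1# ])
        in w , μ , act-∈ sub inv v∈ (gs ++ [ 1# ]) , State.no-smaller S gs (≡.trans (≡.cong suc l′) l) , λ z → x-y≈0⇒x≈y (begin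
          ⟨ A w , z ⟩ - μ * ⟨ w , z ⟩
            ≈⟨ +-congʳ (sa w z) ⟩
          ⟨ w , A z ⟩ - μ * ⟨ w , z ⟩
            ≈⟨ solve 2 (λ p q → p := p :+ :0 :* q) refl (⟨ w , A z ⟩ - μ * ⟨ w , z ⟩) ⟨ v , z ⟩ ⟩
          ⟨ w , A z ⟩ - μ * ⟨ w , z ⟩ + 0# * ⟨ v , z ⟩
            ≈⟨ +-congˡ (*-congʳ root) ⟨
          ⟨ w , A z ⟩ - μ * ⟨ w , z ⟩ + eval (c ∷ cs ++ [ 1# ]) μ * ⟨ v , z ⟩
            ≈⟨ h z ⟨
          ⟨ act (c ∷ cs ++ [ 1# ]) , z ⟩
            ≈⟨ definite p≈0 z ⟩
          0# ∎)

      -- An annihilator of degree m makes a vector of the rest orthogonal to the m-th power as well.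
      -- Moving A across the product raises degrees below m by one, hence at most to m.
      Rest-invariant : ∀ {m} → Annihilator m → Invariant A (Rest m)
      Rest-invariant {m} (cs , l , q≈0) x x∈ =
        let _ , xs = Rest-suc {cs = cs} l (definiteʳ q≈0 x) x∈
        in inv x (proj₁ x∈) , λ ds l′ → begin
          ⟨ A x , act ds ⟩                     ≈⟨ ⟨⟩-comm _ _ ⟩
          ⟨ act ds , A x ⟩                     ≈⟨ solve 2 (λ p q → p := :0 :* q :+ p) refl ⟨ act ds , A x ⟩ ⟨ v , x ⟩ ⟩
          0# * ⟨ v , x ⟩ + ⟨ act ds , A x ⟩    ≈⟨ ⟨act∷,⟩ 0# ds x ⟨
          ⟨ act (0# ∷ ds) , x ⟩                ≈⟨ ⟨⟩-comm _ _ ⟩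
          ⟨ x , act (0# ∷ ds) ⟩                ≈⟨ xs (0# ∷ ds) (≡.cong suc l′) ⟩
          0#                                   ∎

      Annihilator-0⇒Null : Annihilator 0 → Null v
      Annihilator-0⇒Null ([] , _ , p≈0) = begin
        ⟨ v , v ⟩                                  ≈⟨ solve 1 (λ p → p := :1 :* p :+ :0) refl ⟨ v , v ⟩ ⟩
        1# * ⟨ v , v ⟩ + 0#                        ≈⟨ +-congˡ (⟨act[],⟩ (A v)) ⟨
        1# * ⟨ v , v ⟩ + ⟨ act [] , A v ⟩          ≈⟨ ⟨act∷,⟩ 1# [] v ⟨
        ⟨ act (1# ∷ []) , v ⟩                      ≈⟨ definite p≈0 v ⟩
        0#                                         ∎

  parity : ∀ m → ∃ λ k → m ≡ 2 ℕ.* k ⊎ m ≡ suc (2 ℕ.* k)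
  parity zero = 0 , inj₁ ≡.refl
  parity (suc m) with parity m
  ... | k , inj₁ m≡2k = k , inj₂ (≡.cong suc m≡2k)
  ... | k , inj₂ m≡2k+1 = suc k , inj₁ (≡.trans (≡.cong suc m≡2k+1) (≡.sym (ℕ.*-suc 2 k)))

  module _ {X : InnerProductSpace} {A : Space.Vector X → Space.Vector X} (sa : Space.SelfAdjoint X A) where
    open Space X

    -- If the minimal polynomial of a vector v has odd degree it has a root; if
    -- it has even degree, the complement of the cyclic space of v is again odd.
    oddDim⇒eigenvector : ∀ bound d {V} → d ℕ.≤ bound → (∀ k → d ≢ 2 ℕ.* k) →
      Subspace V → Invariant A V → Dim d V → HasEigenvector A V
    oddDim⇒eigenvector bound zero _ odd sub inv D = ⊥-elim (odd 0 ≡.refl)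
    oddDim⇒eigenvector (suc bound) (suc d) {V} (ℕ.s≤s d≤) odd sub inv D@(v , v∈ , v≉0 , _)
      with Krylov.saturate X A sa v sub inv v∈ (suc d) (Krylov.initial X A sa v sub inv v∈ D)
    ... | m , e , eq , S , ann with parity m
    ...   | k , inj₂ ≡.refl = Krylov.Annihilator-odd⇒eigenvector X A sa v sub inv v∈ {k} S ann
    ...   | zero , inj₁ ≡.refl = ⊥-elim (v≉0 (Krylov.Annihilator-0⇒Null X A sa v sub inv v∈ ann))
    ...   | suc k , inj₁ ≡.refl =
      let w , μ , (w∈ , _) , w≉0 , eig = oddDim⇒eigenvector bound e e≤ odd′ (Krylov.Rest-subspace X A sa v sub inv v∈ _)
            (Krylov.Rest-invariant X A sa v sub inv v∈ ann) (Krylov.State.dim S)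
      in w , μ , w∈ , w≉0 , eig
      where
      e≤ : e ℕ.≤ bound
      e≤ = ℕ.≤-trans (ℕ.m≤n+m e _) (ℕ.≤-trans (ℕ.≤-reflexive (ℕ.suc-injective eq)) d≤)
      odd′ : ∀ j → e ≢ 2 ℕ.* j
      odd′ j ≡.refl = odd (suc k ℕ.+ j) (≡.trans (≡.sym eq) (≡.sym (ℕ.*-distribˡ-+ 2 (suc k) j)))

-- Function spaces over abstract finite sums and their tensor squares.

module TensorSquares (R : RealClosedField) where
  open StableField R
  open LinearAlgebra R
  open import Relation.Binary.Reasoning.Setoid setoid

  record Linear {J : Set} (S : (J → Carrier) → Carrier) : Set where
    field
      cong : ∀ {f g} → (∀ j → f j ≈ g j) → S f ≈ S g
      lin  : ∀ a f b g → S (λ j → a * f j + b * g j) ≈ a * S f + b * S g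

    scale : ∀ a f → S (λ j → a * f j) ≈ a * S f
    scale a f = begin
      S (λ j → a * f j)               ≈⟨ cong (λ j → solve 2 (λ p q → p := p :+ :0 :* q) refl (a * f j) (f j)) ⟩
      S (λ j → a * f j + 0# * f j)    ≈⟨ lin a f 0# f ⟩
      a * S f + 0# * S f              ≈⟨ solve 2 (λ p q → p :+ :0 :* q := p) refl (a * S f) (S f) ⟩
      a * S f                         ∎

    zero-cong : ∀ {f} → (∀ j → f j ≈ 0#) → S f ≈ 0#
    zero-cong {f} f≈0 = begin
      S f                 ≈⟨ cong (λ j → trans (f≈0 j) (sym (zeroˡ (f j)))) ⟩
      S (λ j → 0# * f j)  ≈⟨ scale 0# f ⟩
      0# * S f            ≈⟨ zeroˡ _ ⟩
      0#                  ∎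

  -- Finite sums are abstract so that an index set can be replaced by its square. `∑-swap` admits
  -- any linear functional S, which lets it pass to the square by two applications.
  record Summation : Set₁ where
    field
      Index      : Set
      ∑          : (Index → Carrier) → Carrier
      ∑-linear   : Linear ∑
      ∑-swap     : ∀ {J : Set} {S : (J → Carrier) → Carrier} → Linear S → ∀ (f : Index → J → Carrier) →
                   ∑ (λ i → S (f i)) ≈ S (λ j → ∑ (λ i → f i j))
      ∑-nonneg   : ∀ f → (∀ i → Nonneg (f i)) → Nonneg (∑ f)
      ∑-definite : ∀ f → (∀ i → Nonneg (f i)) → ∑ f ≈ 0# → ∀ i → f i ≈ 0#

  functions : Summation → InnerProductSpace
  functions I = record
    { Vector   = Index → Carrier
    ; _·_⊞_·_  = λ a x b y i → a * x i + b * y i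
    ; ⟨_,_⟩    = λ x y → ∑ (λ i → x i * y i)
    ; ⟨⟩-comm  = λ x y → cong (λ i → *-comm (x i) (y i))
    ; ⟨⟩-linˡ  = λ a x b y z → trans
        (cong (λ i → solve 5 (λ a x b y z → (a :* x :+ b :* y) :* z := a :* (x :* z) :+ b :* (y :* z)) refl a (x i) b (y i) (z i)))
        (lin a _ b _)
    ; nonneg   = λ x → ∑-nonneg _ (λ i → Nonneg-square (x i))
    ; definite = λ {x} x≈0 y → zero-cong λ i →
        trans (*-congʳ (square≈0 (∑-definite _ (λ i → Nonneg-square (x i)) x≈0 i))) (zeroˡ _)
    }
    where
    open Summation I
    open Linear ∑-linear

  square : Summation → Summation
  square I = record
    { Index      = Index × Index
    ; ∑          = λ f → ∑ λ i → ∑ λ j → f (i , j)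
    ; ∑-linear   = record
      { cong = λ h → cong λ i → cong λ j → h (i , j)
      ; lin  = λ a f b g → trans (cong λ i → lin a _ b _) (lin a _ b _)
      }
    ; ∑-swap     = λ S f → trans (cong λ i → ∑-swap S (λ j → f (i , j))) (∑-swap S _)
    ; ∑-nonneg   = λ f h → ∑-nonneg _ λ i → ∑-nonneg _ λ j → h (i , j)
    ; ∑-definite = λ f h f≈0 (i , j) →
        ∑-definite _ (λ j → h (i , j)) (∑-definite _ (λ i → ∑-nonneg _ λ j → h (i , j)) f≈0 i) j
    }
    where
    open Summation I
    open Linear ∑-linear

  module Tensor (I : Summation) where
    open Summation I
    open Linear ∑-linear
    X = functions I
    open Space X
    module ⊗ = Space (functions (square I))
    open ⊗ using () renaming (Vector to Vector²; ⟨_,_⟩ to ⟪_,_⟫)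

    infix 9 _⊗_
    _⊗_ : Vector → Vector → Vector²
    (x ⊗ y) (i , j) = x i * y j

    apply : Vector² → Vector → Vector
    apply B y i = ∑ λ j → B (i , j) * y j

    -- These are A ⊗ 1 and 1 ⊗ A, with matrices as the elements of the tensor square.
    leftAct rightAct : (Vector → Vector) → Vector² → Vector²
    leftAct  A B (i , j) = A (λ i → B (i , j)) i
    rightAct A B (i , j) = A (λ j → B (i , j)) j

    apply-adjoint : ∀ B x y → ⟪ B , x ⊗ y ⟫ ≈ ⟨ apply B y , x ⟩
    apply-adjoint B x y = cong λ i → begin
      ∑ (λ j → B (i , j) * (x i * y j))
        ≈⟨ cong (λ j → solve 3 (λ b x y → b :* (x :* y) := x :* (b :* y)) refl (B (i , j)) (x i) (y j)) ⟩
      ∑ (λ j → x i * (B (i , j) * y j))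
        ≈⟨ scale (x i) _ ⟩
      x i * apply B y i
        ≈⟨ *-comm _ _ ⟩
      apply B y i * x i ∎

    apply-adjointʳ : ∀ B x y → ⟪ B , x ⊗ y ⟫ ≈ ∑ (λ j → y j * ⟨ (λ i → B (i , j)) , x ⟩)
    apply-adjointʳ B x y = begin
      ∑ (λ i → ∑ λ j → B (i , j) * (x i * y j))
        ≈⟨ ∑-swap ∑-linear _ ⟩
      ∑ (λ j → ∑ λ i → B (i , j) * (x i * y j))
        ≈⟨ cong (λ j → trans
             (cong λ i → solve 3 (λ b x y → b :* (x :* y) := y :* (b :* x)) refl (B (i , j)) (x i) (y j))
             (scale (y j) _)) ⟩
      ∑ (λ j → y j * ⟨ (λ i → B (i , j)) , x ⟩) ∎

    ⟪⊗,⊗⟫ : ∀ x y u v → ⟪ x ⊗ y , u ⊗ v ⟫ ≈ ⟨ x , u ⟩ * ⟨ y , v ⟩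
    ⟪⊗,⊗⟫ x y u v = begin
      ⟪ x ⊗ y , u ⊗ v ⟫
        ≈⟨ apply-adjoint (x ⊗ y) u v ⟩
      ∑ (λ i → ∑ (λ j → x i * y j * v j) * u i)
        ≈⟨ cong (λ i → *-congʳ (trans (cong λ j → *-assoc (x i) (y j) (v j)) (scale (x i) _))) ⟩
      ∑ (λ i → x i * ⟨ y , v ⟩ * u i)
        ≈⟨ cong (λ i → solve 3 (λ x p u → x :* p :* u := p :* (x :* u)) refl (x i) ⟨ y , v ⟩ (u i)) ⟩
      ∑ (λ i → ⟨ y , v ⟩ * (x i * u i))
        ≈⟨ scale ⟨ y , v ⟩ _ ⟩
      ⟨ y , v ⟩ * ⟨ x , u ⟩
        ≈⟨ *-comm _ _ ⟩
      ⟨ x , u ⟩ * ⟨ y , v ⟩ ∎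

    -- Take y to be the i-th row of B and x = B y. The hypothesis makes B y null, and its i-th
    -- coordinate is the squared norm of that row. This choice replaces evaluation at basis vectors.
    ⊗-separates-Null : ∀ B → (∀ x y → ⟪ B , x ⊗ y ⟫ ≈ 0#) → ⊗.Null B
    ⊗-separates-Null B B⊥ = zero-cong λ i → square≈0
      (∑-definite _ (λ i → Nonneg-square _) (trans (sym (apply-adjoint B (apply B (row i)) (row i))) (B⊥ _ _)) i)
      where
      row : Index → Vector
      row i j = B (i , j)

    ⊗-separates : ∀ B C → (∀ x y → ⟪ B , x ⊗ y ⟫ ≈ ⟪ C , x ⊗ y ⟫) → B ⊗.≋ C
    ⊗-separates B C h = ⊗.⊟-Null⇒≋ (⊗-separates-Null _ λ x y → begin
      ⟪ B ⊗.⊟ C , x ⊗ y ⟫            ≈⟨ ⊗.⟨⊟,⟩ B C (x ⊗ y) ⟩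
      ⟪ B , x ⊗ y ⟫ - ⟪ C , x ⊗ y ⟫  ≈⟨ +-congʳ (h x y) ⟩
      ⟪ C , x ⊗ y ⟫ - ⟪ C , x ⊗ y ⟫  ≈⟨ -‿inverseʳ _ ⟩
      0#                             ∎)

    module _ {A : Vector → Vector} (sa : SelfAdjoint A) where

      leftAct-⊗ : ∀ B x y → ⟪ leftAct A B , x ⊗ y ⟫ ≈ ⟪ B , A x ⊗ y ⟫
      leftAct-⊗ B x y = begin
        ⟪ leftAct A B , x ⊗ y ⟫                        ≈⟨ apply-adjointʳ (leftAct A B) x y ⟩
        ∑ (λ j → y j * ⟨ A (λ i → B (i , j)) , x ⟩)    ≈⟨ cong (λ j → *-congˡ (sa _ x)) ⟩
        ∑ (λ j → y j * ⟨ (λ i → B (i , j)) , A x ⟩)    ≈⟨ apply-adjointʳ B (A x) y ⟨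
        ⟪ B , A x ⊗ y ⟫                                ∎

      rightAct-⊗ : ∀ B x y → ⟪ rightAct A B , x ⊗ y ⟫ ≈ ⟪ B , x ⊗ A y ⟫
      rightAct-⊗ B x y = begin
        ⟪ rightAct A B , x ⊗ y ⟫                           ≈⟨ apply-adjoint (rightAct A B) x y ⟩
        ∑ (λ i → ⟨ A (λ j → B (i , j)) , y ⟩ * x i)        ≈⟨ cong (λ i → *-congʳ (sa _ y)) ⟩
        ∑ (λ i → ⟨ (λ j → B (i , j)) , A y ⟩ * x i)        ≈⟨ apply-adjoint B x (A y) ⟨
        ⟪ B , x ⊗ A y ⟫                                    ∎

      rightAct-selfAdjoint : ⊗.SelfAdjoint (rightAct A)
      rightAct-selfAdjoint B C = cong λ i → sa _ _

      leftAct-selfAdjoint : ⊗.SelfAdjoint (leftAct A)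
      leftAct-selfAdjoint B C = begin
        ⟪ leftAct A B , C ⟫                                      ≈⟨ ∑-swap ∑-linear _ ⟩
        ∑ (λ j → ⟨ A (λ i → B (i , j)) , (λ i → C (i , j)) ⟩)    ≈⟨ cong (λ j → sa _ _) ⟩
        ∑ (λ j → ⟨ (λ i → B (i , j)) , A (λ i → C (i , j)) ⟩)    ≈⟨ ∑-swap ∑-linear _ ⟨
        ⟪ B , leftAct A C ⟫                                      ∎

      left-right-comm : ∀ B → leftAct A (rightAct A B) ⊗.≋ rightAct A (leftAct A B)
      left-right-comm B = ⊗-separates _ _ λ x y → begin
        ⟪ leftAct A (rightAct A B) , x ⊗ y ⟫   ≈⟨ leftAct-⊗ _ x y ⟩
        ⟪ rightAct A B , A x ⊗ y ⟫             ≈⟨ rightAct-⊗ B (A x) y ⟩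
        ⟪ B , A x ⊗ A y ⟫                      ≈⟨ leftAct-⊗ B x (A y) ⟨
        ⟪ leftAct A B , x ⊗ A y ⟫              ≈⟨ rightAct-⊗ _ x y ⟨
        ⟪ rightAct A (leftAct A B) , x ⊗ y ⟫   ∎

      sumAct productAct : Vector² → Vector²
      sumAct     B = 1# ⊗.· leftAct A B ⊞ 1# · rightAct A B
      productAct B = leftAct A (rightAct A B)

      sumAct-selfAdjoint : ⊗.SelfAdjoint sumAct
      sumAct-selfAdjoint B C = begin
        ⟪ sumAct B , C ⟫                                        ≈⟨ ⊗.⟨⟩-linˡ 1# (leftAct A B) 1# (rightAct A B) C ⟩
        1# * ⟪ leftAct A B , C ⟫ + 1# * ⟪ rightAct A B , C ⟫    ≈⟨ +-cong (*-congˡ (leftAct-selfAdjoint B C)) (*-congˡ (rightAct-selfAdjoint B C)) ⟩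
        1# * ⟪ B , leftAct A C ⟫ + 1# * ⟪ B , rightAct A C ⟫    ≈⟨ ⊗.⟨⟩-linʳ 1# (leftAct A C) 1# (rightAct A C) B ⟨
        ⟪ B , sumAct C ⟫                                        ∎

      productAct-selfAdjoint : ⊗.SelfAdjoint productAct
      productAct-selfAdjoint B C = begin
        ⟪ leftAct A (rightAct A B) , C ⟫    ≈⟨ leftAct-selfAdjoint _ C ⟩
        ⟪ rightAct A B , leftAct A C ⟫      ≈⟨ rightAct-selfAdjoint B _ ⟩
        ⟪ B , rightAct A (leftAct A C) ⟫    ≈⟨ ⊗.⟨⟩-congʳ B (left-right-comm C) ⟨
        ⟪ B , leftAct A (rightAct A C) ⟫    ∎

      sumAct-⊗ : ∀ B x y → ⟪ sumAct B , x ⊗ y ⟫ ≈ ⟪ B , A x ⊗ y ⟫ + ⟪ B , x ⊗ A y ⟫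
      sumAct-⊗ B x y = begin
        ⟪ sumAct B , x ⊗ y ⟫
          ≈⟨ ⊗.⟨⟩-linˡ 1# (leftAct A B) 1# (rightAct A B) (x ⊗ y) ⟩
        1# * ⟪ leftAct A B , x ⊗ y ⟫ + 1# * ⟪ rightAct A B , x ⊗ y ⟫
          ≈⟨ +-cong (trans (*-identityˡ _) (leftAct-⊗ B x y)) (trans (*-identityˡ _) (rightAct-⊗ B x y)) ⟩
        ⟪ B , A x ⊗ y ⟫ + ⟪ B , x ⊗ A y ⟫ ∎

      productAct-⊗ : ∀ B x y → ⟪ productAct B , x ⊗ y ⟫ ≈ ⟪ B , A x ⊗ A y ⟫
      productAct-⊗ B x y = trans (leftAct-⊗ _ x y) (rightAct-⊗ B (A x) y)

      sum-product-comm : ∀ B → sumAct (productAct B) ⊗.≋ productAct (sumAct B)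
      sum-product-comm B = ⊗-separates _ _ λ x y → begin
        ⟪ sumAct (productAct B) , x ⊗ y ⟫                           ≈⟨ sumAct-⊗ _ x y ⟩
        ⟪ productAct B , A x ⊗ y ⟫ + ⟪ productAct B , x ⊗ A y ⟫     ≈⟨ +-cong (productAct-⊗ B (A x) y) (productAct-⊗ B x (A y)) ⟩
        ⟪ B , A (A x) ⊗ A y ⟫ + ⟪ B , A x ⊗ A (A y) ⟫               ≈⟨ sumAct-⊗ B (A x) (A y) ⟨
        ⟪ sumAct B , A x ⊗ A y ⟫                                    ≈⟨ productAct-⊗ (sumAct B) x y ⟨
        ⟪ productAct (sumAct B) , x ⊗ y ⟫                           ∎

-- Symmetric squares of subspaces and their dimension.

triangle : ℕ → ℕ
triangle zero    = 0
triangle (suc d) = suc d ℕ.+ triangle d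

module SymmetricSquares (R : RealClosedField) where
  open StableField R
  open LinearAlgebra R
  open TensorSquares R
  open import Relation.Binary.Reasoning.Setoid setoid

  2≉0 : 1# + 1# ≉ 0#
  2≉0 p = 1≉0 (Nonneg-sum≈0ˡ Nonneg-1 Nonneg-1 p)

  double≈0 : ∀ {p q} → p ≈ q → p + q ≈ 0# → p ≈ 0#
  double≈0 {p} {q} p≈q h = *-cancelˡ-≈0 2≉0 (begin
    (1# + 1#) * p  ≈⟨ solve 1 (λ p → (:1 :+ :1) :* p := p :+ p) refl p ⟩
    p + p          ≈⟨ +-congˡ p≈q ⟩
    p + q          ≈⟨ h ⟩
    0#             ∎)

  module SymmetricSquare (I : Summation) where
    open Tensor I public
    open Space X
    open ⊗ using () renaming (Vector to Vector²; ⟨_,_⟩ to ⟪_,_⟫)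

    Symmetric² : Vector² → Set
    Symmetric² B = ∀ x y → ⟪ B , x ⊗ y ⟫ ≈ ⟪ B , y ⊗ x ⟫

    infix 4 _⊥ᵛ_
    _⊥ᵛ_ : Vector → (Vector → Set) → Set
    y ⊥ᵛ V = ∀ w → V w → ⟨ y , w ⟩ ≈ 0#

    -- The symmetric tensors in V ⊗ V: membership is expressed by vanishing on the orthogonal
    -- complement of V in the second factor, and symmetry transfers this to the first.
    Sym² : (Vector → Set) → Vector² → Set
    Sym² V B = Symmetric² B × (∀ y → y ⊥ᵛ V → ∀ x → ⟪ B , x ⊗ y ⟫ ≈ 0#)

    Sym²-subspace : ∀ V → ⊗.Subspace (Sym² V)
    Sym²-subspace V = record
      { lin  = λ {B} {C} a b (B-sym , B⊥) (C-sym , C⊥) →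
          (λ x y → begin
            ⟪ a ⊗.· B ⊞ b · C , x ⊗ y ⟫              ≈⟨ ⊗.⟨⟩-linˡ a B b C (x ⊗ y) ⟩
            a * ⟪ B , x ⊗ y ⟫ + b * ⟪ C , x ⊗ y ⟫    ≈⟨ +-cong (*-congˡ (B-sym x y)) (*-congˡ (C-sym x y)) ⟩
            a * ⟪ B , y ⊗ x ⟫ + b * ⟪ C , y ⊗ x ⟫    ≈⟨ ⊗.⟨⟩-linˡ a B b C (y ⊗ x) ⟨
            ⟪ a ⊗.· B ⊞ b · C , y ⊗ x ⟫              ∎) ,
          λ y y⊥ x → ⊗.⊥-linˡ a b (B⊥ y y⊥ x) (C⊥ y y⊥ x)
      ; resp = λ B≋C (B-sym , B⊥) →
          (λ x y → trans (sym (B≋C (x ⊗ y))) (trans (B-sym x y) (B≋C (y ⊗ x)))) ,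
          λ y y⊥ x → trans (sym (B≋C (x ⊗ y))) (B⊥ y y⊥ x)
      ; null = λ B≈0 → (λ x y → trans (⊗.definite B≈0 _) (sym (⊗.definite B≈0 _))) , λ y _ x → ⊗.definite B≈0 _
      }

    infix 9 _∨_
    _∨_ : Vector → Vector → Vector²
    w ∨ u = 1# ⊗.· w ⊗ u ⊞ 1# · u ⊗ w

    ⟪,∨⟫ : ∀ B w u → ⟪ B , w ∨ u ⟫ ≈ ⟪ B , w ⊗ u ⟫ + ⟪ B , u ⊗ w ⟫
    ⟪,∨⟫ B w u = trans (⊗.⟨⟩-linʳ 1# (w ⊗ u) 1# (u ⊗ w) B) (+-cong (*-identityˡ _) (*-identityˡ _))

    ⟪∨,⊗⟫ : ∀ w u x y → ⟪ w ∨ u , x ⊗ y ⟫ ≈ ⟨ w , x ⟩ * ⟨ u , y ⟩ + ⟨ u , x ⟩ * ⟨ w , y ⟩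
    ⟪∨,⊗⟫ w u x y = begin
      ⟪ w ∨ u , x ⊗ y ⟫                                    ≈⟨ ⊗.⟨⟩-linˡ 1# (w ⊗ u) 1# (u ⊗ w) (x ⊗ y) ⟩
      1# * ⟪ w ⊗ u , x ⊗ y ⟫ + 1# * ⟪ u ⊗ w , x ⊗ y ⟫      ≈⟨ +-cong (trans (*-identityˡ _) (⟪⊗,⊗⟫ w u x y)) (trans (*-identityˡ _) (⟪⊗,⊗⟫ u w x y)) ⟩
      ⟨ w , x ⟩ * ⟨ u , y ⟩ + ⟨ u , x ⟩ * ⟨ w , y ⟩        ∎

    ∨-symmetric : ∀ w u → Symmetric² (w ∨ u)
    ∨-symmetric w u x y = begin
      ⟪ w ∨ u , x ⊗ y ⟫
        ≈⟨ ⟪∨,⊗⟫ w u x y ⟩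
      ⟨ w , x ⟩ * ⟨ u , y ⟩ + ⟨ u , x ⟩ * ⟨ w , y ⟩
        ≈⟨ solve 4 (λ a b c d → a :* b :+ c :* d := d :* c :+ b :* a) refl ⟨ w , x ⟩ ⟨ u , y ⟩ ⟨ u , x ⟩ ⟨ w , y ⟩ ⟩
      ⟨ w , y ⟩ * ⟨ u , x ⟩ + ⟨ u , y ⟩ * ⟨ w , x ⟩
        ≈⟨ ⟪∨,⊗⟫ w u y x ⟨
      ⟪ w ∨ u , y ⊗ x ⟫ ∎

    ∨-∈ : ∀ {V w u} → V w → V u → Sym² V (w ∨ u)
    ∨-∈ {V} {w} {u} w∈ u∈ = ∨-symmetric w u , λ y y⊥ x → begin
      ⟪ w ∨ u , x ⊗ y ⟫
        ≈⟨ ⟪∨,⊗⟫ w u x y ⟩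
      ⟨ w , x ⟩ * ⟨ u , y ⟩ + ⟨ u , x ⟩ * ⟨ w , y ⟩
        ≈⟨ lin-zero _ _ (trans (⟨⟩-comm u y) (y⊥ u u∈)) (trans (⟨⟩-comm w y) (y⊥ w w∈)) ⟩
      0# ∎

    ⟪∨,∨⟫ : ∀ w u x → ⟪ w ∨ x , w ∨ u ⟫ ≈
      (1# + 1#) * (⟨ w , w ⟩ * ⟨ x , u ⟩ + ⟨ w , u ⟩ * ⟨ x , w ⟩)
    ⟪∨,∨⟫ w u x = begin
      ⟪ w ∨ x , w ∨ u ⟫
        ≈⟨ ⟪,∨⟫ (w ∨ x) w u ⟩
      ⟪ w ∨ x , w ⊗ u ⟫ + ⟪ w ∨ x , u ⊗ w ⟫
        ≈⟨ +-cong (⟪∨,⊗⟫ w x w u) (⟪∨,⊗⟫ w x u w) ⟩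
      ⟨ w , w ⟩ * ⟨ x , u ⟩ + ⟨ x , w ⟩ * ⟨ w , u ⟩ + (⟨ w , u ⟩ * ⟨ x , w ⟩ + ⟨ x , u ⟩ * ⟨ w , w ⟩)
        ≈⟨ solve 4 (λ a b c d → a :* b :+ c :* d :+ (d :* c :+ b :* a) := (:1 :+ :1) :* (a :* b :+ d :* c)) refl
             ⟨ w , w ⟩ ⟨ x , u ⟩ ⟨ x , w ⟩ ⟨ w , u ⟩ ⟩
      (1# + 1#) * (⟨ w , w ⟩ * ⟨ x , u ⟩ + ⟨ w , u ⟩ * ⟨ x , w ⟩) ∎

    ∨-⟂ : ∀ {w u x} → ⟨ x , u ⟩ ≈ 0# → ⟨ x , w ⟩ ≈ 0# → ⟪ w ∨ x , w ∨ u ⟫ ≈ 0#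
    ∨-⟂ {w} {u} {x} xu xw = trans (⟪∨,∨⟫ w u x) (trans (*-congˡ (lin-zero _ _ xu xw)) (zeroʳ _))

    -- The squared norm of w ∨ u is twice the sum of ⟨ w , w ⟩ ⟨ u , u ⟩ and the square of ⟨ w , u
    -- ⟩. Both terms are nonnegative, so the first would have to vanish.
    ∨-≉0 : ∀ {w u} → ¬ Null w → ¬ Null u → ¬ ⊗.Null (w ∨ u)
    ∨-≉0 {w} {u} w≉0 u≉0 h = *-≉0 w≉0 u≉0
      (Nonneg-sum≈0ˡ (Nonneg-* (nonneg w) (nonneg u))
        (Nonneg-resp (*-congˡ (⟨⟩-comm w u)) (Nonneg-square ⟨ w , u ⟩))
        (*-cancelˡ-≈0 2≉0 (trans (sym (⟪∨,∨⟫ w u u)) h)))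

    ⟪,∨⟫≈0⇒ : ∀ {B} → Symmetric² B → ∀ w u → ⟪ B , w ∨ u ⟫ ≈ 0# → ⟪ B , u ⊗ w ⟫ ≈ 0#
    ⟪,∨⟫≈0⇒ {B} B-sym w u h = double≈0 (B-sym u w) (trans (+-comm _ _) (trans (sym (⟪,∨⟫ B w u)) h))

    ⇒⟪,∨⟫≈0 : ∀ {B} → Symmetric² B → ∀ w u → ⟪ B , u ⊗ w ⟫ ≈ 0# → ⟪ B , w ∨ u ⟫ ≈ 0#
    ⇒⟪,∨⟫≈0 {B} B-sym w u h = trans (⟪,∨⟫ B w u) (trans (+-cong (trans (B-sym w u) h) h) (+-identityʳ 0#))

    ⊗-reject : ∀ B {v w y} → ¬ Null v → ⟪ B , v ⊗ y ⟫ ≈ 0# → ⟪ B , reject v w ⊗ y ⟫ ≈ 0# → ⟪ B , w ⊗ y ⟫ ≈ 0#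
    ⊗-reject B {v} {w} {y} v≉0 Bv Br = trans (apply-adjoint B w y)
      (reject-⟂-iff v≉0 (trans (sym (apply-adjoint B v y)) Bv) (trans (sym (apply-adjoint B (reject v w) y)) Br))

    -- For u in an orthogonal basis of U, the products w ∨ u are orthogonal to each other since U is
    -- orthogonal to w. They are split off from Q one at a time, and Q accumulates the orthogonality
    -- conditions.
    peel : ∀ e {q U Q w} → Subspace U → Dim e U → (∀ u → U u → ⟨ u , w ⟩ ≈ 0#) → ¬ Null w →
      (∀ u → U u → Q (w ∨ u)) → (∀ B → Q B → Symmetric² B) →
      ⊗.Dim q (λ B → Q B × (∀ u → U u → ⟪ B , u ⊗ w ⟫ ≈ 0#)) → ⊗.Dim (e ℕ.+ q) Q
    peel zero {q} {w = w} sub D U⊥w w≉0 Q∋ Q-sym DQ =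
      ⊗.Dim-resp q (λ _ → proj₁) (λ B B∈ → B∈ , λ u u∈ → trans (apply-adjoint B u w) (definiteʳ (D u u∈) _)) DQ
    peel (suc e) {q} {w = w} sub (u , u∈ , u≉0 , D) U⊥w w≉0 Q∋ Q-sym DQ =
      w ∨ u , Q∋ u u∈ , ∨-≉0 w≉0 u≉0 ,
      peel e (⟂-subspace u sub) D (λ x (x∈ , _) → U⊥w x x∈) w≉0
        (λ x (x∈ , xu) → Q∋ x x∈ , ∨-⟂ xu (U⊥w x x∈))
        (λ B (B∈ , _) → Q-sym B B∈)
        (⊗.Dim-resp q
          (λ B (B∈ , BU) → (B∈ , ⇒⟪,∨⟫≈0 (Q-sym B B∈) w u (BU u u∈)) , λ x (x∈ , _) → BU x x∈)
          (λ B ((B∈ , Bwu) , BU) → B∈ , λ x x∈ →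
            ⊗-reject B u≉0 (⟪,∨⟫≈0⇒ (Q-sym B B∈) w u Bwu) (BU _ (Subspace.lin sub _ _ x∈ u∈ , reject-⟂ u x)))
          DQ)

    -- The range of B is orthogonal to everything orthogonal to V, so it lies in V by
    -- biorthogonality.
    apply-∈ : ∀ d {V B} → Subspace V → Dim d V → Sym² V B → ∀ y → V (apply B y)
    apply-∈ d {V} {B} sub D (B-sym , B⊥) y = biorthogonal d sub D (apply B y) λ z z⊥ → begin
      ⟨ apply B y , z ⟩  ≈⟨ apply-adjoint B z y ⟨
      ⟪ B , z ⊗ y ⟫      ≈⟨ B-sym z y ⟩
      ⟪ B , y ⊗ z ⟫      ≈⟨ B⊥ z z⊥ y ⟩
      0#                 ∎

    -- Sym² V = w ∨ V ⊕ Sym² (V ⟂ w).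
    Sym²-Dim : ∀ d {V} → Subspace V → Dim d V → ⊗.Dim (triangle d) (Sym² V)
    Sym²-Dim zero sub D B (B-sym , B⊥) = ⊗-separates-Null B λ x y → B⊥ y (λ w w∈ → definiteʳ (D w w∈) y) x
    Sym²-Dim (suc d) {V} sub D₊@(w , w∈ , w≉0 , D) =
      w ∨ w , ∨-∈ w∈ w∈ , ∨-≉0 w≉0 w≉0 ,
      peel d (⟂-subspace w sub) D (λ _ → proj₂) w≉0
        (λ u (u∈ , uw) → ∨-∈ w∈ u∈ , ∨-⟂ uw uw)
        (λ B ((B-sym , _) , _) → B-sym)
        (⊗.Dim-resp (triangle d) forth back (Sym²-Dim d (⟂-subspace w sub) D))
      where
      open Subspace sub using (lin)
      forth : ∀ B → Sym² (V ⟂ w) B → (Sym² V ⊗.⟂ w ∨ w) B × (∀ u → (V ⟂ w) u → ⟪ B , u ⊗ w ⟫ ≈ 0#)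
      forth B (B-sym , B⊥) =
        ((B-sym , λ y y⊥ → B⊥ y λ x (x∈ , _) → y⊥ x x∈) , ⇒⟪,∨⟫≈0 B-sym w w (Bw w)) , λ u _ → Bw u
        where
        Bw : ∀ u → ⟪ B , u ⊗ w ⟫ ≈ 0#
        Bw = B⊥ w λ x (_ , xw) → trans (⟨⟩-comm w x) xw
      back : ∀ B → (Sym² V ⊗.⟂ w ∨ w) B × (∀ u → (V ⟂ w) u → ⟪ B , u ⊗ w ⟫ ≈ 0#) → Sym² (V ⟂ w) B
      -- Up to a nonzero factor, y is a multiple of w plus a vector orthogonal to all of V, and B
      -- vanishes on both.
      back B ((B∈@(B-sym , B⊥) , Bww) , BU) = B-sym , λ y y⊥ x → begin
        ⟪ B , x ⊗ y ⟫  ≈⟨ B-sym x y ⟩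
        ⟪ B , y ⊗ x ⟫  ≈⟨ ⊗-reject B w≉0 (trans (B-sym w x) (Bw x))
                            (trans (B-sym _ x) (B⊥ _ (reject⊥ y y⊥) x)) ⟩
        0#             ∎
        where
        BV : ∀ u → V u → ⟪ B , u ⊗ w ⟫ ≈ 0#
        BV u u∈ = ⊗-reject B w≉0 (⟪,∨⟫≈0⇒ B-sym w w Bww) (BU _ (lin _ _ u∈ w∈ , reject-⟂ w u))
        -- The vector B w lies in V and, by `BV`, is orthogonal to V. It is thus orthogonal to
        -- itself, hence null.
        Bw : ∀ x → ⟪ B , x ⊗ w ⟫ ≈ 0#
        Bw x = trans (apply-adjoint B x w) (definite (trans (sym (apply-adjoint B _ w))
          (BV _ (apply-∈ (suc d) sub D₊ B∈ w))) x)
        reject⊥ : ∀ y → y ⊥ᵛ (V ⟂ w) → reject w y ⊥ᵛ V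
        reject⊥ y y⊥ v v∈ = reject-⟂-iff w≉0 (reject-⟂ w y)
          (⊥-linˡ _ _ (y⊥ _ r∈) (trans (⟨⟩-comm w _) (proj₂ r∈)))
          where
          r∈ : (V ⟂ w) (reject w v)
          r∈ = lin _ _ v∈ w∈ , reject-⟂ w v

    module _ {A : Vector → Vector} (sa : SelfAdjoint A) {V : Vector → Set} (inv : Invariant A V) where

      ⊥ᵛ-invariant : ∀ y → y ⊥ᵛ V → A y ⊥ᵛ V
      ⊥ᵛ-invariant y y⊥ w w∈ = trans (sa y w) (y⊥ (A w) (inv w w∈))

      sumAct-invariant : ⊗.Invariant (sumAct sa) (Sym² V)
      sumAct-invariant B (B-sym , B⊥) =
        (λ x y → begin
          ⟪ sumAct sa B , x ⊗ y ⟫              ≈⟨ sumAct-⊗ sa B x y ⟩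
          ⟪ B , A x ⊗ y ⟫ + ⟪ B , x ⊗ A y ⟫    ≈⟨ +-cong (B-sym (A x) y) (B-sym x (A y)) ⟩
          ⟪ B , y ⊗ A x ⟫ + ⟪ B , A y ⊗ x ⟫    ≈⟨ +-comm _ _ ⟩
          ⟪ B , A y ⊗ x ⟫ + ⟪ B , y ⊗ A x ⟫    ≈⟨ sumAct-⊗ sa B y x ⟨
          ⟪ sumAct sa B , y ⊗ x ⟫              ∎) ,
        λ y y⊥ x → begin
          ⟪ sumAct sa B , x ⊗ y ⟫              ≈⟨ sumAct-⊗ sa B x y ⟩
          ⟪ B , A x ⊗ y ⟫ + ⟪ B , x ⊗ A y ⟫    ≈⟨ +-cong (B⊥ y y⊥ (A x)) (B⊥ (A y) (⊥ᵛ-invariant y y⊥) x) ⟩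
          0# + 0#                              ≈⟨ +-identityʳ 0# ⟩
          0#                                   ∎

      productAct-invariant : ⊗.Invariant (productAct sa) (Sym² V)
      productAct-invariant B (B-sym , B⊥) =
        (λ x y → trans (productAct-⊗ sa B x y) (trans (B-sym (A x) (A y)) (sym (productAct-⊗ sa B y x)))) ,
        λ y y⊥ x → trans (productAct-⊗ sa B x y) (B⊥ (A y) (⊥ᵛ-invariant y y⊥) (A x))

      -- On a common eigenvector B the operators A ⊗ 1 + 1 ⊗ A and A ⊗ A become
      -- scalars, and A satisfies the quadratic with these coefficients on the range of B.
      common⇒quadratic : ∀ {B s p} → ⊗.Eigenvector (sumAct sa) s B → ⊗.Eigenvector (productAct sa) p B → ∀ y z →
        ⟨ apply B y , A (A z) ⟩ - s * ⟨ apply B y , A z ⟩ + p * ⟨ apply B y , z ⟩ ≈ 0#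
      common⇒quadratic {B} {s} {p} eig-s eig-p y z = begin
        ⟨ apply B y , A (A z) ⟩ - s * ⟨ apply B y , A z ⟩ + p * ⟨ apply B y , z ⟩
          ≈⟨ +-cong (+-cong (apply-adjoint B _ y) (-‿cong (*-congˡ (apply-adjoint B _ y)))) (*-congˡ (apply-adjoint B z y)) ⟨
        ⟪ B , A (A z) ⊗ y ⟫ - s * ⟪ B , A z ⊗ y ⟫ + p * ⟪ B , z ⊗ y ⟫
          ≈⟨ +-cong (+-congˡ (-‿cong (trans (sym (eig-s (A z ⊗ y))) (sumAct-⊗ sa B (A z) y))))
                    (trans (sym (eig-p (z ⊗ y))) (productAct-⊗ sa B z y)) ⟩
        ⟪ B , A (A z) ⊗ y ⟫ - (⟪ B , A (A z) ⊗ y ⟫ + ⟪ B , A z ⊗ A y ⟫) + ⟪ B , A z ⊗ A y ⟫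
          ≈⟨ solve 2 (λ a b → a :- (a :+ b) :+ b := :0) refl ⟪ B , A (A z) ⊗ y ⟫ ⟪ B , A z ⊗ A y ⟫ ⟩
        0# ∎

-- The power of 2 in a triangular number.

2*triangle : ∀ d → 2 ℕ.* triangle d ≡ d ℕ.* suc d
2*triangle zero    = ≡.refl
2*triangle (suc d) = begin
  2 ℕ.* (suc d ℕ.+ triangle d)           ≡⟨ ℕ.*-distribˡ-+ 2 (suc d) (triangle d) ⟩
  2 ℕ.* suc d ℕ.+ 2 ℕ.* triangle d       ≡⟨ ≡.cong (2 ℕ.* suc d ℕ.+_) (2*triangle d) ⟩
  2 ℕ.* suc d ℕ.+ d ℕ.* suc d            ≡⟨ lemma d ⟩
  suc d ℕ.* suc (suc d)                  ∎
  where
  open ≡.≡-Reasoning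
  lemma : ∀ d → 2 ℕ.* suc d ℕ.+ d ℕ.* suc d ≡ suc d ℕ.* suc (suc d)
  lemma = solve-∀

-- Write d as the stated power of 2 times m. In 2 T = d (d + 1) both m and d + 1 are odd, so T has
-- exactly one factor 2 fewer than d. This drives the induction.
triangle-∤ : ∀ a d → 2 ℕ.^ suc a ∣ d → ¬ (2 ℕ.^ suc (suc a) ∣ d) → ¬ (2 ℕ.^ suc a ∣ triangle d)
triangle-∤ a d (divides m d≡) ∤d ∣T =
  case (euclidsLemma m (suc d) (toWitness {a? = prime? 2} _) 2∣m*[1+d])
  where
  open ≡.≡-Reasoning
  d≡2^a*m*2 : d ≡ 2 ℕ.^ suc a ℕ.* m
  d≡2^a*m*2 = ≡.trans d≡ (ℕ.*-comm m (2 ℕ.^ suc a))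
  instance _ = ℕ.m^n≢0 2 (suc a)
  2∣m*[1+d] : 2 ∣ m ℕ.* suc d
  2∣m*[1+d] = *-cancelˡ-∣ (2 ℕ.^ suc a) (≡.subst₂ _∣_ (ℕ.*-comm 2 (2 ℕ.^ suc a)) (begin
    2 ℕ.* triangle d                 ≡⟨ 2*triangle d ⟩
    d ℕ.* suc d                      ≡⟨ ≡.cong (ℕ._* suc d) d≡2^a*m*2 ⟩
    2 ℕ.^ suc a ℕ.* m ℕ.* suc d      ≡⟨ ℕ.*-assoc (2 ℕ.^ suc a) m (suc d) ⟩
    2 ℕ.^ suc a ℕ.* (m ℕ.* suc d)    ∎) (*-monoʳ-∣ 2 ∣T))
  case : 2 ∣ m ⊎ 2 ∣ suc d → ⊥
  case (inj₁ 2∣m) = ∤d (≡.subst₂ _∣_ (ℕ.*-comm (2 ℕ.^ suc a) 2) (≡.sym d≡2^a*m*2) (*-monoʳ-∣ (2 ℕ.^ suc a) 2∣m))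
  case (inj₂ 2∣1+d) with () ← ∣1⇒≡1 (∣m+n∣m⇒∣n (≡.subst (2 ∣_) (ℕ.+-comm 1 d) 2∣1+d) (∣-trans (m∣m*n (2 ℕ.^ a)) (divides m d≡)))

-- Eigenvectors in every positive dimension, and forms with nonnegative spectrum.

module SpectralTheorem (R : RealClosedField) where
  open StableField R
  open LinearAlgebra R
  open KrylovSpaces R
  open TensorSquares R
  open SymmetricSquares R
  open import Relation.Binary.Reasoning.Setoid setoid

  module _ {X : InnerProductSpace} where
    open Space X

    HasCommonEigenvector : (Vector → Vector) → (Vector → Vector) → (Vector → Set) → Set
    HasCommonEigenvector A B V = ∃ λ x → V x × ¬ Null x × ∃₂ λ μ ν → Eigenvector A μ x × Eigenvector B ν x

    Commute : (Vector → Vector) → (Vector → Vector) → Set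
    Commute A B = ∀ x → A (B x) ≋ B (A x)

    Eigenspace : (Vector → Vector) → Carrier → (Vector → Set) → Vector → Set
    Eigenspace A μ V x = V x × Eigenvector A μ x

    Eigenspace-subspace : ∀ {A μ V} → SelfAdjoint A → Subspace V → Subspace (Eigenspace A μ V)
    Eigenspace-subspace {A} {μ} {V} sa sub = record
      { lin = λ {x} {y} a b (x∈ , ex) (y∈ , ey) → lin a b x∈ y∈ , λ z → begin
          ⟨ A (a · x ⊞ b · y) , z ⟩                    ≈⟨ sa _ z ⟩
          ⟨ a · x ⊞ b · y , A z ⟩                      ≈⟨ ⟨⟩-linˡ a x b y (A z) ⟩
          a * ⟨ x , A z ⟩ + b * ⟨ y , A z ⟩            ≈⟨ +-cong (*-congˡ (trans (sym (sa x z)) (ex z))) (*-congˡ (trans (sym (sa y z)) (ey z))) ⟩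
          a * (μ * ⟨ x , z ⟩) + b * (μ * ⟨ y , z ⟩)    ≈⟨ solve 5 (λ a b μ p q → a :* (μ :* p) :+ b :* (μ :* q) := μ :* (a :* p :+ b :* q)) refl a b μ ⟨ x , z ⟩ ⟨ y , z ⟩ ⟩
          μ * (a * ⟨ x , z ⟩ + b * ⟨ y , z ⟩)          ≈⟨ *-congˡ (⟨⟩-linˡ a x b y z) ⟨
          μ * ⟨ a · x ⊞ b · y , z ⟩                    ∎
      ; resp = λ {x} {y} x≋y (x∈ , ex) → resp x≋y x∈ , λ z → begin
          ⟨ A y , z ⟩      ≈⟨ sa y z ⟩
          ⟨ y , A z ⟩      ≈⟨ x≋y (A z) ⟨
          ⟨ x , A z ⟩      ≈⟨ sa x z ⟨
          ⟨ A x , z ⟩      ≈⟨ ex z ⟩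
          μ * ⟨ x , z ⟩    ≈⟨ *-congˡ (x≋y z) ⟩
          μ * ⟨ y , z ⟩    ∎
      ; null = λ {x} x≈0 → null x≈0 , λ z → begin
          ⟨ A x , z ⟩      ≈⟨ sa x z ⟩
          ⟨ x , A z ⟩      ≈⟨ definite x≈0 (A z) ⟩
          0#               ≈⟨ zeroʳ μ ⟨
          μ * 0#           ≈⟨ *-congˡ (definite x≈0 z) ⟨
          μ * ⟨ x , z ⟩    ∎
      }
      where open Subspace sub

    Eigenspace-invariant : ∀ {A B μ V} → SelfAdjoint B → Commute A B → Invariant B V → Invariant B (Eigenspace A μ V)
    Eigenspace-invariant {A} {B} {μ} saB comm inv x (x∈ , ex) = inv x x∈ , λ z → begin
      ⟨ A (B x) , z ⟩    ≈⟨ comm x z ⟩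
      ⟨ B (A x) , z ⟩    ≈⟨ saB (A x) z ⟩
      ⟨ A x , B z ⟩      ≈⟨ ex (B z) ⟩
      μ * ⟨ x , B z ⟩    ≈⟨ *-congˡ (saB x z) ⟨
      μ * ⟨ B x , z ⟩    ∎

    ⟂ˢ-invariant : ∀ {A V W} → SelfAdjoint A → Invariant A V → Invariant A W → Invariant A (V ⟂ˢ W)
    ⟂ˢ-invariant {A} sa invV invW x (x∈ , xW) = invV x x∈ , λ w w∈ → trans (sa x w) (xW (A w) (invW w w∈))

    -- Completing the square: with h = s / 2 the vector A b - h b has squared norm
    -- (h² - p) ⟨ b , b ⟩, so the discriminant is nonnegative.
    quadratic⇒eigenvector : ∀ {A V b s p} → SelfAdjoint A → Subspace V → Invariant A V → V b → ¬ Null b →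
      (∀ z → ⟨ b , A (A z) ⟩ - s * ⟨ b , A z ⟩ + p * ⟨ b , z ⟩ ≈ 0#) → Classically (HasEigenvector A V)
    quadratic⇒eigenvector {A} {V} {b} {s} {p} sa sub inv b∈ b≉0 quad =
      sqrt-of-ratio (nonneg (shift h)) (nonneg b) b≉0 norm >>= λ (δ , δ²) → pure (root δ δ²)
      where
      open Subspace sub
      h = s * (1# + 1#) ⁻¹
      shift : Carrier → Vector
      shift c = 1# · A b ⊞ - c · b

      s≈2h : s ≈ (1# + 1#) * h
      s≈2h = begin
        s                              ≈⟨ *-identityʳ s ⟨
        s * 1#                         ≈⟨ *-congˡ (inverseʳ 2≉0) ⟨
        s * ((1# + 1#) * (1# + 1#) ⁻¹) ≈⟨ solve 3 (λ s t i → s :* (t :* i) := t :* (s :* i)) refl s (1# + 1#) ((1# + 1#) ⁻¹) ⟩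
        (1# + 1#) * h                  ∎

      ⟨shift,⟩ : ∀ c z → ⟨ shift c , z ⟩ ≈ ⟨ b , A z ⟩ - c * ⟨ b , z ⟩
      ⟨shift,⟩ c z = begin
        ⟨ shift c , z ⟩                           ≈⟨ ⟨⟩-linˡ 1# (A b) (- c) b z ⟩
        1# * ⟨ A b , z ⟩ + - c * ⟨ b , z ⟩        ≈⟨ +-congʳ (*-congˡ (sa b z)) ⟩
        1# * ⟨ b , A z ⟩ + - c * ⟨ b , z ⟩        ≈⟨ solve 3 (λ q c r → :1 :* q :+ (:- c) :* r := q :- c :* r) refl ⟨ b , A z ⟩ c ⟨ b , z ⟩ ⟩
        ⟨ b , A z ⟩ - c * ⟨ b , z ⟩               ∎

      -- This is (A - c′) (A - c) b = (c c′ - p) b. It serves once with c = c′ = h for the norm, and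
      -- once with h + δ and h - δ as the two roots.
      factor : ∀ c c′ → c + c′ ≈ s → ∀ z →
        ⟨ shift c , A z ⟩ - c′ * ⟨ shift c , z ⟩ ≈ (c * c′ - p) * ⟨ b , z ⟩
      factor c c′ c+c′≈s z = begin
        ⟨ shift c , A z ⟩ - c′ * ⟨ shift c , z ⟩
          ≈⟨ +-cong (⟨shift,⟩ c (A z)) (-‿cong (*-congˡ (⟨shift,⟩ c z))) ⟩
        ⟨ b , A (A z) ⟩ - c * ⟨ b , A z ⟩ - c′ * (⟨ b , A z ⟩ - c * ⟨ b , z ⟩)
          ≈⟨ solve 6 (λ x y z c d p → x :- c :* y :- d :* (y :- c :* z) := (x :- (c :+ d) :* y :+ p :* z) :+ (c :* d :- p) :* z) refl
               ⟨ b , A (A z) ⟩ ⟨ b , A z ⟩ ⟨ b , z ⟩ c c′ p ⟩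
        (⟨ b , A (A z) ⟩ - (c + c′) * ⟨ b , A z ⟩ + p * ⟨ b , z ⟩) + (c * c′ - p) * ⟨ b , z ⟩
          ≈⟨ +-congʳ (trans (+-congʳ (+-congˡ (-‿cong (*-congʳ c+c′≈s)))) (quad z)) ⟩
        0# + (c * c′ - p) * ⟨ b , z ⟩
          ≈⟨ +-identityˡ _ ⟩
        (c * c′ - p) * ⟨ b , z ⟩ ∎

      norm : ⟨ shift h , shift h ⟩ ≈ (h * h - p) * ⟨ b , b ⟩
      norm = begin
        ⟨ shift h , shift h ⟩
          ≈⟨ ⟨⟩-linʳ 1# (A b) (- h) b (shift h) ⟩
        1# * ⟨ shift h , A b ⟩ + - h * ⟨ shift h , b ⟩
          ≈⟨ solve 3 (λ x h y → :1 :* x :+ (:- h) :* y := x :- h :* y) refl ⟨ shift h , A b ⟩ h ⟨ shift h , b ⟩ ⟩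
        ⟨ shift h , A b ⟩ - h * ⟨ shift h , b ⟩
          ≈⟨ factor h h (trans (solve 1 (λ h → h :+ h := (:1 :+ :1) :* h) refl h) (sym s≈2h)) b ⟩
        (h * h - p) * ⟨ b , b ⟩ ∎

      -- Either A - (h + δ) kills b, and b is an eigenvector, or the resulting vector is non-null
      -- and is killed by A - (h - δ).
      root : ∀ δ → δ * δ ≈ h * h - p → HasEigenvector A V
      root δ δ² with ≈0? ⟨ shift (h + δ) , shift (h + δ) ⟩
      ... | yes u≈0 = b , h + δ , b∈ , b≉0 , λ z → x-y≈0⇒x≈y (begin
        ⟨ A b , z ⟩ - (h + δ) * ⟨ b , z ⟩    ≈⟨ +-congʳ (sa b z) ⟩
        ⟨ b , A z ⟩ - (h + δ) * ⟨ b , z ⟩    ≈⟨ ⟨shift,⟩ (h + δ) z ⟨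
        ⟨ shift (h + δ) , z ⟩                ≈⟨ definite u≈0 z ⟩
        0#                                   ∎)
      ... | no u≉0 = shift (h + δ) , h - δ , lin _ _ (inv b b∈) b∈ , u≉0 , λ z → x-y≈0⇒x≈y (begin
        ⟨ A (shift (h + δ)) , z ⟩ - (h - δ) * ⟨ shift (h + δ) , z ⟩
          ≈⟨ +-congʳ (sa _ z) ⟩
        ⟨ shift (h + δ) , A z ⟩ - (h - δ) * ⟨ shift (h + δ) , z ⟩
          ≈⟨ factor (h + δ) (h - δ) (trans (solve 2 (λ h d → (h :+ d) :+ (h :- d) := (:1 :+ :1) :* h) refl h δ) (sym s≈2h)) z ⟩
        ((h + δ) * (h - δ) - p) * ⟨ b , z ⟩
          ≈⟨ *-congʳ (trans (solve 3 (λ h d p → (h :+ d) :* (h :- d) :- p := h :* h :- p :- d :* d) refl h δ p) (+-congˡ (-‿cong δ²))) ⟩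
        (h * h - p - (h * h - p)) * ⟨ b , z ⟩
          ≈⟨ trans (*-congʳ (-‿inverseʳ _)) (zeroˡ _) ⟩
        0# ∎)

  -- The dimension has at most a factors 2. All index sets are covered at once because the step from
  -- a to a + 1 applies the hypothesis over the square of the index set.
  EigenvectorsUpTo : ℕ → Set₁
  EigenvectorsUpTo a = ∀ (I : Summation) → let open Space (functions I) in
    ∀ {A V} d → SelfAdjoint A → Subspace V → Invariant A V → Dim d V → ¬ (2 ℕ.^ suc a ∣ d) →
    Classically (HasEigenvector A V)

  CommonEigenvectorsUpTo : ℕ → Set₁
  CommonEigenvectorsUpTo a = ∀ (I : Summation) → let open Space (functions I) in
    ∀ {A B V} d → SelfAdjoint A → SelfAdjoint B → Commute {functions I} A B →
    Subspace V → Invariant A V → Invariant B V → Dim d V → ¬ (2 ℕ.^ suc a ∣ d) →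
    Classically (HasCommonEigenvector {functions I} A B V)

  eigenvectors-odd : EigenvectorsUpTo 0
  eigenvectors-odd I d sa sub inv D ∤d = pure (oddDim⇒eigenvector {functions I} sa d d ℕ.≤-refl
    (λ k d≡2k → ∤d (divides k (≡.trans d≡2k (ℕ.*-comm 2 k)))) sub inv D)

  -- V splits into an eigenspace of A and its complement, and 2 ^ suc a cannot
  -- divide both of their dimensions.
  eigenvectors⇒common : ∀ a → EigenvectorsUpTo a → CommonEigenvectorsUpTo a
  eigenvectors⇒common a eig I d = go d d ℕ.≤-refl
    where
    open Space (functions I)
    go : ∀ bound d {A B V} → d ℕ.≤ bound → SelfAdjoint A → SelfAdjoint B → Commute {functions I} A B →
      Subspace V → Invariant A V → Invariant B V → Dim d V → ¬ (2 ℕ.^ suc a ∣ d) →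
      Classically (HasCommonEigenvector {functions I} A B V)
    go zero .zero ℕ.z≤n saA saB comm sub invA invB D ∤d = ⊥-elim (∤d (_ ∣0))
    go (suc bound) d {A} {B} {V} d≤ saA saB comm sub invA invB D ∤d =
      eig I d saA sub invA D ∤d >>= λ (v , μ , v∈ , v≉0 , ev) →
      let K = Eigenspace {functions I} A μ V
          subK = Eigenspace-subspace {functions I} saA sub
          invAK = Eigenspace-invariant {functions I} {A} {A} saA (λ _ _ → refl) invA
          invBK = Eigenspace-invariant {functions I} {A} {B} saB comm invB
      in Dim-complement d sub subK (λ _ → proj₁) D >>= λ (e , f , e+f≡d , De , Df) →
      split e f e+f≡d De Df subK invAK invBK (v∈ , ev) v≉0
      where
      split : ∀ e f {μ v} → e ℕ.+ f ≡ d → let K = Eigenspace {functions I} A μ V in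
        Dim e K → Dim f (V ⟂ˢ K) → Subspace K → Invariant A K → Invariant B K → K v → ¬ Null v →
        Classically (HasCommonEigenvector {functions I} A B V)
      split zero f e+f≡d De Df subK invAK invBK v∈ v≉0 = ⊥-elim (v≉0 (De _ v∈))
      split e@(suc e′) f {μ} ≡.refl De Df subK invAK invBK v∈ v≉0 with 2 ℕ.^ suc a ∣? e
      ... | no ∤e = eig I e saB subK invBK De ∤e >>= λ (x , ν , (x∈ , ex) , x≉0 , ex′) →
              pure (x , x∈ , x≉0 , μ , ν , ex , ex′)
      ... | yes ∣e = go bound f (ℕ.≤-trans (ℕ.m≤n+m f e′) (ℕ.s≤s⁻¹ d≤)) saA saB comm (⟂ˢ-subspace _ sub)
              (⟂ˢ-invariant {functions I} saA invA invAK) (⟂ˢ-invariant {functions I} saB invB invBK) Df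
              (λ ∣f → ∤d (∣m∣n⇒∣m+n ∣e ∣f)) >>= λ (x , (x∈ , _) , rest) → pure (x , x∈ , rest)

  common⇒eigenvectors : ∀ a → CommonEigenvectorsUpTo a → EigenvectorsUpTo (suc a)
  common⇒eigenvectors a common I {A} {V} d sa sub inv D ∤d with 2 ℕ.^ suc a ∣? d
  -- With fewer factors 2 the hypothesis already applies, to A paired with itself.
  ... | no ∤d′ = common I d sa sa (λ _ _ → refl) sub inv inv D ∤d′ >>=
          λ (x , x∈ , x≉0 , μ , _ , ex , _) → pure (x , μ , x∈ , x≉0 , ex)
  ... | yes ∣d =
    common (square I) (triangle d) (sumAct-selfAdjoint sa) (productAct-selfAdjoint sa) (sum-product-comm sa)
      (Sym²-subspace V) (sumAct-invariant sa inv) (productAct-invariant sa inv) (Sym²-Dim d sub D)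
      (triangle-∤ a d ∣d ∤d) >>= λ (B , B∈ , B≉0 , s , p , eig-s , eig-p) →
    excludedMiddle (∃ λ y → ¬ Null (apply B y)) >>= λ where
      -- If B y were null for every y, then B would vanish on all pure tensors and be null itself.
      (no none) → ⊥-elim (B≉0 (⊗-separates-Null B λ x y →
        trans (apply-adjoint B x y) (definite (λ n → none (y , λ m → m n)) x)))
      (yes (y , b≉0)) → quadratic⇒eigenvector {functions I} {s = s} {p} sa sub inv (apply-∈ d sub D B∈ y) b≉0
        (common⇒quadratic sa inv eig-s eig-p y)
    where
    open SymmetricSquare I
    open Space X

  eigenvectors : ∀ a → EigenvectorsUpTo a
  eigenvectors zero    = eigenvectors-odd
  eigenvectors (suc a) = common⇒eigenvectors a (eigenvectors⇒common a (eigenvectors a))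

  n<2^1+n : ∀ n → n ℕ.< 2 ℕ.^ suc n
  n<2^1+n zero    = ℕ.s≤s ℕ.z≤n
  n<2^1+n (suc n) = ℕ.≤-trans (ℕ.+-mono-≤ (ℕ.m^n>0 2 (suc n)) (n<2^1+n n))
    (ℕ.≤-reflexive (≡.cong (2 ℕ.^ suc n ℕ.+_) (≡.sym (ℕ.+-identityʳ _))))

  module _ (I : Summation) where
    open Space (functions I)

    -- A positive dimension is smaller than a large enough power of 2 and so is not divisible by it.
    -- The crude exponent comes from `n<2^1+n`.
    eigenvector-exists : ∀ {A V} d → SelfAdjoint A → Subspace V → Invariant A V → Dim (suc d) V →
      Classically (HasEigenvector A V)
    eigenvector-exists d sa sub inv D =
      eigenvectors (suc d) I (suc d) sa sub inv D (λ ∣d → ℕ.<⇒≱ (n<2^1+n (suc d)) (∣⇒≤ ∣d))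

    -- Peel off eigenvectors one by one.
    nonneg-spectrum⇒nonneg-form : ∀ {A} → SelfAdjoint A →
      (∀ μ x → ¬ Null x → Eigenvector A μ x → Nonneg μ) →
      ∀ d {V} → Subspace V → Invariant A V → Dim d V → ∀ x → V x → Nonneg ⟨ A x , x ⟩
    nonneg-spectrum⇒nonneg-form {A} sa spec zero sub inv D x x∈ =
      Nonneg-resp (sym (definiteʳ (D x x∈) (A x))) Nonneg-0
    nonneg-spectrum⇒nonneg-form {A} sa spec (suc d) {V} sub inv D x x∈ =
      eigenvector-exists d sa sub inv D >>= λ (v , μ , v∈ , v≉0 , ev) →
      let c = ⟨ x , v ⟩ * ⟨ v , v ⟩ ⁻¹
          y = 1# · x ⊞ - c · v
          x,v : c * ⟨ v , v ⟩ ≈ ⟨ x , v ⟩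
          x,v = begin
            c * ⟨ v , v ⟩
              ≈⟨ solve 3 (λ p i n → p :* i :* n := p :* (n :* i)) refl ⟨ x , v ⟩ (⟨ v , v ⟩ ⁻¹) ⟨ v , v ⟩ ⟩
            ⟨ x , v ⟩ * (⟨ v , v ⟩ * ⟨ v , v ⟩ ⁻¹)
              ≈⟨ *-congˡ (inverseʳ v≉0) ⟩
            ⟨ x , v ⟩ * 1#
              ≈⟨ *-identityʳ _ ⟩
            ⟨ x , v ⟩ ∎
          y⊥v : ⟨ y , v ⟩ ≈ 0#
          y⊥v = begin
            ⟨ y , v ⟩
              ≈⟨ ⟨⟩-linˡ 1# x (- c) v v ⟩
            1# * ⟨ x , v ⟩ + - c * ⟨ v , v ⟩
              ≈⟨ +-congʳ (*-congˡ (sym x,v)) ⟩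
            1# * (c * ⟨ v , v ⟩) + - c * ⟨ v , v ⟩
              ≈⟨ solve 2 (λ c n → :1 :* (c :* n) :+ (:- c) :* n := :0) refl c ⟨ v , v ⟩ ⟩
            0# ∎
          Ax,v : ⟨ A x , v ⟩ ≈ c * (μ * ⟨ v , v ⟩)
          Ax,v = begin
            ⟨ A x , v ⟩            ≈⟨ sa x v ⟩
            ⟨ x , A v ⟩            ≈⟨ ⟨⟩-comm x (A v) ⟩
            ⟨ A v , x ⟩            ≈⟨ ev x ⟩
            μ * ⟨ v , x ⟩          ≈⟨ *-congˡ (trans (⟨⟩-comm v x) (sym x,v)) ⟩
            μ * (c * ⟨ v , v ⟩)    ≈⟨ solve 3 (λ m c n → m :* (c :* n) := c :* (m :* n)) refl μ c ⟨ v , v ⟩ ⟩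
            c * (μ * ⟨ v , v ⟩)    ∎
          inv′ : Invariant A (V ⟂ v)
          inv′ z (z∈ , zv) = inv z z∈ , (begin
            ⟨ A z , v ⟩      ≈⟨ sa z v ⟩
            ⟨ z , A v ⟩      ≈⟨ ⟨⟩-comm z (A v) ⟩
            ⟨ A v , z ⟩      ≈⟨ ev z ⟩
            μ * ⟨ v , z ⟩    ≈⟨ *-congˡ (trans (⟨⟩-comm v z) zv) ⟩
            μ * 0#           ≈⟨ zeroʳ μ ⟩
            0#               ∎)
          y-nonneg = nonneg-spectrum⇒nonneg-form sa spec d (⟂-subspace v sub) inv′
            (Dim-⟂ d sub D v∈ v≉0) y (lin _ _ x∈ v∈ , y⊥v)
          Av,y : ⟨ A v , y ⟩ ≈ 0#
          Av,y = trans (ev y) (trans (*-congˡ (trans (⟨⟩-comm v y) y⊥v)) (zeroʳ μ))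
          -- The cross terms vanish since A v = μ v is orthogonal to y, so the form at x is the form
          -- at y plus c c μ ⟨ v , v ⟩.
          expand : ⟨ A y , y ⟩ ≈ ⟨ A x , x ⟩ - c * c * (μ * ⟨ v , v ⟩)
          expand = begin
            ⟨ A y , y ⟩
              ≈⟨ sa y y ⟩
            ⟨ y , A y ⟩
              ≈⟨ ⟨⟩-linˡ 1# x (- c) v (A y) ⟩
            1# * ⟨ x , A y ⟩ + - c * ⟨ v , A y ⟩
              ≈⟨ +-cong (*-congˡ (sym (sa x y))) (*-congˡ (trans (sym (sa v y)) Av,y)) ⟩
            1# * ⟨ A x , y ⟩ + - c * 0#
              ≈⟨ +-congʳ (*-congˡ (⟨⟩-linʳ 1# x (- c) v (A x))) ⟩
            1# * (1# * ⟨ A x , x ⟩ + - c * ⟨ A x , v ⟩) + - c * 0#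
              ≈⟨ +-congʳ (*-congˡ (+-congˡ (*-congˡ Ax,v))) ⟩
            1# * (1# * ⟨ A x , x ⟩ + - c * (c * (μ * ⟨ v , v ⟩))) + - c * 0#
              ≈⟨ solve 3 (λ p c q → :1 :* (:1 :* p :+ (:- c) :* (c :* q)) :+ (:- c) :* :0 := p :- c :* c :* q) refl
                   ⟨ A x , x ⟩ c (μ * ⟨ v , v ⟩) ⟩
            ⟨ A x , x ⟩ - c * c * (μ * ⟨ v , v ⟩) ∎
      in Nonneg-resp
           (trans (+-congʳ expand) (solve 2 (λ p q → p :- q :+ q := p) refl ⟨ A x , x ⟩ (c * c * (μ * ⟨ v , v ⟩))))
           (Nonneg-+ y-nonneg (Nonneg-* (Nonneg-square c) (Nonneg-* (spec μ v v≉0 ev) (nonneg v))))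
      where open Subspace sub

-- Double negation commutes with finite conjunctions. This yields the equations of `IsEigenvalue` in
-- all coordinates simultaneously.
classically-all : ∀ {n} {P : Fin n → Set} → (∀ i → Classically (P i)) → Classically (∀ i → P i)
classically-all {zero}  h = pure λ ()
classically-all {suc n} h = h zero >>= λ p → classically-all (h ∘ suc) >>= λ ps → pure λ where
  zero    → p
  (suc i) → ps i

-- The adjacency operator of a graph and its smallest eigenvalue.

module AdjacencySpectrum (R : RealClosedField) where
  open StableField R
  open LinearAlgebra R
  open TensorSquares R
  open SpectralTheorem R
  open Spectral R using (sumR; A; IsEigenvalue; IsSmallestEigenvalue)
  open import Relation.Binary.Reasoning.Setoid setoid

  sumR-linear : ∀ {n} → Linear (sumR {n})
  sumR-linear {n} = record { cong = cong n ; lin = lin n }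
    where
    cong : ∀ n {f g : Fin n → Carrier} → (∀ i → f i ≈ g i) → sumR f ≈ sumR g
    cong zero    h = refl
    cong (suc n) h = +-cong (h zero) (cong n (h ∘ suc))
    lin : ∀ n a (f : Fin n → Carrier) b g → sumR (λ i → a * f i + b * g i) ≈ a * sumR f + b * sumR g
    lin zero    a f b g = solve 2 (λ a b → :0 := a :* :0 :+ b :* :0) refl a b
    lin (suc n) a f b g = trans (+-congˡ (lin n a (f ∘ suc) b (g ∘ suc)))
      (solve 6 (λ a p b q s t → (a :* p :+ b :* q) :+ (a :* s :+ b :* t) := a :* (p :+ s) :+ b :* (q :+ t)) refl
        a (f zero) b (g zero) (sumR (f ∘ suc)) (sumR (g ∘ suc)))

  sumR-nonneg : ∀ n (f : Fin n → Carrier) → (∀ i → Nonneg (f i)) → Nonneg (sumR f)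
  sumR-nonneg zero    f h = Nonneg-0
  sumR-nonneg (suc n) f h = Nonneg-+ (h zero) (sumR-nonneg n (f ∘ suc) (h ∘ suc))

  sumR-definite : ∀ n (f : Fin n → Carrier) → (∀ i → Nonneg (f i)) → sumR f ≈ 0# → ∀ i → f i ≈ 0#
  sumR-definite (suc n) f h s≈0 zero    = Nonneg-sum≈0ˡ (h zero) (sumR-nonneg n (f ∘ suc) (h ∘ suc)) s≈0
  sumR-definite (suc n) f h s≈0 (suc i) = sumR-definite n (f ∘ suc) (h ∘ suc)
    (Nonneg-sum≈0ˡ (sumR-nonneg n (f ∘ suc) (h ∘ suc)) (h zero) (trans (+-comm _ _) s≈0)) i

  sumR-swap : ∀ n {J : Set} {S : (J → Carrier) → Carrier} → Linear S → ∀ (f : Fin n → J → Carrier) →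
    sumR (λ i → S (f i)) ≈ S (λ j → sumR (λ i → f i j))
  sumR-swap zero        S-lin f = sym (Linear.zero-cong S-lin λ _ → refl)
  sumR-swap (suc n) {S = S} S-lin f = begin
    S (f zero) + sumR (λ i → S (f (suc i)))
      ≈⟨ +-congˡ (sumR-swap n S-lin (f ∘ suc)) ⟩
    S (f zero) + S (λ j → sumR (λ i → f (suc i) j))
      ≈⟨ solve 2 (λ a b → a :+ b := :1 :* a :+ :1 :* b) refl _ _ ⟩
    1# * S (f zero) + 1# * S (λ j → sumR (λ i → f (suc i) j))
      ≈⟨ lin 1# _ 1# _ ⟨
    S (λ j → 1# * f zero j + 1# * sumR (λ i → f (suc i) j))
      ≈⟨ cong (λ j → +-cong (*-identityˡ _) (*-identityˡ _)) ⟩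
    S (λ j → f zero j + sumR (λ i → f (suc i) j)) ∎
    where open Linear S-lin

  finite : ℕ → Summation
  finite n = record
    { Index      = Fin n
    ; ∑          = sumR
    ; ∑-linear   = sumR-linear
    ; ∑-swap     = sumR-swap n
    ; ∑-nonneg   = sumR-nonneg n
    ; ∑-definite = sumR-definite n
    }

  basis : ∀ {n} → Fin n → Fin n → Carrier
  basis zero    zero    = 1#
  basis zero    (suc i) = 0#
  basis (suc k) zero    = 0#
  basis (suc k) (suc i) = basis k i

  basis-≢ : ∀ {n} (k i : Fin n) → i ≢ k → basis k i ≈ 0#
  basis-≢ zero    zero    i≢k = ⊥-elim (i≢k ≡.refl)
  basis-≢ zero    (suc i) i≢k = refl
  basis-≢ (suc k) zero    i≢k = refl
  basis-≢ (suc k) (suc i) i≢k = basis-≢ k i (i≢k ∘ ≡.cong suc)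

  basis-refl : ∀ {n} (k : Fin n) → basis k k ≈ 1#
  basis-refl zero    = refl
  basis-refl (suc k) = basis-refl k

  sumR-basis : ∀ {n} (x : Fin n → Carrier) k → sumR (λ i → x i * basis k i) ≈ x k
  sumR-basis x zero = trans (+-cong (*-identityʳ _) (Linear.zero-cong sumR-linear λ i → zeroʳ (x (suc i)))) (+-identityʳ _)
  sumR-basis x (suc k) = trans (+-cong (zeroʳ _) (sumR-basis (x ∘ suc) k)) (+-identityˡ _)

  module _ {n : ℕ} where
    open Space (functions (finite n))

    -- A flag of coordinate subspaces. Splitting off the basis vectors in turn computes their
    -- dimensions, and k = 0 gives the whole space.
    VanishesBelow : ℕ → Vector → Set
    VanishesBelow k x = ∀ i → toℕ i ℕ.< k → x i ≈ 0#

    VanishesBelow-Dim : ∀ m k → k ℕ.+ m ≡ n → Dim m (VanishesBelow k)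
    VanishesBelow-Dim zero k k≡n x x≈0 = Linear.zero-cong sumR-linear λ i →
      trans (*-congʳ (x≈0 i (≡.subst (toℕ i ℕ.<_) (≡.trans (≡.sym k≡n) (ℕ.+-identityʳ k)) (toℕ<n i)))) (zeroˡ _)
    VanishesBelow-Dim (suc m) k k+1+m≡n =
      basis κ , (λ i i<k → basis-≢ κ i λ i≡κ → ℕ.<⇒≢ i<k (≡.trans (≡.cong toℕ i≡κ) κ≡k)) ,
      (λ n → 1≉0 (trans (sym (basis-refl κ)) (trans (sym (sumR-basis (basis κ) κ)) n))) ,
      Dim-resp m
        (λ x x≈0 → (λ i i<k → x≈0 i (ℕ.m<n⇒m<1+n i<k)) ,
          trans (sumR-basis x κ) (x≈0 κ (ℕ.≤-reflexive (≡.cong suc κ≡k))))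
        (λ x (x≈0 , xκ) i i<1+k → case x x≈0 xκ i (ℕ.m≤n⇒m<n∨m≡n (ℕ.s≤s⁻¹ i<1+k)))
        (VanishesBelow-Dim m (suc k) (≡.trans (≡.sym (ℕ.+-suc k m)) k+1+m≡n))
      where
      k<n : k ℕ.< n
      k<n = ℕ.≤-trans (ℕ.≤-trans (ℕ.s≤s (ℕ.m≤m+n k m)) (ℕ.≤-reflexive (≡.sym (ℕ.+-suc k m)))) (ℕ.≤-reflexive k+1+m≡n)
      κ : Fin n
      κ = fromℕ< k<n
      κ≡k : toℕ κ ≡ k
      κ≡k = toℕ-fromℕ< k<n
      case : ∀ x → VanishesBelow k x → ⟨ x , basis κ ⟩ ≈ 0# → ∀ i → toℕ i ℕ.< k ⊎ toℕ i ≡ k → x i ≈ 0#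
      case x x≈0 xκ i (inj₁ i<k) = x≈0 i i<k
      case x x≈0 xκ i (inj₂ i≡k) with ≡.refl ← toℕ-injective {i = i} {j = κ} (≡.trans i≡k (≡.sym κ≡k)) =
        trans (sym (sumR-basis x κ)) xκ

    everything : Vector → Set
    everything _ = ⊤

    everything-subspace : Subspace everything
    everything-subspace = record { lin = λ _ _ _ _ → tt ; resp = λ _ _ → tt ; null = λ _ → tt }

    everything-Dim : Dim n everything
    everything-Dim = Dim-resp n (λ _ _ → tt) (λ _ _ _ ()) (VanishesBelow-Dim n 0 ≡.refl)

    module _ (G : Graph n) where
      open Graph G using (adj)

      adjacency : Vector → Vector
      adjacency x i = sumR (λ j → A G i j * x j)

      A-sym : ∀ i j → A G i j ≈ A G j i
      A-sym i j = reflexive (≡.cong (if_then 1# else 0#) (Graph.sym G i j))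

      adjacency-selfAdjoint : SelfAdjoint adjacency
      adjacency-selfAdjoint x y = begin
        sumR (λ i → sumR (λ j → A G i j * x j) * y i)
          ≈⟨ cong (λ i → trans (*-comm _ _) (sym (scale (y i) _))) ⟩
        sumR (λ i → sumR (λ j → y i * (A G i j * x j)))
          ≈⟨ sumR-swap n (sumR-linear {n}) _ ⟩
        sumR (λ j → sumR (λ i → y i * (A G i j * x j)))
          ≈⟨ cong (λ j → trans (cong λ i → entry i j) (scale (x j) _)) ⟩
        sumR (λ j → x j * sumR (λ i → A G j i * y i)) ∎
        where
        open Linear sumR-linear
        entry : ∀ i j → y i * (A G i j * x j) ≈ x j * (A G j i * y i)
        entry i j = trans (*-congˡ (*-congʳ (A-sym i j)))
          (solve 3 (λ y a x → y :* (a :* x) := x :* (a :* y)) refl (y i) (A G j i) (x j))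

      -- Testing the weak eigenvector equation against the standard basis recovers it in
      -- coordinates.
      eigenvalue : ∀ {μ x} → ¬ Null x → Eigenvector adjacency μ x → Classically (IsEigenvalue G μ)
      eigenvalue {μ} {x} x≉0 ex =
        excludedMiddle (∃ λ i → x i ≢ 0#) >>= λ where
          (no none) → ⊥-elim (x≉0 (Linear.zero-cong sumR-linear λ i →
            trans (*-congʳ λ xi≢0 → none (i , xi≢0)) (zeroˡ _)))
          (yes nonzero) → classically-all (λ i → begin
              adjacency x i                ≈⟨ sumR-basis (adjacency x) i ⟨
              ⟨ adjacency x , basis i ⟩    ≈⟨ ex (basis i) ⟩
              μ * ⟨ x , basis i ⟩          ≈⟨ *-congˡ (sumR-basis x i) ⟩
              μ * x i                      ∎) >>= λ ax≡μx → pure (x , nonzero , ax≡μx)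

      ⟨basis,adjacency⟩ : ∀ a b → ⟨ basis a , adjacency (basis b) ⟩ ≈ A G a b
      ⟨basis,adjacency⟩ a b = begin
        ⟨ basis a , adjacency (basis b) ⟩    ≈⟨ ⟨⟩-comm (basis a) (adjacency (basis b)) ⟩
        ⟨ adjacency (basis b) , basis a ⟩    ≈⟨ sumR-basis (adjacency (basis b)) a ⟩
        adjacency (basis b) a                ≈⟨ sumR-basis (A G a) b ⟩
        A G a b                              ∎

      -- The adjacency form takes the value -2 at the difference of the ends of an edge.
      edge⇒smallestEigenvalue≢0 : ∀ {a b θ} → adj a b ≡ true → IsSmallestEigenvalue G θ → θ ≢ 0#
      edge⇒smallestEigenvalue≢0 {a} {b} a~b (_ , smallest) ≡.refl = ¬Nonneg-neg1 (Nonneg-resp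
        (trans (+-congʳ value) (solve 0 (:- (:1 :+ :1) :+ :1 := :- :1) refl))
        (Nonneg-+ (nonneg-spectrum⇒nonneg-form (finite n) adjacency-selfAdjoint spectrum n
          everything-subspace (λ _ _ → tt) everything-Dim x tt) Nonneg-1))
        where
        x : Vector
        x = basis a ⊟ basis b
        spectrum : ∀ μ y → ¬ Null y → Eigenvector adjacency μ y → Nonneg μ
        spectrum μ y y≉0 ey = eigenvalue y≉0 ey >>= λ isEv → pure (smallest μ isEv)
        A₀ : ∀ i → A G i i ≈ 0#
        A₀ i = reflexive (≡.cong (if_then 1# else 0#) (Graph.irrefl G i))
        A₁ : A G a b ≈ 1#
        A₁ = reflexive (≡.cong (if_then 1# else 0#) a~b)
        row : ∀ i → ⟨ adjacency x , basis i ⟩ ≈ A G a i - A G b i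
        row i = begin
          ⟨ adjacency x , basis i ⟩    ≈⟨ adjacency-selfAdjoint x (basis i) ⟩
          ⟨ x , adjacency (basis i) ⟩  ≈⟨ ⟨⊟,⟩ (basis a) (basis b) (adjacency (basis i)) ⟩
          ⟨ basis a , adjacency (basis i) ⟩ - ⟨ basis b , adjacency (basis i) ⟩
                                       ≈⟨ +-cong (⟨basis,adjacency⟩ a i) (-‿cong (⟨basis,adjacency⟩ b i)) ⟩
          A G a i - A G b i            ∎
        value : ⟨ adjacency x , x ⟩ ≈ - (1# + 1#)
        value = begin
          ⟨ adjacency x , x ⟩
            ≈⟨ ⟨⟩-linʳ 1# (basis a) (- 1#) (basis b) (adjacency x) ⟩
          1# * ⟨ adjacency x , basis a ⟩ + - 1# * ⟨ adjacency x , basis b ⟩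
            ≈⟨ +-cong (*-congˡ (trans (row a) (+-cong (A₀ a) (-‿cong (trans (A-sym b a) A₁)))))
                      (*-congˡ (trans (row b) (+-cong A₁ (-‿cong (A₀ b))))) ⟩
          1# * (0# - 1#) + - 1# * (1# - 0#)
            ≈⟨ solve 0 (:1 :* (:0 :- :1) :+ (:- :1) :* (:1 :- :0) := :- (:1 :+ :1)) refl ⟩
          - (1# + 1#) ∎

-- Counting with Boolean predicates and indicator sums.

module FiniteCounting where
  open import Data.Bool using (not; _∧_; _∨_)
  open import Data.Nat using (_+_; _*_; _∸_; _≤_; _<_; z≤n; s≤s; >-nonZero)
  open Algebra.Properties.CommutativeSemigroup ℕ.*-commutativeSemigroup using (x∙yz≈y∙xz)
  open Algebra.Properties.Semiring.Sum ℕ.+-*-semiring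
    using (sum; sum-cong-≗; ∑-comm; ∑-distrib-+; *-distribˡ-sum; *-distribʳ-sum)

  true≢false : true ≢ false
  true≢false ()

  ∧-intro : ∀ {a b} → a ≡ true → b ≡ true → a ∧ b ≡ true
  ∧-intro ≡.refl ≡.refl = ≡.refl

  ∧-elim : ∀ {a b} → a ∧ b ≡ true → a ≡ true × b ≡ true
  ∧-elim {true} {true} _ = ≡.refl , ≡.refl

  ∨-elim : ∀ {a b} → a ∨ b ≡ true → a ≡ true ⊎ b ≡ true
  ∨-elim {true}  _ = inj₁ ≡.refl
  ∨-elim {false} h = inj₂ h

  ∨-introʳ : ∀ {a b} → b ≡ true → a ∨ b ≡ true
  ∨-introʳ {true}  _ = ≡.refl
  ∨-introʳ {false} h = h

  ≢true⇒≡false : ∀ {a} → a ≢ true → a ≡ false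
  ≢true⇒≡false {true}  h = ⊥-elim (h ≡.refl)
  ≢true⇒≡false {false} _ = ≡.refl

  ⌊⌋-intro : ∀ {P : Set} (P? : Dec P) → P → ⌊ P? ⌋ ≡ true
  ⌊⌋-intro (yes _) _ = ≡.refl
  ⌊⌋-intro (no ¬p) p = ⊥-elim (¬p p)

  ⌊⌋-elim : ∀ {P : Set} (P? : Dec P) → ⌊ P? ⌋ ≡ true → P
  ⌊⌋-elim (yes p) _ = p

  indicator : Bool → ℕ
  indicator b = if b then 1 else 0

  indicator-∧ : ∀ a b → indicator (a ∧ b) ≡ indicator a * indicator b
  indicator-∧ true  b = ≡.sym (ℕ.+-identityʳ _)
  indicator-∧ false b = ≡.refl

  count≡sum : ∀ {n} (p : Fin n → Bool) → count p ≡ sum (indicator ∘ p)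
  count≡sum {zero}  p = ≡.refl
  count≡sum {suc n} p = ≡.cong (indicator (p zero) +_) (count≡sum (p ∘ suc))

  sum-mono : ∀ {n} {f g : Fin n → ℕ} → (∀ i → f i ≤ g i) → sum f ≤ sum g
  sum-mono {zero}  h = z≤n
  sum-mono {suc n} h = ℕ.+-mono-≤ (h zero) (sum-mono (h ∘ suc))

  sum-strict : ∀ {n} {f g : Fin n → ℕ} i → (∀ j → f j ≤ g j) → f i < g i → sum f < sum g
  sum-strict zero    h f<g = ℕ.+-mono-<-≤ f<g (sum-mono (h ∘ suc))
  sum-strict (suc i) h f<g = ℕ.+-mono-≤-< (h zero) (sum-strict i (h ∘ suc) f<g)

  term≤sum : ∀ {n} (f : Fin n → ℕ) i → f i ≤ sum f
  term≤sum f zero    = ℕ.m≤m+n _ _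
  term≤sum f (suc i) = ℕ.≤-trans (term≤sum (f ∘ suc) i) (ℕ.m≤n+m _ _)

  sum≡0 : ∀ {n} {f : Fin n → ℕ} → (∀ i → f i ≡ 0) → sum f ≡ 0
  sum≡0 {zero}  h = ≡.refl
  sum≡0 {suc n} h = ≡.cong₂ _+_ (h zero) (sum≡0 (h ∘ suc))

  count-cong : ∀ {n} {p q : Fin n → Bool} → (∀ i → p i ≡ q i) → count p ≡ count q
  count-cong {p = p} {q} h = ≡.trans (count≡sum p) (≡.trans (sum-cong-≗ (≡.cong indicator ∘ h)) (≡.sym (count≡sum q)))

  count-pos : ∀ {n} (p : Fin n → Bool) i → p i ≡ true → 1 ≤ count p
  count-pos p i pi = ≡.subst (1 ≤_) (≡.sym (count≡sum p)) (≡.subst (λ b → indicator b ≤ sum (indicator ∘ p)) pi (term≤sum (indicator ∘ p) i))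

  iff⇒≡ : ∀ {a b} → (a ≡ true → b ≡ true) → (b ≡ true → a ≡ true) → a ≡ b
  iff⇒≡ {true}  {b}     f g = ≡.sym (f ≡.refl)
  iff⇒≡ {false} {true}  f g = g ≡.refl
  iff⇒≡ {false} {false} f g = ≡.refl

  indicator-mono : ∀ {a b} → (a ≡ true → b ≡ true) → indicator a ≤ indicator b
  indicator-mono {true}  f = ℕ.≤-reflexive (≡.cong indicator (≡.sym (f ≡.refl)))
  indicator-mono {false} f = z≤n

  -- Otherwise p would be contained in q, properly because of i, against the equal counts. A finite
  -- search produces the witness.
  equicounted⇒∃ : ∀ {n} (p q : Fin n → Bool) i → count p ≡ count q → q i ≡ true → p i ≡ false →
    ∃ λ j → p j ≡ true × q j ≡ false
  equicounted⇒∃ p q i p≡q qi pi with any? (λ j → (p j ≟ᵇ true) ×-dec (q j ≟ᵇ false))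
  ... | yes found = found
  ... | no none = ⊥-elim (ℕ.<-irrefl p≡q (≡.subst₂ _<_ (≡.sym (count≡sum p)) (≡.sym (count≡sum q))
    (sum-strict i (λ j → indicator-mono (p⇒q j)) (≡.subst₂ (λ a b → indicator a < indicator b) (≡.sym pi) (≡.sym qi) (s≤s z≤n)))))
    where
    p⇒q : ∀ j → p j ≡ true → q j ≡ true
    p⇒q j pj with q j in qj
    ... | true  = ≡.refl
    ... | false = ⊥-elim (none (j , pj , qj))

  count-split : ∀ {n} (p q r : Fin n → Bool) → (∀ i → indicator (p i) ≡ indicator (q i) + indicator (r i)) →
    count p ≡ count q + count r
  count-split p q r h = begin
    count p                                      ≡⟨ count≡sum p ⟩
    sum (indicator ∘ p)                          ≡⟨ sum-cong-≗ h ⟩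
    sum (λ i → indicator (q i) + indicator (r i)) ≡⟨ ∑-distrib-+ (indicator ∘ q) (indicator ∘ r) ⟩
    sum (indicator ∘ q) + sum (indicator ∘ r)    ≡⟨ ≡.cong₂ _+_ (count≡sum q) (count≡sum r) ⟨
    count q + count r                            ∎
    where open ≡.≡-Reasoning

  count-singleton : ∀ {n} (x : Fin n) → count (λ i → ⌊ x Fin.≟ i ⌋) ≡ 1
  count-singleton {suc n} zero = ≡.cong suc (≡.trans (count≡sum {n} _) (sum≡0 {n} {λ _ → 0} λ _ → ≡.refl))
  count-singleton {suc n} (suc x) = ≡.trans (count-cong λ i → iff⇒≡
      (λ h → ⌊⌋-intro (x Fin.≟ i) (suc-injective (⌊⌋-elim (suc x Fin.≟ suc i) h)))
      (λ h → ⌊⌋-intro (suc x Fin.≟ suc i) (≡.cong suc (⌊⌋-elim (x Fin.≟ i) h)))) (count-singleton x)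

  anyF-elim : ∀ {n} (p : Fin n → Bool) → anyF p ≡ true → ∃ λ i → p i ≡ true
  anyF-elim {suc n} p h with ∨-elim h
  ... | inj₁ p0 = zero , p0
  ... | inj₂ h′ = let i , pi = anyF-elim (p ∘ suc) h′ in suc i , pi

  anyF-intro : ∀ {n} (p : Fin n → Bool) i → p i ≡ true → anyF p ≡ true
  anyF-intro p zero    pi = ≡.cong (_∨ anyF (p ∘ suc)) pi
  anyF-intro p (suc i) pi = ∨-introʳ (anyF-intro (p ∘ suc) i pi)

  least≤ : ∀ p m → least p m ≤ m
  least≤ p zero = z≤n
  least≤ p (suc m) with p 0
  ... | true  = z≤n
  ... | false = s≤s (least≤ (p ∘ suc) m)

  -- The bound j < m excludes the default value m of a failed search. For distances the default is
  -- the number n of vertices, so 3 ≤ n makes the values 0, 1 and 2 meaningful.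
  least-elim : ∀ p m j → j < m → least p m ≡ j → p j ≡ true × (∀ i → i < j → p i ≡ false)
  least-elim p (suc m) j j<m h with p 0 in p0
  least-elim p (suc m) .0 j<m ≡.refl | true = p0 , λ _ ()
  least-elim p (suc m) (suc j) (s≤s j<m) h | false with least-elim (p ∘ suc) m j j<m (ℕ.suc-injective h)
  ... | pj , below = pj , λ where
    zero    _         → p0
    (suc i) (s≤s i<j) → below i i<j

  least-intro : ∀ p m j → j < m → p j ≡ true → (∀ i → i < j → p i ≡ false) → least p m ≡ j
  least-intro p (suc m) zero    _         pj below rewrite pj = ≡.refl
  least-intro p (suc m) (suc j) (s≤s j<m) pj below rewrite below 0 (s≤s z≤n) =
    ≡.cong suc (least-intro (p ∘ suc) m j j<m pj (λ i i<j → below (suc i) (s≤s i<j)))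

  below-1 : ∀ {P : ℕ → Set} → P 0 → ∀ i → i < 1 → P i
  below-1 p zero _ = p
  below-1 p (suc i) (s≤s ())

  below-2 : ∀ {P : ℕ → Set} → P 0 → P 1 → ∀ i → i < 2 → P i
  below-2 p q zero _ = p
  below-2 p q (suc zero) _ = q
  below-2 p q (suc (suc i)) (s≤s (s≤s ()))

  -- Distances 0, 1 and 2 in terms of adjacency.

  module Distances {n : ℕ} (G : Graph n) (3≤n : 3 ≤ n) where
    open Graph G

    infix 4 _~_
    _~_ : Fin n → Fin n → Set
    x ~ y = adj x y ≡ true

    ~-sym : ∀ {x y} → x ~ y → y ~ x
    ~-sym {x} {y} h = ≡.trans (sym y x) h

    ~⇒≢ : ∀ {x y} → x ~ y → x ≢ y
    ~⇒≢ {x} x~y ≡.refl = true≢false (≡.trans (≡.sym x~y) (irrefl x))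

    record AtDistance2 (x y : Fin n) : Set where
      constructor atDistance2
      field
        distinct    : x ≢ y
        nonadjacent : ¬ (x ~ y)
        middle      : Fin n
        x~middle    : x ~ middle
        middle~y    : middle ~ y

    AtDistance2-sym : ∀ {x y} → AtDistance2 x y → AtDistance2 y x
    AtDistance2-sym (atDistance2 d na z xz zy) = atDistance2 (d ∘ ≡.sym) (na ∘ ~-sym) z (~-sym zy) (~-sym xz)

    reach0-elim : ∀ {x y} → reach G x y 0 ≡ true → x ≡ y
    reach0-elim {x} {y} = ⌊⌋-elim (x Fin.≟ y)

    reach0-intro : ∀ {x y} → x ≡ y → reach G x y 0 ≡ true
    reach0-intro {x} {y} = ⌊⌋-intro (x Fin.≟ y)

    reach1-elim : ∀ {x y} → reach G x y 1 ≡ true → x ≡ y ⊎ x ~ y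
    reach1-elim {x} {y} h with ∨-elim h
    ... | inj₁ h₀ = inj₁ (reach0-elim h₀)
    ... | inj₂ h₁ with anyF-elim (λ z → adj x z ∧ reach G z y 0) h₁
    ...   | z , hz with ∧-elim hz
    ...     | x~z , z≡y = inj₂ (≡.subst (x ~_) (reach0-elim z≡y) x~z)

    reach1-intro : ∀ {x y} → x ~ y → reach G x y 1 ≡ true
    reach1-intro {x} {y} x~y = ∨-introʳ (anyF-intro _ y (∧-intro x~y (reach0-intro {y} ≡.refl)))

    dist≡0⇒≡ : ∀ {x y} → dist G x y ≡ 0 → x ≡ y
    dist≡0⇒≡ h = reach0-elim (proj₁ (least-elim _ n 0 (ℕ.≤-trans (s≤s z≤n) 3≤n) h))

    dist-refl : ∀ x → dist G x x ≡ 0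
    dist-refl x = least-intro _ n 0 (ℕ.≤-trans (s≤s z≤n) 3≤n) (reach0-intro {x} ≡.refl) (λ _ ())

    dist≡1⇒~ : ∀ {x y} → dist G x y ≡ 1 → x ~ y
    dist≡1⇒~ {x} {y} h with least-elim _ n 1 (ℕ.≤-trans (s≤s (s≤s z≤n)) 3≤n) h
    ... | r₁ , below with reach1-elim {x} {y} r₁
    ...   | inj₁ x≡y = ⊥-elim (true≢false (≡.trans (≡.sym (reach0-intro x≡y)) (below 0 (s≤s z≤n))))
    ...   | inj₂ x~y = x~y

    ~⇒dist≡1 : ∀ {x y} → x ~ y → dist G x y ≡ 1
    ~⇒dist≡1 {x} {y} x~y = least-intro (reach G x y) n 1 (ℕ.≤-trans (s≤s (s≤s z≤n)) 3≤n) (reach1-intro x~y)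
      (below-1 (≢true⇒≡false (~⇒≢ x~y ∘ reach0-elim)))

    dist≡2⇒ : ∀ {x y} → dist G x y ≡ 2 → AtDistance2 x y
    dist≡2⇒ {x} {y} h with least-elim (reach G x y) n 2 3≤n h
    ... | r₂ , below with ∨-elim {reach G x y 1} r₂
    ...   | inj₁ r₁ = ⊥-elim (true≢false (≡.trans (≡.sym r₁) (below 1 (s≤s (s≤s z≤n)))))
    ...   | inj₂ r with anyF-elim _ r
    ...     | z , hz with ∧-elim hz
    ...       | x~z , r₁ = result (reach1-elim {z} {y} r₁)
      where
      ¬x~y : ¬ (x ~ y)
      ¬x~y x~y = true≢false (≡.trans (≡.sym (reach1-intro x~y)) (below 1 (s≤s (s≤s z≤n))))
      result : z ≡ y ⊎ z ~ y → AtDistance2 x y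
      result (inj₁ z≡y) = ⊥-elim (¬x~y (≡.subst (x ~_) z≡y x~z))
      result (inj₂ z~y) = atDistance2
        (λ x≡y → true≢false (≡.trans (≡.sym (reach0-intro x≡y)) (below 0 (s≤s z≤n)))) ¬x~y z x~z z~y

    ⇒dist≡2 : ∀ {x y} → AtDistance2 x y → dist G x y ≡ 2
    ⇒dist≡2 {x} {y} (atDistance2 x≢y x≁y z x~z z~y) = least-intro (reach G x y) n 2 3≤n
      (∨-introʳ {reach G x y 1} (anyF-intro _ z (∧-intro x~z (reach1-intro z~y))))
      (below-2 (≢true⇒≡false (x≢y ∘ reach0-elim))
        (≢true⇒≡false λ r₁ → case (reach1-elim {x} {y} r₁)))
      where
      case : x ≡ y ⊎ x ~ y → ⊥
      case (inj₁ x≡y) = x≢y x≡y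
      case (inj₂ x~y) = x≁y x~y

    dist≡2-sym : ∀ {x y} → dist G x y ≡ 2 → dist G y x ≡ 2
    dist≡2-sym = ⇒dist≡2 ∘ AtDistance2-sym ∘ dist≡2⇒

    module _ {x : Fin n} {C : Fin n → Bool} where

      private
        near : ℕ → Bool
        near j = anyF (λ y → C y ∧ ⌊ dist G x y ℕ.≟ j ⌋)

        near-elim : ∀ j → near j ≡ true → ∃ λ y → C y ≡ true × dist G x y ≡ j
        near-elim j h with anyF-elim _ h
        ... | y , hy with ∧-elim {C y} hy
        ...   | y∈C , d = y , y∈C , ⌊⌋-elim (dist G x y ℕ.≟ j) d

        near-intro : ∀ j y → C y ≡ true → dist G x y ≡ j → near j ≡ true
        near-intro j y y∈C d = anyF-intro _ y (∧-intro y∈C (⌊⌋-intro (dist G x y ℕ.≟ j) d))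

        near0 : C x ≢ true → near 0 ≡ false
        near0 x∉C = ≢true⇒≡false λ h → let y , y∈C , d = near-elim 0 h in
          x∉C (≡.subst (λ z → C z ≡ true) (≡.sym (dist≡0⇒≡ d)) y∈C)

      distSet≡1⇒ : distSet G x C ≡ 1 → C x ≢ true × ∃ λ y → C y ≡ true × x ~ y
      distSet≡1⇒ h with least-elim near n 1 (ℕ.≤-trans (s≤s (s≤s z≤n)) 3≤n) h
      ... | near₁ , below with near-elim 1 near₁
      ...   | y , y∈C , d = (λ x∈C → true≢false (≡.trans (≡.sym (near-intro 0 x x∈C (dist-refl x))) (below 0 (s≤s z≤n)))) ,
                y , y∈C , dist≡1⇒~ d

      ⇒distSet≡1 : C x ≢ true → ∀ y → C y ≡ true → x ~ y → distSet G x C ≡ 1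
      ⇒distSet≡1 x∉C y y∈C x~y = least-intro near n 1 (ℕ.≤-trans (s≤s (s≤s z≤n)) 3≤n)
        (near-intro 1 y y∈C (~⇒dist≡1 x~y)) (below-1 (near0 x∉C))

      ⇒distSet≡2 : C x ≢ true → (∀ y → C y ≡ true → ¬ (x ~ y)) → ∀ y → C y ≡ true → dist G x y ≡ 2 → distSet G x C ≡ 2
      ⇒distSet≡2 x∉C far y y∈C d = least-intro near n 2 3≤n (near-intro 2 y y∈C d)
        (below-2 (near0 x∉C) (≢true⇒≡false λ h → let z , z∈C , d₁ = near-elim 1 h in far z z∈C (dist≡1⇒~ d₁)))

  -- Double counting with points and lines.

  module LineCounting {n : ℕ} (G : Graph n) (3≤n : 3 ≤ n) {L : ℕ} (line : Fin L → Fin n → Bool)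
    (clique : ∀ m → IsClique G (line m)) where
    open Graph G
    open Distances G 3≤n
    open Lines G line

    infix 4 _∈_
    _∈_ : Fin n → Fin L → Set
    x ∈ m = line m x ≡ true

    bracket-elim : ∀ {x z m} → bracket x z m ≡ true → x ∈ m × distSet G z (line m) ≡ 1
    bracket-elim {x} {z} {m} h with ∧-elim {line m x} h
    ... | x∈m , d = x∈m , ⌊⌋-elim (distSet G z (line m) ℕ.≟ 1) d

    bracket-intro : ∀ {x z m} → x ∈ m → distSet G z (line m) ≡ 1 → bracket x z m ≡ true
    bracket-intro {x} {z} {m} x∈m d = ∧-intro x∈m (⌊⌋-intro (distSet G z (line m) ℕ.≟ 1) d)

    collinear : ∀ {x y m} → x ∈ m → y ∈ m → x ≡ y ⊎ x ~ y
    collinear {x} {y} {m} x∈m y∈m with x Fin.≟ y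
    ... | yes x≡y = inj₁ x≡y
    ... | no x≢y  = inj₂ (clique m x y x∈m y∈m x≢y)

    neighboursOn : Fin n → Fin L → ℕ
    neighboursOn x m = count (λ y → line m y ∧ adj x y)

    farOn : Fin n → Fin L → Fin n → Bool
    farOn x l y = line l y ∧ ⌊ dist G x y ℕ.≟ 2 ⌋

    farOn-elim : ∀ {x l y} → farOn x l y ≡ true → y ∈ l × dist G x y ≡ 2
    farOn-elim {x} {l} {y} h with ∧-elim {line l y} h
    ... | y∈l , d = y∈l , ⌊⌋-elim (dist G x y ℕ.≟ 2) d

    neighboursOn≡ : ∀ x m → count (λ y → line m y ∧ ⌊ dist G x y ℕ.≟ 1 ⌋) ≡ neighboursOn x m
    neighboursOn≡ x m = count-cong λ y → iff⇒≡
      (λ h → let y∈m , d = ∧-elim {line m y} h in ∧-intro y∈m (dist≡1⇒~ (⌊⌋-elim (dist G x y ℕ.≟ 1) d)))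
      (λ h → let y∈m , x~y = ∧-elim {line m y} h in ∧-intro y∈m (⌊⌋-intro (dist G x y ℕ.≟ 1) (~⇒dist≡1 x~y)))

    adjacentPairs : Fin L → Fin L → ℕ
    adjacentPairs m l = sum λ u → sum λ y → indicator (line m u) * (indicator (line l y) * indicator (adj u y))

    neighboursOn≡sum : ∀ u l → sum (λ y → indicator (line l y) * indicator (adj u y)) ≡ neighboursOn u l
    neighboursOn≡sum u l = ≡.trans (sum-cong-≗ λ y → ≡.sym (indicator-∧ (line l y) (adj u y))) (≡.sym (count≡sum (λ y → line l y ∧ adj u y)))

    adjacentPairs-rows : ∀ m l → adjacentPairs m l ≡ sum (λ u → indicator (line m u) * neighboursOn u l)
    adjacentPairs-rows m l = sum-cong-≗ λ u → ≡.trans (≡.sym (*-distribˡ-sum (indicator (line m u)) (λ y → indicator (line l y) * indicator (adj u y))))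
      (≡.cong (indicator (line m u) *_) (neighboursOn≡sum u l))

    adjacentPairs-sym : ∀ m l → adjacentPairs m l ≡ adjacentPairs l m
    adjacentPairs-sym m l = ≡.trans (∑-comm {n} {n} λ u y → indicator (line m u) * (indicator (line l y) * indicator (adj u y))) (sum-cong-≗ λ y → sum-cong-≗ λ u → begin
      indicator (line m u) * (indicator (line l y) * indicator (adj u y))    ≡⟨ ≡.cong (λ b → indicator (line m u) * (indicator (line l y) * indicator b)) (sym u y) ⟩
      indicator (line m u) * (indicator (line l y) * indicator (adj y u))    ≡⟨ x∙yz≈y∙xz (indicator (line m u)) (indicator (line l y)) (indicator (adj y u)) ⟩
      indicator (line l y) * (indicator (line m u) * indicator (adj y u))    ∎)
      where
      open ≡.≡-Reasoning

    -- Count the pairs of a line through x and another point on it: each line through x has s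
    -- further points, and each neighbour of x shares exactly one line with x.
    neighbours-on-lines : ∀ {s} → (∀ m → count (line m) ≡ suc s) →
      (∀ x y → x ~ y → count (λ m → line m x ∧ line m y) ≡ 1) →
      ∀ x → count (λ m → line m x) * s ≡ count (adj x)
    neighbours-on-lines {s} size unique x = begin
      count (λ m → line m x) * s
        ≡⟨ ≡.cong (_* s) (count≡sum (λ m → line m x)) ⟩
      sum (λ m → indicator (line m x)) * s
        ≡⟨ *-distribʳ-sum s (λ m → indicator (line m x)) ⟩
      sum (λ m → indicator (line m x) * s)
        ≡⟨ sum-cong-≗ byLine ⟩
      sum (λ m → sum λ z → indicator (adj x z) * indicator (line m x ∧ line m z))
        ≡⟨ ∑-comm {L} {n} (λ m z → indicator (adj x z) * indicator (line m x ∧ line m z)) ⟩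
      sum (λ z → sum λ m → indicator (adj x z) * indicator (line m x ∧ line m z))
        ≡⟨ sum-cong-≗ byNeighbour ⟩
      sum (λ z → indicator (adj x z))
        ≡⟨ count≡sum (adj x) ⟨
      count (adj x) ∎
      where
      open ≡.≡-Reasoning

      others : ∀ m → x ∈ m → neighboursOn x m ≡ s
      others m x∈m = ℕ.suc-injective (≡.trans (≡.sym (≡.trans
        (count-split (line m) (λ z → ⌊ x Fin.≟ z ⌋) (λ z → line m z ∧ adj x z) cases)
        (≡.cong (_+ neighboursOn x m) (count-singleton x)))) (size m))
        where
        cases : ∀ z → indicator (line m z) ≡ indicator ⌊ x Fin.≟ z ⌋ + indicator (line m z ∧ adj x z)
        cases z with x Fin.≟ z
        ... | yes ≡.refl rewrite x∈m | irrefl x = ≡.refl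
        ... | no x≢z with line m z in z∈m
        ...   | true  = ≡.cong indicator (≡.sym (clique m x z x∈m z∈m x≢z))
        ...   | false = ≡.refl

      byLine : ∀ m → indicator (line m x) * s ≡ sum λ z → indicator (adj x z) * indicator (line m x ∧ line m z)
      byLine m with line m x in x∈m
      ... | true  = ≡.trans (ℕ.+-identityʳ s) (≡.trans (≡.sym (others m x∈m)) (≡.trans (≡.sym (neighboursOn≡sum x m))
                      (sum-cong-≗ λ z → ℕ.*-comm (indicator (line m z)) (indicator (adj x z)))))
      ... | false = ≡.sym (sum≡0 {f = λ z → indicator (adj x z) * 0} λ z → ℕ.*-zeroʳ (indicator (adj x z)))

      byNeighbour : ∀ z → sum (λ m → indicator (adj x z) * indicator (line m x ∧ line m z)) ≡ indicator (adj x z)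
      byNeighbour z with adj x z in x~z
      ... | true  = ≡.trans (sum-cong-≗ λ m → ℕ.+-identityʳ (indicator (line m x ∧ line m z)))
                      (≡.trans (≡.sym (count≡sum (λ m → line m x ∧ line m z))) (unique x z x~z))
      ... | false = sum≡0 {L} {λ _ → 0} λ _ → ≡.refl

    module _ {φ₁ φ₂ : ℕ}
      (near : ∀ x m → distSet G x (line m) ≡ 1 → neighboursOn x m ≡ φ₁)
      (far : ∀ x m → distSet G x (line m) ≡ 2 → count (farOn x m) ≡ φ₂) where

      φ₁-pos : ∀ {x l} → distSet G x (line l) ≡ 1 → 1 ≤ φ₁
      φ₁-pos {x} {l} d with distSet≡1⇒ d
      ... | _ , z , z∈l , x~z = ≡.subst (1 ≤_) (near x l d) (count-pos (λ y → line l y ∧ adj x y) z (∧-intro z∈l x~z))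

      line-split : ∀ {x l} → distSet G x (line l) ≡ 1 → count (line l) ≡ count (farOn x l) + φ₁
      line-split {x} {l} d with distSet≡1⇒ d
      ... | x∉l , z , z∈l , x~z = ≡.trans
        (count-split (line l) (farOn x l) (λ y → line l y ∧ adj x y) cases) (≡.cong (count (farOn x l) +_) (near x l d))
        where
        cases : ∀ y → indicator (line l y) ≡ indicator (farOn x l y) + indicator (line l y ∧ adj x y)
        cases y with line l y in y∈l | adj x y in x~y | dist G x y ℕ.≟ 2
        ... | false | _     | _     = ≡.refl
        ... | true  | true  | yes d₂ = ⊥-elim (AtDistance2.nonadjacent (dist≡2⇒ d₂) x~y)
        ... | true  | true  | no _   = ≡.refl
        ... | true  | false | yes _  = ≡.refl
        ... | true  | false | no d₂  = ⊥-elim (d₂ (⇒dist≡2 (atDistance2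
                (λ x≡y → x∉l (≡.subst (_∈ l) (≡.sym x≡y) y∈l)) (λ x~y′ → true≢false (≡.trans (≡.sym x~y′) x~y)) z x~z
                (z~y (collinear z∈l y∈l)))))
          where
          z~y : z ≡ y ⊎ z ~ y → z ~ y
          z~y (inj₁ ≡.refl) = ⊥-elim (true≢false (≡.trans (≡.sym x~z) x~y))
          z~y (inj₂ z~y) = z~y

      -- Count the adjacent pairs (u , y) with u on m and y on l in two ways: a
      -- point u with a neighbour on l is at distance 2 from y′, and every point of
      -- l that is adjacent to x, or at distance 2 from x and 1 from m, has φ₁ neighbours on m.
      bracket-bound : ∀ {x l y′ m} → distSet G x (line l) ≡ 1 → x ∈ m → y′ ∈ l → dist G x y′ ≡ 2 →
        bracket x y′ m ≡ false → count (λ y → farOn x l y ∧ bracket x y m) + φ₁ ≤ φ₂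
      bracket-bound {x} {l} {y′} {m} dxl x∈m y′∈l d₂ ∉bracket = ℕ.*-cancelʳ-≤ _ _ φ₁ {{>-nonZero (φ₁-pos dxl)}} (begin
        (count (λ y → farOn x l y ∧ bracket x y m) + φ₁) * φ₁
          ≡⟨ ≡.cong (_* φ₁) (≡.cong₂ _+_ (count≡sum (λ y → farOn x l y ∧ bracket x y m)) (≡.trans (≡.sym (near x l dxl)) (count≡sum (λ y → line l y ∧ adj x y)))) ⟩
        (sum (λ y → indicator (farOn x l y ∧ bracket x y m)) + sum (λ y → indicator (line l y ∧ adj x y))) * φ₁
          ≡⟨ ≡.cong (_* φ₁) (≡.sym (∑-distrib-+ (λ y → indicator (farOn x l y ∧ bracket x y m)) (λ y → indicator (line l y ∧ adj x y)))) ⟩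
        sum (λ y → indicator (farOn x l y ∧ bracket x y m) + indicator (line l y ∧ adj x y)) * φ₁
          ≡⟨ *-distribʳ-sum φ₁ (λ y → indicator (farOn x l y ∧ bracket x y m) + indicator (line l y ∧ adj x y)) ⟩
        sum (λ y → (indicator (farOn x l y ∧ bracket x y m) + indicator (line l y ∧ adj x y)) * φ₁)
          ≤⟨ sum-mono lower ⟩
        sum (λ y → indicator (line l y) * neighboursOn y m)
          ≡⟨ adjacentPairs-rows l m ⟨
        adjacentPairs l m
          ≡⟨ adjacentPairs-sym l m ⟩
        adjacentPairs m l
          ≡⟨ adjacentPairs-rows m l ⟩
        sum (λ u → indicator (line m u) * neighboursOn u l)
          ≤⟨ sum-mono upper ⟩
        sum (λ u → indicator (farOn y′ m u) * φ₁)
          ≡⟨ *-distribʳ-sum φ₁ (λ u → indicator (farOn y′ m u)) ⟨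
        sum (λ u → indicator (farOn y′ m u)) * φ₁
          ≡⟨ ≡.cong (_* φ₁) (≡.trans (≡.sym (count≡sum (farOn y′ m))) (far y′ m dy′m)) ⟩
        φ₂ * φ₁ ∎)
        where
        open ℕ.≤-Reasoning
        x-y′ = dist≡2⇒ d₂

        y′∉m : line m y′ ≢ true
        y′∉m y′∈m with collinear x∈m y′∈m
        ... | inj₁ x≡y′ = AtDistance2.distinct x-y′ x≡y′
        ... | inj₂ x~y′ = AtDistance2.nonadjacent x-y′ x~y′

        y′≁m : ∀ u → u ∈ m → ¬ (y′ ~ u)
        y′≁m u u∈m y′~u = true≢false (≡.trans (≡.sym (bracket-intro x∈m (⇒distSet≡1 y′∉m u u∈m y′~u))) ∉bracket)

        dy′m : distSet G y′ (line m) ≡ 2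
        dy′m = ⇒distSet≡2 y′∉m y′≁m x x∈m (dist≡2-sym d₂)

        lower : ∀ y → (indicator (farOn x l y ∧ bracket x y m) + indicator (line l y ∧ adj x y)) * φ₁ ≤
          indicator (line l y) * neighboursOn y m
        lower y with farOn x l y ∧ bracket x y m in far-y | line l y ∧ adj x y in near-y
        ... | false | false = z≤n
        ... | true  | true  = ⊥-elim (AtDistance2.nonadjacent (dist≡2⇒ (proj₂ (farOn-elim (proj₁ (∧-elim {farOn x l y} far-y)))))
                                      (proj₂ (∧-elim {line l y} near-y)))
        ... | true  | false with ∧-elim {farOn x l y} far-y
        ...   | fy , by = ℕ.≤-reflexive (≡.cong₂ _*_ (≡.cong indicator (≡.sym (proj₁ (farOn-elim {x} {l} {y} fy))))
                            (≡.sym (near y m (proj₂ (bracket-elim {x} {y} {m} by)))))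
        lower y | false | true with ∧-elim {line l y} near-y
        -- A point y of l is y′ or adjacent to it, so y lies outside m, to which y′ has distance 2.
        -- The neighbour x of y then shows that y has distance 1 from m.
        ...   | y∈l , x~y = ℕ.≤-reflexive (≡.cong₂ _*_ (≡.cong indicator (≡.sym y∈l))
                              (≡.sym (near y m (⇒distSet≡1 (y∉m (collinear y′∈l y∈l)) x x∈m (~-sym x~y)))))
          where
          y∉m : y′ ≡ y ⊎ y′ ~ y → line m y ≢ true
          y∉m (inj₁ ≡.refl) = y′∉m
          y∉m (inj₂ y′~y) y∈m = y′≁m y y∈m y′~y

        upper : ∀ u → indicator (line m u) * neighboursOn u l ≤ indicator (farOn y′ m u) * φ₁
        upper u with line m u in u∈m
        ... | false = z≤n
        ... | true with any? (λ y → (line l y ≟ᵇ true) ×-dec (adj u y ≟ᵇ true))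
        ...   | no none = ≡.subst (_≤ indicator ⌊ dist G y′ u ℕ.≟ 2 ⌋ * φ₁) (≡.sym (≡.trans (ℕ.+-identityʳ _) (≡.trans (count≡sum (λ y → line l y ∧ adj u y))
                  (sum≡0 λ y → ≡.cong indicator (≢true⇒≡false λ h → none (y , ∧-elim {line l y} h)))))) z≤n
        ...   | yes (y , y∈l , u~y) = ℕ.≤-reflexive (≡.cong₂ _*_
                  (≡.cong indicator (≡.sym (⌊⌋-intro (dist G y′ u ℕ.≟ 2) (⇒dist≡2 (atDistance2
                    (λ y′≡u → y′∉m (≡.subst (_∈ m) (≡.sym y′≡u) u∈m)) (y′≁m u u∈m) y (y′~y (collinear y′∈l y∈l)) (~-sym u~y))))))
                  (near u l (⇒distSet≡1 (λ u∈l → u∉l (collinear y′∈l u∈l)) y y∈l u~y)))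
          where
          y′~y : y′ ≡ y ⊎ y′ ~ y → y′ ~ y
          y′~y (inj₁ ≡.refl) = ⊥-elim (y′≁m u u∈m (~-sym u~y))
          y′~y (inj₂ y′~y)   = y′~y
          u∉l : y′ ≡ u ⊎ y′ ~ u → ⊥
          u∉l (inj₁ ≡.refl) = y′∉m u∈m
          u∉l (inj₂ y′~u)   = y′≁m u u∈m y′~u

      module _ {τ₂ : ℕ} (brackets : ∀ x z → dist G z x ≡ 2 → count (bracket x z) ≡ τ₂) where

        -- If m₁ lies in [x , y₂] but not in [x , y₁], every y on l at distance 2 from
        -- x has m₁ ∈ [x , y], or some line of [x , y] is outside [x , y₂].
        separated-bound : ∀ {x l y₁ y₂ m₁} → distSet G x (line l) ≡ 1 → y₁ ∈ l → y₂ ∈ l →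
          dist G x y₁ ≡ 2 → dist G x y₂ ≡ 2 → bracket x y₂ m₁ ≡ true → bracket x y₁ m₁ ≡ false →
          ∃₂ λ e t → φ₁ + e ≡ φ₂ × τ₂ + t ≡ count (λ m → line m x) × count (line l) ≤ suc t * e + φ₁
        separated-bound {x} {l} {y₁} {y₂} {m₁} dxl y₁∈l y₂∈l d₁ d₂ ∈b₂ ∉b₁ =
          e , t , ℕ.m+[n∸m]≡n (ℕ.≤-trans (ℕ.m≤n+m φ₁ _) bound₁) , lines-split ,
          ≡.subst (_≤ suc t * e + φ₁) (≡.sym (line-split dxl)) (ℕ.+-monoˡ-≤ φ₁ (begin
            count (farOn x l)
              ≡⟨ count≡sum (farOn x l) ⟩
            sum (λ y → indicator (farOn x l y))
              ≤⟨ sum-mono cover ⟩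
            sum (λ y → indicator (both m₁ y) + sum λ m → indicator (outside m) * indicator (both m y))
              ≡⟨ ∑-distrib-+ (λ y → indicator (both m₁ y)) (λ y → sum λ m → indicator (outside m) * indicator (both m y)) ⟩
            sum (λ y → indicator (both m₁ y)) + sum (λ y → sum λ m → indicator (outside m) * indicator (both m y))
              ≡⟨ ≡.cong₂ _+_ (≡.sym (count≡sum (both m₁))) (∑-comm {n} {L} λ y m → indicator (outside m) * indicator (both m y)) ⟩
            count (both m₁) + sum (λ m → sum λ y → indicator (outside m) * indicator (both m y))
              ≤⟨ ℕ.+-mono-≤ (≤e bound₁) (sum-mono perLine) ⟩
            e + sum (λ m → indicator (outside m) * e)
              ≡⟨ ≡.cong (e +_) (≡.trans (≡.sym (*-distribʳ-sum e (indicator ∘ outside))) (≡.cong (_* e) (≡.sym (count≡sum outside)))) ⟩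
            suc t * e ∎))
          where
          open ℕ.≤-Reasoning
          both : Fin L → Fin n → Bool
          both m y = farOn x l y ∧ bracket x y m
          outside : Fin L → Bool
          outside m = line m x ∧ not (bracket x y₂ m)
          -- `bound₁` gives φ₁ ≤ φ₂, so the truncated difference is exact. The factor `suc t`
          -- consists of the t lines through x outside [x , y₂] and of m₁.
          e = φ₂ ∸ φ₁
          t = count outside

          bound₁ : count (both m₁) + φ₁ ≤ φ₂
          bound₁ = bracket-bound dxl (proj₁ (bracket-elim {x} {y₂} {m₁} ∈b₂)) y₁∈l d₁ ∉b₁

          ≤e : ∀ {c} → c + φ₁ ≤ φ₂ → c ≤ e
          ≤e {c} = ℕ.m+n≤o⇒m≤o∸n c

          lines-split : τ₂ + t ≡ count (λ m → line m x)
          lines-split = ≡.sym (≡.trans (count-split (λ m → line m x) (bracket x y₂) outside cases)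
            (≡.cong (_+ t) (brackets x y₂ (dist≡2-sym d₂))))
            where
            cases : ∀ m → indicator (line m x) ≡ indicator (bracket x y₂ m) + indicator (outside m)
            cases m with line m x | ⌊ distSet G y₂ (line m) ℕ.≟ 1 ⌋
            ... | false | _     = ≡.refl
            ... | true  | true  = ≡.refl
            ... | true  | false = ≡.refl

          perLine : ∀ m → sum (λ y → indicator (outside m) * indicator (both m y)) ≤ indicator (outside m) * e
          perLine m with outside m in out
          ... | false = ℕ.≤-reflexive (sum≡0 {n} {λ _ → 0} λ _ → ≡.refl)
          ... | true with ∧-elim {line m x} out
          ...   | x∈m , ∉b₂ = ℕ.≤-trans
                  (ℕ.≤-reflexive (≡.trans (sum-cong-≗ λ y → ℕ.+-identityʳ (indicator (both m y))) (≡.sym (count≡sum (both m)))))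
                  (ℕ.≤-trans (≤e (bracket-bound dxl x∈m y₂∈l d₂ (not-true ∉b₂))) (ℕ.≤-reflexive (≡.sym (ℕ.+-identityʳ e))))
            where
            not-true : ∀ {b} → not b ≡ true → b ≡ false
            not-true {false} _ = ≡.refl

          cover : ∀ y → indicator (farOn x l y) ≤ indicator (both m₁ y) + sum λ m → indicator (outside m) * indicator (both m y)
          cover y with farOn x l y in fy
          ... | false = z≤n
          ... | true with bracket x y m₁ in by₁
          ...   | true  = s≤s z≤n
          ...   | false with equicounted⇒∃ (bracket x y) (bracket x y₂) m₁
                            (≡.trans (brackets x y (dist≡2-sym (proj₂ (farOn-elim {x} {l} {y} fy)))) (≡.sym (brackets x y₂ (dist≡2-sym d₂)))) ∈b₂ by₁
          ...     | m , by , ∉b₂ = ℕ.≤-trans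
                    (ℕ.≤-reflexive (≡.cong₂ (λ p q → indicator p * indicator q)
                      (≡.sym (∧-intro (proj₁ (bracket-elim {x} {y} {m} by)) (≡.cong not ∉b₂))) (≡.sym by)))
                    (term≤sum (λ m → indicator (outside m) * indicator (bracket x y m)) m)

-- Transfer of the numerical hypothesis from the field to natural numbers.

module NaturalsInField (R : RealClosedField) where
  open StableField R
  open Spectral R using (fromℕ)
  open import Relation.Binary.Reasoning.Setoid setoid

  fromℕ-+ : ∀ m n → fromℕ (m ℕ.+ n) ≈ fromℕ m + fromℕ n
  fromℕ-+ zero    n = sym (+-identityˡ _)
  fromℕ-+ (suc m) n = trans (+-congˡ (fromℕ-+ m n)) (sym (+-assoc _ _ _))

  fromℕ-* : ∀ m n → fromℕ (m ℕ.* n) ≈ fromℕ m * fromℕ n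
  fromℕ-* zero    n = sym (zeroˡ _)
  fromℕ-* (suc m) n = begin
    fromℕ (n ℕ.+ m ℕ.* n)          ≈⟨ fromℕ-+ n (m ℕ.* n) ⟩
    fromℕ n + fromℕ (m ℕ.* n)      ≈⟨ +-congˡ (fromℕ-* m n) ⟩
    fromℕ n + fromℕ m * fromℕ n    ≈⟨ solve 2 (λ m n → n :+ m :* n := (:1 :+ m) :* n) refl (fromℕ m) (fromℕ n) ⟩
    fromℕ (suc m) * fromℕ n        ∎

  fromℕ-nonneg : ∀ n → Nonneg (fromℕ n)
  fromℕ-nonneg zero    = Nonneg-0
  fromℕ-nonneg (suc n) = Nonneg-+ Nonneg-1 (fromℕ-nonneg n)

  -- If m = 1 + n + o, adding o to the difference would make - 1 nonnegative. As the order on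
  -- natural numbers is decidable, the double negation disappears here.
  fromℕ-reflects-≤ : ∀ m n → Nonneg (fromℕ n - fromℕ m) → m ℕ.≤ n
  fromℕ-reflects-≤ m n h with m ℕ.≤? n
  ... | yes m≤n = m≤n
  ... | no m≰n with ℕ.m≤n⇒∃[o]m+o≡n (ℕ.≰⇒> m≰n)
  ...   | o , ≡.refl = ⊥-elim (¬Nonneg-neg1 (Nonneg-resp (begin
    fromℕ n - (1# + fromℕ (n ℕ.+ o)) + fromℕ o
      ≈⟨ +-congʳ (+-congˡ (-‿cong (+-congˡ (fromℕ-+ n o)))) ⟩
    fromℕ n - (1# + (fromℕ n + fromℕ o)) + fromℕ o
      ≈⟨ solve 2 (λ n o → n :- (:1 :+ (n :+ o)) :+ o := :- :1) refl (fromℕ n) (fromℕ o) ⟩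
    - 1# ∎) (Nonneg-+ h (fromℕ-nonneg o))))

  fromℕ-injective : ∀ {m n} → fromℕ m ≈ fromℕ n → m ≡ n
  fromℕ-injective {m} {n} h = ℕ.≤-antisym
    (fromℕ-reflects-≤ m n (Nonneg-resp (trans (sym (-‿inverseʳ _)) (+-congˡ (-‿cong (sym h)))) Nonneg-0))
    (fromℕ-reflects-≤ n m (Nonneg-resp (trans (sym (-‿inverseʳ _)) (+-congˡ (-‿cong h))) Nonneg-0))

  -- From s r = k = ρ s follows s (r - ρ) = 0, and s can be cancelled. This identifies r with the
  -- number of lines through a point.
  ratio-unique : ∀ {s ρ k r} → r ≉ 0# → s ≢ 0 → fromℕ s ≈ fromℕ k * r ⁻¹ → ρ ℕ.* s ≡ k → r ≈ fromℕ ρ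
  ratio-unique {s} {ρ} {k} {r} r≉0 s≢0 s≈k/r ≡.refl = x-y≈0⇒x≈y (*-cancelˡ-≈0 (s≢0 ∘ fromℕ-injective) (begin
    fromℕ s * (r - fromℕ ρ)
      ≈⟨ solve 3 (λ s r p → s :* (r :- p) := s :* r :- p :* s) refl (fromℕ s) r (fromℕ ρ) ⟩
    fromℕ s * r - fromℕ ρ * fromℕ s
      ≈⟨ +-congʳ (*-congʳ s≈k/r) ⟩
    fromℕ (ρ ℕ.* s) * r ⁻¹ * r - fromℕ ρ * fromℕ s
      ≈⟨ +-cong (solve 3 (λ k i r → k :* i :* r := k :* (r :* i)) refl (fromℕ (ρ ℕ.* s)) (r ⁻¹) r) (-‿cong (sym (fromℕ-* ρ s))) ⟩
    fromℕ (ρ ℕ.* s) * (r * r ⁻¹) - fromℕ (ρ ℕ.* s)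
      ≈⟨ +-congʳ (trans (*-congˡ (inverseʳ r≉0)) (*-identityʳ _)) ⟩
    fromℕ (ρ ℕ.* s) - fromℕ (ρ ℕ.* s)
      ≈⟨ -‿inverseʳ _ ⟩
    0# ∎))

  bound-in-ℕ : ∀ {r β τ t φ₁ φ₂ e s} → r ≈ fromℕ (τ ℕ.+ t) → φ₁ ℕ.+ e ≡ φ₂ → fromℕ s ≈ β →
    Nonneg (β - ((r - fromℕ τ + 1#) * (fromℕ φ₂ - fromℕ φ₁) + fromℕ φ₁)) → suc t ℕ.* e ℕ.+ φ₁ ℕ.≤ s
  bound-in-ℕ {r} {β} {τ} {t} {φ₁} {φ₂} {e} {s} r≈ ≡.refl s≈β = fromℕ-reflects-≤ (suc t ℕ.* e ℕ.+ φ₁) s ∘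
    Nonneg-resp (+-cong (sym s≈β) (-‿cong (begin
      (r - fromℕ τ + 1#) * (fromℕ (φ₁ ℕ.+ e) - fromℕ φ₁) + fromℕ φ₁
        ≈⟨ +-congʳ (*-cong (+-congʳ (+-congʳ (trans r≈ (fromℕ-+ τ t)))) (+-congʳ (fromℕ-+ φ₁ e))) ⟩
      (fromℕ τ + fromℕ t - fromℕ τ + 1#) * (fromℕ φ₁ + fromℕ e - fromℕ φ₁) + fromℕ φ₁
        ≈⟨ solve 4 (λ τ t φ e → (τ :+ t :- τ :+ :1) :* (φ :+ e :- φ) :+ φ := (:1 :+ t) :* e :+ φ) refl
             (fromℕ τ) (fromℕ t) (fromℕ φ₁) (fromℕ e) ⟩
      fromℕ (suc t) * fromℕ e + fromℕ φ₁
        ≈⟨ +-congʳ (fromℕ-* (suc t) e) ⟨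
      fromℕ (suc t ℕ.* e) + fromℕ φ₁
        ≈⟨ fromℕ-+ (suc t ℕ.* e) φ₁ ⟨
      fromℕ (suc t ℕ.* e ℕ.+ φ₁) ∎)))

-- The equal line set property.

theorem27 : (R : RealClosedField) → let open RealClosedField R in let open Spectral R in
    ∀ {n : ℕ} (G : Graph n) (D : ℕ) (b c : ℕ → ℕ) → IsDRG G D b c → 3 ℕ.≤ D →
    (θ : Carrier) → IsSmallestEigenvalue G θ →
    {L : ℕ} (line : Fin L → Fin n → Bool) → IsGeometric G (b 0) θ line →
    (φ τ : ℕ → ℕ) → IsPhi G (b 0) θ φ → IsTau G line τ →
    let r = - θ in let β = fromℕ (b 0) * (r ⁻¹) in
    (r - fromℕ (τ 2) + 1#) * (fromℕ (φ 2) - fromℕ (φ 1)) + fromℕ (φ 1) ≤ β →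
    Lines.ELS G line
theorem27 R {n} G D b c (_ , (_ , x₀ , y₀ , dist≡D) , regular) 3≤D θ smallest {L} line
  (delsarte , unique) φ τ isPhi isTau bound = els
  where
  open StableField R
  open NaturalsInField R
  open AdjacencySpectrum R using (edge⇒smallestEigenvalue≢0)
  open Spectral R using (fromℕ)
  open FiniteCounting
  open Graph G using (adj)
  open Lines G line
  open import Relation.Binary.Reasoning.Setoid setoid

  -- The diameter is attained as a value of `dist`, and these values never exceed n.
  3≤n : 3 ℕ.≤ n
  3≤n = ℕ.≤-trans 3≤D (≡.subst (ℕ._≤ n) dist≡D (least≤ _ n))

  open Distances G 3≤n
  open LineCounting G 3≤n line (proj₁ ∘ delsarte)

  r β : Carrier
  r = - θ
  β = fromℕ (b 0) * r ⁻¹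

  near : ∀ x m → distSet G x (line m) ≡ 1 → neighboursOn x m ≡ φ 1
  near x m d = ≡.trans (≡.sym (neighboursOn≡ x m)) (isPhi (line m) (delsarte m) x 1 d)

  far : ∀ x m → distSet G x (line m) ≡ 2 → count (farOn x m) ≡ φ 2
  far x m d = isPhi (line m) (delsarte m) x 2 d

  brackets : ∀ x z → dist G z x ≡ 2 → count (bracket x z) ≡ τ 2
  brackets x z d = isTau z x 2 (ℕ.s≤s ℕ.z≤n) d

  degree : ∀ x → count (adj x) ≡ b 0
  degree x = ≡.trans (count-cong λ z → iff⇒≡
      (λ x~z → ∧-intro x~z (⌊⌋-intro (dist G x z ℕ.≟ 1) (~⇒dist≡1 x~z)))
      (proj₁ ∘ ∧-elim {adj x z}))
    (proj₂ (regular x x 0 (dist-refl x)))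

  size≈ : ∀ m → fromℕ (count (line m)) ≈ 1# + β
  size≈ m = pure (proj₂ (delsarte m))

  size≡ : ∀ m l → count (line m) ≡ count (line l)
  size≡ m l = fromℕ-injective (trans (size≈ m) (sym (size≈ l)))

  -- The line l has 1 + s points with s = β. Counting bounds 1 + s by (t + 1) e + φ₁, while the
  -- hypothesis bounds (t + 1) e + φ₁ by s.
  not-separated : ∀ {x l y₁ y₂ m} → distSet G x (line l) ≡ 1 → y₁ ∈ l → y₂ ∈ l →
    dist G x y₁ ≡ 2 → dist G x y₂ ≡ 2 → bracket x y₂ m ≡ true → bracket x y₁ m ≡ false → ⊥
  not-separated {x} {l} {y₁} dxl y₁∈l y₂∈l d₁ d₂ ∈b₂ ∉b₁
    with separated-bound near far brackets dxl y₁∈l y₂∈l d₁ d₂ ∈b₂ ∉b₁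
       | ℕ.m≤n⇒∃[o]m+o≡n (count-pos (line l) y₁ y₁∈l) | distSet≡1⇒ dxl
  ... | e , t , φ₁+e≡φ₂ , τ₂+t≡ρ , size≤ | s , 1+s≡size | _ , z , _ , x~z =
    ℕ.<⇒≱ (≡.subst (ℕ._≤ suc t ℕ.* e ℕ.+ φ 1) (≡.sym 1+s≡size) size≤)
      (bound-in-ℕ {τ = τ 2} {t} {φ 1} {φ 2} {e} {s}
        (≡.subst (λ k → r ≈ fromℕ k) (≡.sym τ₂+t≡ρ) (ratio-unique {ρ = count λ m → line m x} r≉0 s≢0 s≈β ρs≡k)) φ₁+e≡φ₂ s≈β (≤⇒Nonneg bound))
    where
    r≉0 : r ≉ 0#
    r≉0 -θ≈0 = θ≈0 (edge⇒smallestEigenvalue≢0 G x~z smallest)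
      where
      θ≈0 : θ ≈ 0#
      θ≈0 = trans (solve 1 (λ θ → θ := :- (:- θ)) refl θ) (trans (-‿cong -θ≈0) (solve 0 (:- :0 := :0) refl))
    s≈β : fromℕ s ≈ β
    s≈β = begin
      fromℕ s                            ≈⟨ solve 1 (λ s → s := :- :1 :+ (:1 :+ s)) refl (fromℕ s) ⟩
      - 1# + fromℕ (suc s)               ≡⟨ ≡.cong (λ k → - 1# + fromℕ k) 1+s≡size ⟩
      - 1# + fromℕ (count (line l))      ≈⟨ +-congˡ (size≈ l) ⟩
      - 1# + (1# + β)                    ≈⟨ solve 1 (λ b → :- :1 :+ (:1 :+ b) := b) refl β ⟩
      β                                  ∎
    ρs≡k : count (λ m → line m x) ℕ.* s ≡ b 0
    ρs≡k = ≡.trans (neighbours-on-lines (λ m → ≡.trans (size≡ m l) (≡.sym 1+s≡size)) unique x) (degree x)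
    -- Otherwise the valency ρ s would be 0, although x has the neighbour z on l.
    s≢0 : s ≢ 0
    s≢0 ≡.refl = ℕ.<⇒≢ (≡.subst (1 ℕ.≤_) (degree x) (count-pos (adj x) z x~z)) (≡.trans (≡.sym (ℕ.*-zeroʳ (count λ m → line m x))) ρs≡k)

  els : ELS
  els x l dxl y₁ y₂ y₁∈l y₂∈l _ d₁ d₂ m with bracket x y₁ m in b₁ | bracket x y₂ m in b₂
  ... | true  | true  = ≡.refl
  ... | false | false = ≡.refl
  ... | false | true  = ⊥-elim (not-separated dxl y₁∈l y₂∈l d₁ d₂ b₂ b₁)
  ... | true  | false = ⊥-elim (not-separated dxl y₂∈l y₁∈l d₂ d₁ b₁ b₂)
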